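{- Every countable model of set theory $\langle M,\in^M\rangle$ is isomorphic to a submodel of its own constructible universe $\langle L^M,\in^M\rangle$. In other words, there is a function $j:M\to L^M$ such that $x\in^M y \iff j(x)\in^M j(y)$ for all $x,y\in M$, and $j$ is an isomorphism of $\langle M,\in^M\rangle$ with the submodel of $\langle L^M,\in^M\rangle$ on its range.
   Context: A model of set theory is a first-order structure $\langle M,\in^M\rangle$ in the language with one binary relation symbol that satisfies at least the axioms of Kripke–Platek set theory KP; it need not be well-founded or transitive. $L^M$ is the constructible universe as defined inside $M$, i.e. the set of all $x\in M$ with $M\models x\in L$. A submodel of $\langle N,\in^N\rangle$ is an arbitrary subset of $N$ with the restriction of $\in^N$ (an induced substructure, not required to satisfy any axioms). An embedding of one such structure into another is an isomorphism onto a submodel. No definability of $j$ in $M$ is claimed. -}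

module Defs where

open import Data.Empty.Polymorphic using (⊥)
open import Data.Fin using (Fin; zero; suc)
open import Data.Nat using (ℕ; suc)
open import Data.Product using (∃-syntax; _×_)
open import Data.Sum using (_⊎_)
open import Data.Vec using (Vec; _∷_; lookup)
open import Function.Bundles using (_⇔_; _↣_)
open import Function.Definitions using (Injective)
open import Level using (Level) renaming (suc to lsuc)
open import Relation.Binary.Core using (Rel)
open import Relation.Binary.PropositionalEquality using (_≡_)
open import Relation.Nullary using (¬_)
open import Relation.Unary using (Pred)

-- First-order formulas of the language {∈, =}, with n free variables
-- (de Bruijn indices).
data Formula (n : ℕ) : Set where
  _∈̇_ _≐_       : Fin n → Fin n → Formula n
  ⊥̇             : Formula n
  _∧̇_ _∨̇_ _⇒̇_ : Formula n → Formula n → Formula n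
  ∀̇_ ∃̇_       : Formula (suc n) → Formula n

data Δ₀ {n : ℕ} : Formula n → Set where
  mem  : ∀ {i j} → Δ₀ (i ∈̇ j)
  eq   : ∀ {i j} → Δ₀ (i ≐ j)
  bot  : Δ₀ ⊥̇
  conj : ∀ {φ ψ} → Δ₀ φ → Δ₀ ψ → Δ₀ (φ ∧̇ ψ)
  disj : ∀ {φ ψ} → Δ₀ φ → Δ₀ ψ → Δ₀ (φ ∨̇ ψ)
  impl : ∀ {φ ψ} → Δ₀ φ → Δ₀ ψ → Δ₀ (φ ⇒̇ ψ)
  ball : ∀ {i φ} → Δ₀ φ → Δ₀ (∀̇ ((zero ∈̇ suc i) ⇒̇ φ))
  bex  : ∀ {i φ} → Δ₀ φ → Δ₀ (∃̇ ((zero ∈̇ suc i) ∧̇ φ))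

record Structure (ℓ : Level) : Set (lsuc ℓ) where
  infix 4 _∈_
  field
    Carrier : Set ℓ
    _∈_     : Rel Carrier ℓ

Countable : ∀ {ℓ} → Structure ℓ → Set ℓ
Countable 𝓜 = Structure.Carrier 𝓜 ↣ ℕ

module _ {ℓ : Level} (𝓜 : Structure ℓ) where
  open Structure 𝓜 renaming (Carrier to M)

  Sat : ∀ {n} → Formula n → Vec M n → Set ℓ
  Sat (i ∈̇ j)  ρ = lookup ρ i ∈ lookup ρ j
  Sat (i ≐ j)  ρ = lookup ρ i ≡ lookup ρ j
  Sat ⊥̇        ρ = ⊥
  Sat (φ ∧̇ ψ) ρ = Sat φ ρ × Sat ψ ρ
  Sat (φ ∨̇ ψ) ρ = Sat φ ρ ⊎ Sat ψ ρ
  Sat (φ ⇒̇ ψ) ρ = Sat φ ρ → Sat ψ ρ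
  Sat (∀̇ φ)    ρ = ∀ x → Sat φ (x ∷ ρ)
  Sat (∃̇ φ)    ρ = ∃[ x ] Sat φ (x ∷ ρ)

  -- Kripke–Platek set theory, with foundation for all formulas and without
  -- the axiom of infinity.  The vector ρ supplies the parameters of a schema.
  record IsKPModel : Set ℓ where
    field
      extensionality : ∀ x y → (∀ z → z ∈ x ⇔ z ∈ y) → x ≡ y
      empty          : ∃[ x ] ∀ y → ¬ (y ∈ x)
      pairing        : ∀ x y → ∃[ p ] ∀ z → z ∈ p ⇔ (z ≡ x ⊎ z ≡ y)
      union          : ∀ x → ∃[ u ] ∀ z → z ∈ u ⇔ (∃[ y ] y ∈ x × z ∈ y)
      foundation     : ∀ {n} (φ : Formula (suc n)) (ρ : Vec M n) →
                       (∃[ x ] Sat φ (x ∷ ρ)) →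
                       ∃[ x ] Sat φ (x ∷ ρ) × (∀ y → y ∈ x → ¬ Sat φ (y ∷ ρ))
      Δ₀-separation  : ∀ {n} (φ : Formula (suc n)) → Δ₀ φ → (ρ : Vec M n) →
                       ∀ a → ∃[ b ] ∀ x → x ∈ b ⇔ (x ∈ a × Sat φ (x ∷ ρ))
      Δ₀-collection  : ∀ {n} (φ : Formula (suc (suc n))) → Δ₀ φ → (ρ : Vec M n) →
                       ∀ a → (∀ x → x ∈ a → ∃[ y ] Sat φ (y ∷ x ∷ ρ)) →
                       ∃[ b ] ∀ x → x ∈ a → ∃[ y ] y ∈ b × Sat φ (y ∷ x ∷ ρ)

  -- From here to IsConstructible, each definition is a first-order formula of
  -- {∈, =} written out in its interpretation in 𝓜: every quantifier ranges
  -- over M.  In particular "ordinal", "natural number" and "finite sequence"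
  -- have their internal meaning, and may be nonstandard.

  _⊆_ : Rel M ℓ
  x ⊆ y = ∀ z → z ∈ x → z ∈ y

  IsEmpty : Pred M ℓ
  IsEmpty x = ∀ y → ¬ (y ∈ x)

  IsPair : M → M → M → Set ℓ
  IsPair p x y = ∀ z → z ∈ p ⇔ (z ≡ x ⊎ z ≡ y)

  -- p = ⟨x , y⟩ = {{x}, {x, y}}
  IsOrderedPair : M → M → M → Set ℓ
  IsOrderedPair p x y = ∃[ u ] ∃[ v ] IsPair u x x × IsPair v x y × IsPair p u v

  -- y = x ∪ {x}
  IsSuc : M → M → Set ℓ
  IsSuc y x = ∀ z → z ∈ y ⇔ (z ∈ x ⊎ z ≡ x)

  IsTransitive : Pred M ℓ
  IsTransitive x = ∀ y → y ∈ x → y ⊆ x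

  IsOrdinal : Pred M ℓ
  IsOrdinal α = IsTransitive α × (∀ β → β ∈ α → IsTransitive β)

  IsLimit : Pred M ℓ
  IsLimit α = IsOrdinal α × ¬ IsEmpty α × ¬ (∃[ β ] IsSuc α β)

  IsNat : Pred M ℓ
  IsNat n = IsOrdinal n ×
            (∀ m → m ∈ n ⊎ m ≡ n → IsEmpty m ⊎ (∃[ k ] IsSuc m k))

  -- ⟨x , y⟩ ∈ f
  Maps : M → M → M → Set ℓ
  Maps f x y = ∃[ p ] IsOrderedPair p x y × p ∈ f

  -- f is a function with domain d
  IsFunction : M → M → Set ℓ
  IsFunction f d =
    (∀ p → p ∈ f → ∃[ x ] ∃[ y ] x ∈ d × IsOrderedPair p x y) ×
    (∀ x → x ∈ d → ∃[ y ] Maps f x y × (∀ y′ → Maps f x y′ → y′ ≡ y))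

  -- s ∈ Aⁿ
  IsTuple : M → M → M → Set ℓ
  IsTuple A n s = IsFunction s n × (∀ i x → Maps s i x → x ∈ A)

  -- The definable relations over ⟨A , ∈⟩ are obtained as in Gödel's and
  -- Kunen's definition of the definable power set, by closing the atomic
  -- relations under the operations on relations corresponding to ¬, ∧ and ∃.
  -- A relation R ⊆ Aⁿ is the set of tuples satisfying a formula in the
  -- variables v₀, …, vₙ₋₁.

  -- R = {s ∈ Aⁿ : s(i) ∈ s(j)}
  IsDiag∈ : M → M → M → M → M → Set ℓ
  IsDiag∈ A n i j R = ∀ s → s ∈ R ⇔
    (IsTuple A n s × (∃[ x ] ∃[ y ] Maps s i x × Maps s j y × x ∈ y))

  -- R = {s ∈ Aⁿ : s(i) = s(j)}
  IsDiag≡ : M → M → M → M → M → Set ℓ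
  IsDiag≡ A n i j R = ∀ s → s ∈ R ⇔
    (IsTuple A n s × (∃[ x ] ∃[ y ] Maps s i x × Maps s j y × x ≡ y))

  -- R = Aⁿ ∖ R₁
  IsComplement : M → M → M → M → Set ℓ
  IsComplement A n R₁ R = ∀ s → s ∈ R ⇔ (IsTuple A n s × ¬ (s ∈ R₁))

  -- R = R₁ ∩ R₂
  IsIntersection : M → M → M → Set ℓ
  IsIntersection R₁ R₂ R = ∀ s → s ∈ R ⇔ (s ∈ R₁ × s ∈ R₂)

  -- R = {t ↾ n : t ∈ R₁}, for R₁ ⊆ Aⁿ⁺¹; for tuples s ∈ Aⁿ and t ∈ Aⁿ⁺¹,
  -- t ↾ n = s amounts to s ⊆ t.
  IsProjection : M → M → M → M → Set ℓ
  IsProjection A n R₁ R = ∀ s → s ∈ R ⇔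
    (IsTuple A n s × (∃[ t ] t ∈ R₁ × s ⊆ t))

  -- g(k) = ⟨n , R⟩
  Lists : M → M → M → M → Set ℓ
  Lists g k n R = ∃[ e ] IsOrderedPair e n R × Maps g k e

  -- ⟨n , R⟩ = g(k) for some k ∈ i
  ListedBefore : M → M → M → M → Set ℓ
  ListedBefore g i n R = ∃[ k ] k ∈ i × Lists g k n R

  -- ⟨n , R⟩ is a legitimate i-th entry of the sequence g
  IsFormationStep : M → M → M → M → M → Set ℓ
  IsFormationStep A g i n R =
      (∃[ j ] ∃[ k ] j ∈ n × k ∈ n × IsDiag∈ A n j k R)
    ⊎ (∃[ j ] ∃[ k ] j ∈ n × k ∈ n × IsDiag≡ A n j k R)
    ⊎ (∃[ R₁ ] ListedBefore g i n R₁ × IsComplement A n R₁ R)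
    ⊎ (∃[ R₁ ] ∃[ R₂ ] ListedBefore g i n R₁ × ListedBefore g i n R₂ ×
                       IsIntersection R₁ R₂ R)
    ⊎ (∃[ m ] ∃[ R₁ ] IsSuc m n × ListedBefore g i m R₁ × IsProjection A n R₁ R)

  -- g is a sequence of length l, every entry of which is a pair ⟨n , R⟩
  -- obtained from the atomic relations and earlier entries
  IsFormationSequence : M → M → M → Set ℓ
  IsFormationSequence A l g =
    IsNat l × IsFunction g l ×
    (∀ i → i ∈ l → ∃[ n ] ∃[ R ]
       IsNat n × Lists g i n R × IsFormationStep A g i n R)

  IsDefinableRelation : M → M → M → Set ℓ
  IsDefinableRelation A n R =
    ∃[ l ] ∃[ g ] IsFormationSequence A l g × ListedBefore g l n R

  -- z = {x ∈ A : s ⌢ ⟨x⟩ ∈ R} for some n ∈ ω, s ∈ Aⁿ and definable R ⊆ Aⁿ⁺¹;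
  -- for t ∈ Aⁿ⁺¹, t = s ⌢ ⟨x⟩ amounts to s ⊆ t and t(n) = x.
  IsDefinableSubset : M → M → Set ℓ
  IsDefinableSubset A z =
    ∃[ n ] ∃[ m ] ∃[ s ] ∃[ R ]
      IsNat n × IsSuc m n × IsTuple A n s × IsDefinableRelation A m R ×
      (∀ x → x ∈ z ⇔ (x ∈ A × (∃[ t ] t ∈ R × s ⊆ t × Maps t n x)))

  -- D = Def(A)
  IsDef : M → M → Set ℓ
  IsDef D A = ∀ z → z ∈ D ⇔ IsDefinableSubset A z

  -- f = ⟨L_β : β ≤ α⟩
  IsLHierarchy : M → M → Set ℓ
  IsLHierarchy α f =
    (∃[ d ] IsSuc d α × IsFunction f d) ×
    (∀ β y → Maps f β y →
      (IsEmpty β → IsEmpty y) ×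
      (∀ γ w → IsSuc β γ → Maps f γ w → IsDef y w) ×
      (IsLimit β → ∀ z → z ∈ y ⇔ (∃[ γ ] ∃[ w ] γ ∈ β × Maps f γ w × z ∈ w)))

  -- y = L_α
  IsLLevel : M → M → Set ℓ
  IsLLevel α y = IsOrdinal α × (∃[ f ] IsLHierarchy α f × Maps f α y)

  -- the class L^𝓜
  IsConstructible : Pred M ℓ
  IsConstructible x = ∃[ α ] ∃[ y ] IsLLevel α y × x ∈ y

  -- j is an isomorphism of 𝓜 with a submodel of the induced substructure of
  -- 𝓜 on P, namely the one on the range of j.
  record IsEmbeddingInto (P : Pred M ℓ) (j : M → M) : Set ℓ where
    field
      into      : ∀ x → P (j x)
      injective : Injective _≡_ _≡_ j
      ∈-iff     : ∀ x y → x ∈ y ⇔ j x ∈ j y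

{-# OPTIONS --safe #-}
-- A model with an inductive set.  Let aᵢ be the element with code i in the given enumeration,
-- and let α(a) be a rank of a with α(b) + 1 ∈ α(a) for b ∈ a, computed from ω upwards.  Fix
-- markers pᵢ, qᵢ ∈ L_ω forming an antichain for ∈, and put
--
--   j(aᵢ) = {y ∈ L_α(aᵢ) : y ∈ Pᵢ or y meets Qᵢ},
--   Pᵢ = {qᵢ} ∪ {pₖ : k < i, aᵢ ∈ aₖ},   Qᵢ = {pᵢ} ∪ {qₖ : k < i, aₖ ∈ aᵢ}.
--
-- The markers in j(aₖ) record k and the indices i < k with aₖ ∈ aᵢ.  Hence whichever of i, k is
-- larger, j(aₖ) can satisfy the condition defining j(aᵢ) only if aₖ ∈ aᵢ; conversely, if aₖ ∈ aᵢ
-- then j(aₖ) ∈ L_{α(aₖ)+1} ⊆ L_α(aᵢ).  No recursion along α is needed: j(aᵢ) is definable over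
-- L_α(aᵢ) from finitely many parameters.
--
-- A model without an inductive set.  All ordinals are natural numbers and all sets are finite, so
-- that Def(A) is the power set of A, every set x lies in L_{rank(x)+1}, and j is the identity.
--
-- That the L-hierarchy exists at all is KP's Σ-recursion theorem.  It is applied through a calculus
-- of set functions with Σ₁ graphs, closed under composition, {t(x) : x ∈ u, φ(x)} with φ Δ₁, and
-- ∈-recursion.
module Submission where

open import Defs hiding (_⊆_)
open import Axiom.ExcludedMiddle using (ExcludedMiddle)
open import Data.Empty.Polymorphic using (⊥)
open import Data.Fin using (Fin; zero; suc)
open import Data.List using (List; []; _∷_) renaming (_++_ to _++ᴸ_)
open import Data.List.Relation.Unary.All.Properties using () renaming (++⁺ to All-++)
open import Data.List.Relation.Unary.Any.Properties using () renaming (++⁻ to Any-++⁻; ++⁺ˡ to Any-++ˡ; ++⁺ʳ to Any-++ʳ)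
open import Data.List.Relation.Unary.All using (All; []; _∷_)
open import Data.List.Relation.Unary.Any using (Any; here; there)
open import Data.Nat using (ℕ; zero; suc; _+_; _<_)
open import Data.Nat.Properties using (<-cmp; m≤n⇒m≤1+n; m<1+n⇒m<n∨m≡n; n<1+n; suc-injective)
open import Relation.Binary.Definitions using (tri<; tri≈; tri>)
open import Data.Product using (∃; ∃-syntax; _×_; _,_; proj₁; proj₂)
open import Data.Product.Function.NonDependent.Propositional using (_×-⇔_)
open import Data.Unit.Polymorphic using (⊤; tt)
open import Data.Sum using (_⊎_; inj₁; inj₂; [_,_])
open import Data.Sum.Function.Propositional using (_⊎-⇔_)
open import Data.Vec using (Vec; []; _∷_; lookup; head; tail; map; _++_)
open import Data.Vec.Properties using (lookup-map)
open import Function using (_∘_; case_of_)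
open import Function.Bundles using (_⇔_; mk⇔; module Equivalence; module Injection)
open Equivalence using (to; from)
open import Level using (Level)
open import Relation.Binary.PropositionalEquality using (_≡_; _≢_; refl; sym; trans; cong; cong₂; subst; subst₂)
open import Relation.Nullary using (¬_; yes; no; contradiction)
open import Function.Properties.Equivalence using () renaming (refl to ⇔-id; sym to ⇔-sym; trans to ⇔-trans)

-- Since 𝓜 may be ill-founded, no recursion along its membership relation is possible from outside,
-- and inside 𝓜 neither the enumeration nor j need be definable. The order of the codes is
-- well-founded, but defining j(aᵢ) from the earlier values j(aₖ) over L_α(aᵢ) would require these
-- values as parameters there, and aₖ may have larger rank than aᵢ. Markers replace the values: they
-- name indices, and as elements of L_ω they belong to every level used. So each j(aᵢ) is written
-- down at once, with no reference to any other value of j. The antichain condition keeps a marker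
-- from meeting Qᵢ, and keeps a set that contains a marker from being one.
--
-- The case distinction comes from `Def`. Collecting all definable subsets of A ranges over
-- formation sequences of every length, and KP can gather these into a set once the natural numbers
-- form one. Without such a set another Σ₁ description of `Def` is required, and the power set
-- provides it. In that case lengths and cardinalities may still be nonstandard, so a disjunction
-- over the elements of a set is formed by induction inside 𝓜.

private variable
  a b : Level
  A A′ B B′ : Set a

→-⇔ : A ⇔ A′ → B ⇔ B′ → (A → B) ⇔ (A′ → B′)
→-⇔ e f = mk⇔ (λ h x → to f (h (from e x))) (λ h x → from f (h (to e x)))

∀-⇔ : {P Q : A → Set b} → (∀ x → P x ⇔ Q x) → (∀ x → P x) ⇔ (∀ x → Q x)
∀-⇔ e = mk⇔ (λ h x → to (e x) (h x)) (λ h x → from (e x) (h x))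

∃-⇔ : {P Q : A → Set b} → (∀ x → P x ⇔ Q x) → ∃ P ⇔ ∃ Q
∃-⇔ e = mk⇔ (λ { (x , p) → x , to (e x) p }) (λ { (x , p) → x , from (e x) p })

¬-⇔ : A ⇔ B → (¬ A) ⇔ (¬ B)
¬-⇔ e = mk⇔ (λ h b → h (from e b)) (λ h a → h (to e a))

≡⇒⇔ : {A B : Set a} → A ≡ B → A ⇔ B
≡⇒⇔ refl = ⇔-id

private variable
  n m k : ℕ

-- Definable predicates, functions with Σ₁ graph, Δ₁-separation and Σ₁-collection.

module Definability
  {ℓ : Level} (em : ExcludedMiddle ℓ) (𝓜 : Structure ℓ) (kp : IsKPModel 𝓜) where
  open Structure 𝓜 renaming (Carrier to M)
  open IsKPModel kp

  Env : ℕ → Set ℓ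
  Env = Vec M

  ⊥-elim′ : ∀ {a} {A : Set a} → ⊥ {ℓ} → A
  ⊥-elim′ ()

  by-contradiction : {P : Set ℓ} → ¬ ¬ P → P
  by-contradiction {P} nn with em {P}
  ... | yes p = p
  ... | no np = contradiction np nn

  lift-ren : (Fin n → Fin m) → Fin (suc n) → Fin (suc m)
  lift-ren r zero    = zero
  lift-ren r (suc i) = suc (r i)

  ren : (Fin n → Fin m) → Formula n → Formula m
  ren r (i ∈̇ j)  = r i ∈̇ r j
  ren r (i ≐ j)  = r i ≐ r j
  ren r ⊥̇        = ⊥̇
  ren r (φ ∧̇ ψ) = ren r φ ∧̇ ren r ψ
  ren r (φ ∨̇ ψ) = ren r φ ∨̇ ren r ψ
  ren r (φ ⇒̇ ψ) = ren r φ ⇒̇ ren r ψ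
  ren r (∀̇ φ)    = ∀̇ (ren (lift-ren r) φ)
  ren r (∃̇ φ)    = ∃̇ (ren (lift-ren r) φ)

  ren-Δ₀ : (r : Fin n → Fin m) {φ : Formula n} → Δ₀ φ → Δ₀ (ren r φ)
  ren-Δ₀ r mem        = mem
  ren-Δ₀ r eq         = eq
  ren-Δ₀ r bot        = bot
  ren-Δ₀ r (conj d e) = conj (ren-Δ₀ r d) (ren-Δ₀ r e)
  ren-Δ₀ r (disj d e) = disj (ren-Δ₀ r d) (ren-Δ₀ r e)
  ren-Δ₀ r (impl d e) = impl (ren-Δ₀ r d) (ren-Δ₀ r e)
  ren-Δ₀ r (ball d)   = ball (ren-Δ₀ (lift-ren r) d)
  ren-Δ₀ r (bex d)    = bex (ren-Δ₀ (lift-ren r) d)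

  Agree : (Fin n → Fin m) → Env m → Env n → Set ℓ
  Agree r σ ρ = ∀ i → lookup σ (r i) ≡ lookup ρ i

  lift-agree : ∀ {r : Fin n → Fin m} {σ ρ} x → Agree r σ ρ → Agree (lift-ren r) (x ∷ σ) (x ∷ ρ)
  lift-agree x a zero    = refl
  lift-agree x a (suc i) = a i

  ren-sat : ∀ (r : Fin n → Fin m) φ {σ ρ} → Agree r σ ρ → Sat 𝓜 (ren r φ) σ ⇔ Sat 𝓜 φ ρ
  ren-sat r (i ∈̇ j)  a = mk⇔ (subst₂ _∈_ (a i) (a j)) (subst₂ _∈_ (sym (a i)) (sym (a j)))
  ren-sat r (i ≐ j)  a = mk⇔ (λ e → trans (sym (a i)) (trans e (a j)))
                             (λ e → trans (a i) (trans e (sym (a j))))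
  ren-sat r ⊥̇        a = ⇔-id
  ren-sat r (φ ∧̇ ψ) a = ren-sat r φ a ×-⇔ ren-sat r ψ a
  ren-sat r (φ ∨̇ ψ) a = ren-sat r φ a ⊎-⇔ ren-sat r ψ a
  ren-sat r (φ ⇒̇ ψ) a = →-⇔ (ren-sat r φ a) (ren-sat r ψ a)
  ren-sat r (∀̇ φ)    a = ∀-⇔ λ x → ren-sat (lift-ren r) φ (lift-agree x a)
  ren-sat r (∃̇ φ)    a = ∃-⇔ λ x → ren-sat (lift-ren r) φ (lift-agree x a)

  -- `index` acts on formulas and `env` on environments. Keeping `env` as a function of its own,
  -- tied to `index` by `agree`, lets renamed predicates reduce by computation on explicit
  -- environments.
  record Renaming (n m : ℕ) : Set ℓ where
    field
      index : Fin n → Fin m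
      env   : Env m → Env n
      agree : ∀ σ → Agree index σ (env σ)
  open Renaming

  weaken : Renaming n (suc n)
  weaken .index       = suc
  weaken .env (x ∷ σ) = σ
  weaken .agree (x ∷ σ) i = refl

  lift : Renaming n m → Renaming (suc n) (suc m)
  lift r .index         = lift-ren (r .index)
  lift r .env (x ∷ σ)   = x ∷ r .env σ
  lift r .agree (x ∷ σ) = lift-agree x (r .agree σ)

  pick : Vec (Fin m) n → Renaming n m
  pick is .index i = lookup is i
  pick is .env σ   = map (lookup σ) is
  pick is .agree σ i = sym (lookup-map i (lookup σ) is)

  drops : ∀ k → Renaming n (k + n)
  drops zero    .index i = i
  drops zero    .env σ   = σ
  drops zero    .agree σ i = refl
  drops (suc k) .index i = suc (drops k .index i)
  drops (suc k) .env (x ∷ σ) = drops k .env σ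
  drops (suc k) .agree (x ∷ σ) = drops k .agree σ

  keeps : ∀ k → Renaming k (k + n)
  keeps zero    .index ()
  keeps zero    .env σ = []
  keeps zero    .agree σ ()
  keeps (suc k) = lift (keeps k)

  drops-++ : (xs : Env k) (ρ : Env n) → drops k .env (xs ++ ρ) ≡ ρ
  drops-++ []       ρ = refl
  drops-++ (x ∷ xs) ρ = drops-++ xs ρ

  keeps-++ : (xs : Env k) (ρ : Env n) → keeps k .env (xs ++ ρ) ≡ xs
  keeps-++ []       ρ = refl
  keeps-++ (x ∷ xs) ρ = cong (x ∷_) (keeps-++ xs ρ)

  -- The schemas of KP speak of formulas, the arguments below of Agda predicates. This record and
  -- the next three attach a formula to a predicate, so that closure lemmas take the place of
  -- explicit syntax.
  record FO {n} (P : Env n → Set ℓ) : Set ℓ where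
    no-eta-equality; pattern
    constructor fo
    field
      formula : Formula n
      sat     : ∀ ρ → Sat 𝓜 formula ρ ⇔ P ρ
  open FO

  record D₀ {n} (P : Env n → Set ℓ) : Set ℓ where
    no-eta-equality; pattern
    constructor d₀
    field
      formula : Formula n
      bounded : Δ₀ formula
      sat     : ∀ ρ → Sat 𝓜 formula ρ ⇔ P ρ
  open D₀

  record Σ₁ {n} (P : Env n → Set ℓ) : Set ℓ where
    no-eta-equality
    constructor σ₁
    field
      matrix  : Formula (suc n)
      bounded : Δ₀ matrix
      sat     : ∀ ρ → (∃[ w ] Sat 𝓜 matrix (w ∷ ρ)) ⇔ P ρ
  open Σ₁

  -- This is Δ₁ relative to 𝓜: the two Σ₁ formulas are complementary in this model, with no claim
  -- about other models of KP.
  record Δ₁ {n} (P : Env n → Set ℓ) : Set ℓ where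
    no-eta-equality
    constructor δ₁
    field
      pos : Σ₁ P
      neg : Σ₁ (λ ρ → ¬ P ρ)
  open Δ₁

  private variable
    P Q : Env n → Set ℓ

  mem₀ : (i j : Fin n) → D₀ (λ ρ → lookup ρ i ∈ lookup ρ j)
  mem₀ i j = d₀ (i ∈̇ j) mem λ ρ → ⇔-id

  eq₀ : (i j : Fin n) → D₀ (λ ρ → lookup ρ i ≡ lookup ρ j)
  eq₀ i j = d₀ (i ≐ j) eq λ ρ → ⇔-id

  and₀ : D₀ P → D₀ Q → D₀ (λ ρ → P ρ × Q ρ)
  and₀ (d₀ φ δ s) (d₀ ψ ε t) = d₀ (φ ∧̇ ψ) (conj δ ε) λ ρ → s ρ ×-⇔ t ρ

  or₀ : D₀ P → D₀ Q → D₀ (λ ρ → P ρ ⊎ Q ρ)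
  or₀ (d₀ φ δ s) (d₀ ψ ε t) = d₀ (φ ∨̇ ψ) (disj δ ε) λ ρ → s ρ ⊎-⇔ t ρ

  not₀ : D₀ P → D₀ (λ ρ → ¬ P ρ)
  not₀ (d₀ φ δ s) = d₀ (φ ⇒̇ ⊥̇) (impl δ bot) λ ρ →
    mk⇔ (λ h p → case h (from (s ρ) p) of λ ()) (λ h p → contradiction (to (s ρ) p) h)

  bex₀ : (i : Fin n) → D₀ P → D₀ (λ ρ → ∃[ x ] x ∈ lookup ρ i × P (x ∷ ρ))
  bex₀ i (d₀ φ δ s) = d₀ (∃̇ ((zero ∈̇ suc i) ∧̇ φ)) (bex δ) λ ρ → ∃-⇔ λ x → ⇔-id ×-⇔ s (x ∷ ρ)

  ball₀ : (i : Fin n) → D₀ P → D₀ (λ ρ → ∀ x → x ∈ lookup ρ i → P (x ∷ ρ))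
  ball₀ i (d₀ φ δ s) = d₀ (∀̇ ((zero ∈̇ suc i) ⇒̇ φ)) (ball δ) λ ρ → ∀-⇔ λ x → →-⇔ ⇔-id (s (x ∷ ρ))

  ren₀ : (r : Renaming n m) → D₀ P → D₀ (λ σ → P (r .env σ))
  ren₀ r (d₀ φ δ s) = d₀ (ren (r .index) φ) (ren-Δ₀ (r .index) δ)
    λ σ → ⇔-trans (ren-sat (r .index) φ (r .agree σ)) (s _)

  ren-FO : (r : Renaming n m) → FO P → FO (λ σ → P (r .env σ))
  ren-FO r (fo φ s) = fo (ren (r .index) φ)
    λ σ → ⇔-trans (ren-sat (r .index) φ (r .agree σ)) (s _)

  ∅ : M
  ∅ = proj₁ empty

  ∉∅ : ∀ {x} → ¬ (x ∈ ∅)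
  ∉∅ = proj₂ empty _

  ext : ∀ {x y} → (∀ z → z ∈ x → z ∈ y) → (∀ z → z ∈ y → z ∈ x) → x ≡ y
  ext f g = extensionality _ _ λ z → mk⇔ (f z) (g z)

  abstract
    ⟅_,_⟆ : M → M → M
    ⟅ x , y ⟆ = proj₁ (pairing x y)

    ∈⟅⟆ : ∀ {x y z} → z ∈ ⟅ x , y ⟆ ⇔ (z ≡ x ⊎ z ≡ y)
    ∈⟅⟆ = proj₂ (pairing _ _) _

    ⋃ : M → M
    ⋃ x = proj₁ (union x)

    ∈⋃ : ∀ {x z} → z ∈ ⋃ x ⇔ (∃[ y ] y ∈ x × z ∈ y)
    ∈⋃ = proj₂ (union _) _

  private
    matrix₀ : (p : Σ₁ P) → D₀ (Sat 𝓜 (p .matrix))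
    matrix₀ p = d₀ _ (p .bounded) λ ρ → ⇔-id

    mkΣ₁ : {Q : Env (suc n) → Set ℓ} → D₀ Q → (∀ ρ → (∃[ w ] Q (w ∷ ρ)) ⇔ P ρ) → Σ₁ P
    mkΣ₁ (d₀ φ δ s) e = σ₁ φ δ λ ρ → ⇔-trans (∃-⇔ λ w → s (w ∷ ρ)) (e ρ)

    under : Renaming (suc n) (suc (suc n))
    under = lift weaken

  abstract
    resp₁ : (∀ ρ → P ρ ⇔ Q ρ) → Σ₁ P → Σ₁ Q
    resp₁ e p = σ₁ (p .matrix) (p .bounded) λ ρ → ⇔-trans (p .sat ρ) (e ρ)

    Δ₀⇒Σ₁ : D₀ P → Σ₁ P
    Δ₀⇒Σ₁ d = mkΣ₁ (ren₀ weaken d) λ ρ → mk⇔ proj₂ (∅ ,_)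

    ren₁ : (r : Renaming n m) → Σ₁ P → Σ₁ (λ σ → P (r .env σ))
    ren₁ r p = mkΣ₁ (ren₀ (lift r) (matrix₀ p)) λ σ → p .sat (r .env σ)

    -- The new witness is a set in which bounded quantifiers find both old ones; pairing supplies
    -- it. The same device contracts two unbounded quantifiers in `ex₁`.
    and₁ : Σ₁ P → Σ₁ Q → Σ₁ (λ ρ → P ρ × Q ρ)
    and₁ p q = mkΣ₁
      (and₀ (bex₀ zero (ren₀ under (matrix₀ p))) (bex₀ zero (ren₀ under (matrix₀ q))))
      λ ρ → mk⇔
        (λ { (w , (u , _ , s) , (v , _ , t)) → to (p .sat ρ) (u , s) , to (q .sat ρ) (v , t) })
        (λ { (a , b) → let u , s = from (p .sat ρ) a ; v , t = from (q .sat ρ) b in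
             ⟅ u , v ⟆ , (u , from ∈⟅⟆ (inj₁ refl) , s) , (v , from ∈⟅⟆ (inj₂ refl) , t) })

    or₁ : Σ₁ P → Σ₁ Q → Σ₁ (λ ρ → P ρ ⊎ Q ρ)
    or₁ p q = mkΣ₁ (or₀ (matrix₀ p) (matrix₀ q)) λ ρ → mk⇔
      (λ { (w , inj₁ s) → inj₁ (to (p .sat ρ) (w , s)) ; (w , inj₂ s) → inj₂ (to (q .sat ρ) (w , s)) })
      (λ { (inj₁ a) → let w , s = from (p .sat ρ) a in w , inj₁ s
         ; (inj₂ b) → let w , s = from (q .sat ρ) b in w , inj₂ s })

    ex₁ : Σ₁ P → Σ₁ (λ ρ → ∃[ x ] P (x ∷ ρ))
    ex₁ p = mkΣ₁ (bex₀ zero (bex₀ (suc zero) (ren₀ (lift under) (matrix₀ p)))) λ ρ → mk⇔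
      (λ { (u , x , _ , w , _ , s) → x , to (p .sat (x ∷ ρ)) (w , s) })
      (λ { (x , a) → let w , s = from (p .sat (x ∷ ρ)) a in
           ⟅ x , w ⟆ , x , from ∈⟅⟆ (inj₁ refl) , w , from ∈⟅⟆ (inj₂ refl) , s })

    bex₁ : (i : Fin n) → Σ₁ P → Σ₁ (λ ρ → ∃[ x ] x ∈ lookup ρ i × P (x ∷ ρ))
    bex₁ i p = ex₁ (and₁ (Δ₀⇒Σ₁ (mem₀ zero (suc i))) p)

    -- Δ₀-collection turns the separate witnesses for the elements `x` into a single bound, which
    -- becomes the outer existential witness.
    ball₁ : (i : Fin n) → Σ₁ P → Σ₁ (λ ρ → ∀ x → x ∈ lookup ρ i → P (x ∷ ρ))
    ball₁ i p = mkΣ₁ (ball₀ (suc i) (bex₀ (suc zero) (ren₀ (lift under) (matrix₀ p)))) λ ρ → mk⇔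
      (λ { (b , h) x x∈ → let w , _ , s = h x x∈ in to (p .sat (x ∷ ρ)) (w , s) })
      (λ h → Δ₀-collection (p .matrix) (p .bounded) ρ (lookup ρ i)
               (λ x x∈ → from (p .sat (x ∷ ρ)) (h x x∈)))

  -- Totality is what makes a Σ₁ graph sufficient: a statement about the value, and equally its
  -- negation, can be put as "some y is the value and satisfies ...". Hence `comp-Δ`, and in
  -- particular equality and membership of values are Δ₁.
  record Fun (n : ℕ) : Set ℓ where
    no-eta-equality
    constructor fun
    field
      _⟨_⟩  : Env n → M
      graph : Σ₁ {suc n} (λ σ → head σ ≡ _⟨_⟩ (tail σ))
    infix 8 _⟨_⟩
  open Fun

  evals : Vec (Fun n) k → Env n → Env k
  evals []       ρ = []
  evals (f ∷ fs) ρ = f ⟨ ρ ⟩ ∷ evals fs ρ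

  abstract
    private
      var-graph : (i : Fin n) → Σ₁ (λ σ → head σ ≡ lookup (tail σ) i)
      var-graph i = resp₁ (λ { (x ∷ ρ) → ⇔-id }) (Δ₀⇒Σ₁ (eq₀ zero (suc i)))

      ren-graph : (r : Renaming n m) (f : Fun n) → Σ₁ (λ σ → head σ ≡ f ⟨ r .env (tail σ) ⟩)
      ren-graph r f = resp₁ (λ { (x ∷ ρ) → ⇔-id }) (ren₁ (lift r) (f .graph))

  var : Fin n → Fun n
  var i ⟨ ρ ⟩ = lookup ρ i
  var i .graph = var-graph i

  ren-Fun : Renaming n m → Fun n → Fun m
  ren-Fun r f ⟨ ρ ⟩   = f ⟨ r .env ρ ⟩
  ren-Fun r f .graph = ren-graph r f

  abstract
    subst₁ : Σ₁ P → (f : Fun n) → Σ₁ (λ ρ → P (f ⟨ ρ ⟩ ∷ ρ))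
    subst₁ {P = P} p f = resp₁ (λ ρ → mk⇔ (λ { (_ , refl , a) → a }) (λ a → f ⟨ ρ ⟩ , refl , a))
                       (ex₁ (and₁ (f .graph) p))

    private
      -- Arguments are eliminated head first; `drops k` lets `f` read the original environment
      -- beneath the `k` arguments still standing.
      subst* : {Q : Env (k + n) → Set ℓ} → Σ₁ Q → (fs : Vec (Fun n) k) → Σ₁ (λ ρ → Q (evals fs ρ ++ ρ))
      subst* q [] = q
      subst* {k = suc k} {Q = Q} q (f ∷ fs) =
        resp₁ (λ ρ → ≡⇒⇔ (cong (λ z → Q (f ⟨ z ⟩ ∷ evals fs ρ ++ ρ)) (drops-++ (evals fs ρ) ρ)))
          (subst* (subst₁ q (ren-Fun (drops k) f)) fs)

    comp₁ : Σ₁ P → (fs : Vec (Fun n) k) → Σ₁ (λ ρ → P (evals fs ρ))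
    comp₁ {P = P} p fs =
      resp₁ (λ ρ → ≡⇒⇔ (cong P (keeps-++ (evals fs ρ) ρ))) (subst* (ren₁ (keeps _) p) fs)

    private
      eq-evals : (fs : Vec (Fun n) k) → ∀ {x} ρ → evals (map (ren-Fun weaken) fs) (x ∷ ρ) ≡ evals fs ρ
      eq-evals []       ρ = refl
      eq-evals (f ∷ fs) ρ = cong (_ ∷_) (eq-evals fs ρ)

      comp-graph : (f : Fun k) (fs : Vec (Fun n) k) → Σ₁ (λ σ → head σ ≡ f ⟨ evals fs (tail σ) ⟩)
      comp-graph f fs = resp₁ (λ { (x ∷ ρ) → ≡⇒⇔ (cong (λ z → x ≡ f ⟨ z ⟩) (eq-evals fs ρ)) })
        (comp₁ (f .graph) (var zero ∷ map (ren-Fun weaken) fs))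

  comp : Fun k → Vec (Fun n) k → Fun n
  comp f fs ⟨ ρ ⟩ = f ⟨ evals fs ρ ⟩
  comp f fs .graph = comp-graph f fs

  infix  6 _∈ᶠ_ _≡ᶠ_
  infixr 5 _∧ᶠ_
  infixr 4 _∨ᶠ_
  infixr 3 _⇒ᶠ_ _⇔ᶠ_

  abstract
    comp-Δ : Δ₁ P → (fs : Vec (Fun n) k) → Δ₁ (λ ρ → P (evals fs ρ))
    comp-Δ p fs = δ₁ (comp₁ (p .pos) fs) (comp₁ (p .neg) fs)

    resp-Δ : (∀ ρ → P ρ ⇔ Q ρ) → Δ₁ P → Δ₁ Q
    resp-Δ e p = δ₁ (resp₁ e (p .pos)) (resp₁ (λ ρ → ¬-⇔ (e ρ)) (p .neg))

    ren-Δ : (r : Renaming n m) → Δ₁ P → Δ₁ (λ σ → P (r .env σ))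
    ren-Δ r p = δ₁ (ren₁ r (p .pos)) (ren₁ r (p .neg))

    Δ₀⇒Δ₁ : D₀ P → Δ₁ P
    Δ₀⇒Δ₁ d = δ₁ (Δ₀⇒Σ₁ d) (Δ₀⇒Σ₁ (not₀ d))

    _∈ᶠ_ : (f g : Fun n) → Δ₁ (λ ρ → f ⟨ ρ ⟩ ∈ g ⟨ ρ ⟩)
    f ∈ᶠ g = comp-Δ (Δ₀⇒Δ₁ (mem₀ zero (suc zero))) (f ∷ g ∷ [])

    _≡ᶠ_ : (f g : Fun n) → Δ₁ (λ ρ → f ⟨ ρ ⟩ ≡ g ⟨ ρ ⟩)
    f ≡ᶠ g = comp-Δ (Δ₀⇒Δ₁ (eq₀ zero (suc zero))) (f ∷ g ∷ [])

    ¬ᶠ_ : Δ₁ P → Δ₁ (λ ρ → ¬ P ρ)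
    ¬ᶠ p = δ₁ (p .neg) (resp₁ (λ ρ → mk⇔ (λ a na → na a) by-contradiction) (p .pos))

    _∧ᶠ_ : Δ₁ P → Δ₁ Q → Δ₁ (λ ρ → P ρ × Q ρ)
    p ∧ᶠ q = δ₁ (and₁ (p .pos) (q .pos)) (resp₁ (λ ρ → mk⇔
      (λ { (inj₁ na) (a , b) → na a ; (inj₂ nb) (a , b) → nb b }) de-morgan) (or₁ (p .neg) (q .neg)))
      where
      de-morgan : {A B : Set ℓ} → ¬ (A × B) → ¬ A ⊎ ¬ B
      de-morgan {A} h with em {A}
      ... | yes a = inj₂ λ b → h (a , b)
      ... | no na = inj₁ na

    _∨ᶠ_ : Δ₁ P → Δ₁ Q → Δ₁ (λ ρ → P ρ ⊎ Q ρ)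
    p ∨ᶠ q = δ₁ (or₁ (p .pos) (q .pos)) (resp₁ (λ ρ → mk⇔ (λ { (na , nb) → [ na , nb ] })
      (λ h → h ∘ inj₁ , h ∘ inj₂)) (and₁ (p .neg) (q .neg)))

    _⇒ᶠ_ : Δ₁ P → Δ₁ Q → Δ₁ (λ ρ → P ρ → Q ρ)
    _⇒ᶠ_ p q = resp-Δ (λ ρ → mk⇔ (λ { (inj₁ na) a → contradiction a na ; (inj₂ b) a → b }) ⊎-of) (¬ᶠ p ∨ᶠ q)
      where
      ⊎-of : {A B : Set ℓ} → (A → B) → ¬ A ⊎ B
      ⊎-of {A} h with em {A}
      ... | yes a = inj₂ (h a)
      ... | no na = inj₁ na

    _⇔ᶠ_ : Δ₁ P → Δ₁ Q → Δ₁ (λ ρ → P ρ ⇔ Q ρ)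
    p ⇔ᶠ q = resp-Δ (λ ρ → mk⇔ (λ { (f , g) → mk⇔ f g }) (λ e → to e , from e)) ((p ⇒ᶠ q) ∧ᶠ (q ⇒ᶠ p))

    ∃∈ᶠ : (f : Fun n) → Δ₁ P → Δ₁ (λ ρ → ∃[ x ] x ∈ f ⟨ ρ ⟩ × P (x ∷ ρ))
    ∃∈ᶠ f p = δ₁ (subst₁ (bex₁ zero (ren₁ under (p .pos))) f)
      (resp₁ (λ ρ → mk⇔ (λ { h (x , x∈ , a) → h x x∈ a }) (λ h x x∈ a → h (x , x∈ , a)))
        (subst₁ (ball₁ zero (ren₁ under (p .neg))) f))

    ∀∈ᶠ : (f : Fun n) → Δ₁ P → Δ₁ (λ ρ → ∀ x → x ∈ f ⟨ ρ ⟩ → P (x ∷ ρ))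
    ∀∈ᶠ f p = resp-Δ (λ ρ → mk⇔ (λ h x x∈ → by-contradiction λ na → h (x , x∈ , na))
      (λ { h (x , x∈ , na) → na (h x x∈) })) (¬ᶠ (∃∈ᶠ f (¬ᶠ p)))

  private
    -- Every `x` in `a` has a witness for `P` or one for its negation. Collecting these gives `b`,
    -- and with witnesses bounded by `b` the predicate becomes Δ₀ on `a`.
    separate : Δ₁ P → ∀ ρ a → ∃[ b ] ∀ x → x ∈ b ⇔ (x ∈ a × P (x ∷ ρ))
    separate {P = P} p ρ a with Δ₀-collection _ (disj (p .pos .bounded) (p .neg .bounded)) ρ a decide
      where
      decide : ∀ x → x ∈ a → ∃[ w ] (Sat 𝓜 (p .pos .matrix) (w ∷ x ∷ ρ) ⊎ Sat 𝓜 (p .neg .matrix) (w ∷ x ∷ ρ))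
      decide x _ with em {P (x ∷ ρ)}
      ... | yes h = let w , s = from (p .pos .sat _) h in w , inj₁ s
      ... | no nh = let w , s = from (p .neg .sat _) nh in w , inj₂ s
    ... | b , hb = c , λ x → mk⇔
          (λ x∈c → let x∈a , w , _ , s = to (hc x) x∈c in x∈a , to (p .pos .sat _) (w , to (ren-sat (r .index) (p .pos .matrix) (ag x w)) s))
          (λ (x∈a , h) → from (hc x) (x∈a , witness x x∈a h))
      where
      r : Renaming (suc (suc _)) (suc (suc (suc _)))
      r = lift under
      ag : ∀ x w → Agree (r .index) (w ∷ x ∷ b ∷ ρ) (w ∷ x ∷ ρ)
      ag x w = r .agree (w ∷ x ∷ b ∷ ρ)
      φ = ∃̇ ((zero ∈̇ suc (suc zero)) ∧̇ ren (r .index) (p .pos .matrix))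
      sep = Δ₀-separation φ (bex (ren-Δ₀ _ (p .pos .bounded))) (b ∷ ρ) a
      c = proj₁ sep
      hc = proj₂ sep
      witness : ∀ x → x ∈ a → P (x ∷ ρ) → Sat 𝓜 φ (x ∷ b ∷ ρ)
      witness x x∈a h with hb x x∈a
      ... | w , w∈b , inj₁ s = w , w∈b , from (ren-sat (r .index) (p .pos .matrix) (ag x w)) s
      ... | w , w∈b , inj₂ s = contradiction h (to (p .neg .sat _) (w , s))

    -- Δ₀-collection is applied to unordered pairs of a value and its Σ₁ witness; the union of the
    -- collected set then contains the values.
    collect : {P : Env (2 + n) → Set ℓ} → Σ₁ P → ∀ ρ a → (∀ x → x ∈ a → ∃[ y ] P (y ∷ x ∷ ρ)) →
                    ∃[ b ] ∀ x → x ∈ a → ∃[ y ] y ∈ b × P (y ∷ x ∷ ρ)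
    collect {P = P} p ρ a h with Δ₀-collection (c .formula) (c .bounded) ρ a
        (λ x x∈ → let y , q = h x x∈ ; w , s = from (p .sat _) q in
           ⟅ y , w ⟆ , from (c .sat _) (y , from ∈⟅⟆ (inj₁ refl) , w , from ∈⟅⟆ (inj₂ refl) , s))
      where
      c : D₀ λ σ → ∃[ y ] y ∈ lookup σ zero × ∃[ w ] w ∈ lookup σ zero × Sat 𝓜 (p .matrix) (w ∷ y ∷ weaken .env σ)
      c = bex₀ zero (bex₀ (suc zero) (ren₀ (lift under) (matrix₀ p)))
    ... | b , hb = ⋃ b , λ x x∈ → let v , v∈b , s = hb x x∈ ; y , y∈v , w , _ , t = to (c .sat _) s in
          y , from ∈⋃ (v , v∈b , y∈v) , to (p .sat _) (w , t)
      where
      c : D₀ λ σ → ∃[ y ] y ∈ lookup σ zero × ∃[ w ] w ∈ lookup σ zero × Sat 𝓜 (p .matrix) (w ∷ y ∷ weaken .env σ)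
      c = bex₀ zero (bex₀ (suc zero) (ren₀ (lift under) (matrix₀ p)))

  abstract
    Δ₁-separation : {P : Env (suc n) → Set ℓ} → Δ₁ P → ∀ ρ a → ∃[ b ] ∀ x → x ∈ b ⇔ (x ∈ a × P (x ∷ ρ))
    Δ₁-separation = separate

    Σ₁-collection : {P : Env (2 + n) → Set ℓ} → Σ₁ P → ∀ ρ a → (∀ x → x ∈ a → ∃[ y ] P (y ∷ x ∷ ρ)) →
                    ∃[ b ] ∀ x → x ∈ a → ∃[ y ] y ∈ b × P (y ∷ x ∷ ρ)
    Σ₁-collection = collect

-- Set functions with Σ₁ graphs and recursion on membership.

module SetFunctions
  {ℓ : Level} (em : ExcludedMiddle ℓ) (𝓜 : Structure ℓ) (kp : IsKPModel 𝓜) where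
  open Definability em 𝓜 kp public
  open Structure 𝓜 renaming (Carrier to M)
  open IsKPModel kp
  open Renaming
  open FO
  open Σ₁
  open Δ₁
  open Fun
  private variable
    P Q : Env n → Set ℓ

  abstract
    Σ₁⇒FO : Σ₁ P → FO P
    Σ₁⇒FO p = fo (∃̇ (p .matrix)) (p .sat)

  Δ₁⇒FO : Δ₁ P → FO P
  Δ₁⇒FO p = Σ₁⇒FO (p .pos)

  resp-FO : (∀ ρ → P ρ ⇔ Q ρ) → FO P → FO Q
  resp-FO e (fo φ s) = fo φ λ ρ → ⇔-trans (s ρ) (e ρ)

  infixl 1 _via_

  abstract
    _via_ : Δ₁ P → (∀ ρ → P ρ ⇔ Q ρ) → Δ₁ Q
    d via e = resp-Δ e d

  infixr 5 _∧ᵒ_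
  infixr 4 _∨ᵒ_
  infixr 3 _⇒ᵒ_ _⇔ᵒ_

  _∧ᵒ_ : FO P → FO Q → FO (λ ρ → P ρ × Q ρ)
  fo φ s ∧ᵒ fo ψ t = fo (φ ∧̇ ψ) λ ρ → s ρ ×-⇔ t ρ

  _∨ᵒ_ : FO P → FO Q → FO (λ ρ → P ρ ⊎ Q ρ)
  fo φ s ∨ᵒ fo ψ t = fo (φ ∨̇ ψ) λ ρ → s ρ ⊎-⇔ t ρ

  _⇒ᵒ_ : FO P → FO Q → FO (λ ρ → P ρ → Q ρ)
  fo φ s ⇒ᵒ fo ψ t = fo (φ ⇒̇ ψ) λ ρ → →-⇔ (s ρ) (t ρ)

  _⇔ᵒ_ : FO P → FO Q → FO (λ ρ → P ρ ⇔ Q ρ)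
  p ⇔ᵒ q = resp-FO (λ ρ → mk⇔ (λ { (f , g) → mk⇔ f g }) (λ e → to e , from e)) ((p ⇒ᵒ q) ∧ᵒ (q ⇒ᵒ p))

  infix 6 ¬ᵒ_ ∀ᵒ_ ∃ᵒ_

  ¬ᵒ_ : FO P → FO (λ ρ → ¬ P ρ)
  ¬ᵒ fo φ s = fo (φ ⇒̇ ⊥̇) λ ρ →
    mk⇔ (λ h p → ⊥-elim′ (h (from (s ρ) p))) (λ h p → contradiction (to (s ρ) p) h)

  ∀ᵒ_ : FO P → FO (λ ρ → ∀ x → P (x ∷ ρ))
  ∀ᵒ fo φ s = fo (∀̇ φ) λ ρ → ∀-⇔ λ x → s (x ∷ ρ)

  ∃ᵒ_ : FO P → FO (λ ρ → ∃[ x ] P (x ∷ ρ))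
  ∃ᵒ fo φ s = fo (∃̇ φ) λ ρ → ∃-⇔ λ x → s (x ∷ ρ)

  substᵒ : FO P → (f : Fun n) → FO (λ ρ → P (f ⟨ ρ ⟩ ∷ ρ))
  substᵒ p f = resp-FO (λ ρ → mk⇔ (λ { (_ , refl , h) → h }) (λ h → _ , refl , h))
    (∃ᵒ (Σ₁⇒FO (f .graph) ∧ᵒ p))

  -- Least counterexample. Foundation is assumed for all formulas, so induction also covers
  -- predicates with unbounded quantifiers, as in `trichotomy` or in statements that a formation
  -- sequence exists.
  ∈-induction : FO P → ∀ ρ → (∀ x → (∀ y → y ∈ x → P (y ∷ ρ)) → P (x ∷ ρ)) → ∀ x → P (x ∷ ρ)
  ∈-induction p ρ step x = by-contradiction λ nPx →
    let y , ¬y , min = foundation (formula (¬ᵒ p)) ρ (x , from (sat (¬ᵒ p) _) nPx) in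
    to (sat (¬ᵒ p) _) ¬y (step y λ z z∈y → by-contradiction λ nPz →
      min z z∈y (from (sat (¬ᵒ p) _) nPz))

  v0 : Fin (1 + n)
  v0 = zero
  v1 : Fin (2 + n)
  v1 = suc v0
  v2 : Fin (3 + n)
  v2 = suc v1
  v3 : Fin (4 + n)
  v3 = suc v2
  v4 : Fin (5 + n)
  v4 = suc v3
  v5 : Fin (6 + n)
  v5 = suc v4
  v6 : Fin (7 + n)
  v6 = suc v5

  ∈-irrefl : ∀ {x} → ¬ (x ∈ x)
  ∈-irrefl {x} = ∈-induction {P = λ { (x ∷ []) → ¬ (x ∈ x) }}
    (resp-FO (λ { (x ∷ []) → ⇔-id }) (Δ₁⇒FO (¬ᶠ (var v0 ∈ᶠ var v0)))) []
    (λ x ih x∈x → ih x x∈x x∈x) x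

  infixl 7 _∪_
  infix 6 _⊆_

  _⊆_ : M → M → Set ℓ
  x ⊆ y = ∀ z → z ∈ x → z ∈ y

  ⊆-antisym : ∀ {x y} → x ⊆ y → y ⊆ x → x ≡ y
  ⊆-antisym = ext

  sing : M → M
  sing x = ⟅ x , x ⟆

  ∈sing : ∀ {x z} → z ∈ sing x ⇔ (z ≡ x)
  ∈sing = mk⇔ (λ h → [ (λ e → e) , (λ e → e) ] (to ∈⟅⟆ h)) (λ e → from ∈⟅⟆ (inj₁ e))

  sing-self : ∀ {x} → x ∈ sing x
  sing-self = from ∈sing refl

  _∪_ : M → M → M
  x ∪ y = ⋃ ⟅ x , y ⟆

  ∈∪ : ∀ {x y z} → z ∈ x ∪ y ⇔ (z ∈ x ⊎ z ∈ y)
  ∈∪ = mk⇔ (λ h → case to ∈⋃ h of λ (u , u∈ , z∈) → case to ∈⟅⟆ u∈ of λ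
              { (inj₁ refl) → inj₁ z∈ ; (inj₂ refl) → inj₂ z∈ })
           [ (λ z∈ → from ∈⋃ (_ , from ∈⟅⟆ (inj₁ refl) , z∈)) , (λ z∈ → from ∈⋃ (_ , from ∈⟅⟆ (inj₂ refl) , z∈)) ]

  adjoin : M → M → M
  adjoin x y = x ∪ sing y

  ∈adjoin : ∀ {x y z} → z ∈ adjoin x y ⇔ (z ∈ x ⊎ z ≡ y)
  ∈adjoin = ⇔-trans ∈∪ (⇔-id ⊎-⇔ ∈sing)

  ∈adjoinˡ : ∀ {x y z} → z ∈ x → z ∈ adjoin x y
  ∈adjoinˡ h = from ∈adjoin (inj₁ h)

  ∈adjoinʳ : ∀ {x y} → y ∈ adjoin x y
  ∈adjoinʳ = from ∈adjoin (inj₂ refl)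

  S : M → M
  S x = adjoin x x

  ⟪_,_⟫ : M → M → M
  ⟪ x , y ⟫ = ⟅ sing x , ⟅ x , y ⟆ ⟆

  ⟪⟫-injective : ∀ {x y x′ y′} → ⟪ x , y ⟫ ≡ ⟪ x′ , y′ ⟫ → x ≡ x′ × y ≡ y′
  ⟪⟫-injective {x} {y} {x′} {y′} e = x≡ , y≡
    where
    u∈ : ∀ {u} → u ∈ ⟪ x , y ⟫ → (u ≡ sing x′ ⊎ u ≡ ⟅ x′ , y′ ⟆)
    u∈ h = to ∈⟅⟆ (subst (_ ∈_) e h)
    u∈′ : ∀ {u} → u ∈ ⟪ x′ , y′ ⟫ → (u ≡ sing x ⊎ u ≡ ⟅ x , y ⟆)
    u∈′ h = to ∈⟅⟆ (subst (_ ∈_) (sym e) h)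
    x≡ : x ≡ x′
    x≡ with u∈ (from ∈⟅⟆ (inj₁ refl))
    ... | inj₁ s = to ∈sing (subst (x ∈_) s sing-self)
    ... | inj₂ s = sym (to ∈sing (subst (x′ ∈_) (sym s) (from ∈⟅⟆ (inj₁ refl))))
    y∈ : y ∈ ⟅ x′ , y′ ⟆ ⊎ (y ≡ x′ × ⟅ x , y ⟆ ≡ sing x′)
    y∈ with u∈ (from ∈⟅⟆ (inj₂ refl))
    ... | inj₁ s = inj₂ (to ∈sing (subst (y ∈_) s (from ∈⟅⟆ (inj₂ refl))) , s)
    ... | inj₂ s = inj₁ (subst (y ∈_) s (from ∈⟅⟆ (inj₂ refl)))
    y′∈ : (y′ ≡ x) ⊎ (y′ ≡ y)
    y′∈ with u∈′ (from ∈⟅⟆ (inj₂ refl))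
    ... | inj₁ s = inj₁ (to ∈sing (subst (y′ ∈_) s (from ∈⟅⟆ (inj₂ refl))))
    ... | inj₂ s = to ∈⟅⟆ (subst (y′ ∈_) s (from ∈⟅⟆ (inj₂ refl)))
    y≡ : y ≡ y′
    y≡ with y′∈
    ... | inj₂ e′ = sym e′
    ... | inj₁ e′ with y∈
    ...   | inj₂ (e″ , _) = trans e″ (trans (sym x≡) (sym e′))
    ...   | inj₁ h with to ∈⟅⟆ h
    ...     | inj₁ e″ = trans e″ (trans (sym x≡) (sym e′))
    ...     | inj₂ e″ = e″

  -- For Kuratowski pairs this one set contains both coordinates of every pair in `f`, so
  -- quantifiers over arguments and values of `f` become bounded.
  fld : M → M
  fld f = ⋃ (⋃ f)

  fldˡ : ∀ {f x y} → ⟪ x , y ⟫ ∈ f → x ∈ fld f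
  fldˡ h = from ∈⋃ (_ , from ∈⋃ (_ , h , from ∈⟅⟆ (inj₁ refl)) , sing-self)

  fldʳ : ∀ {f x y} → ⟪ x , y ⟫ ∈ f → y ∈ fld f
  fldʳ h = from ∈⋃ (_ , from ∈⋃ (_ , h , from ∈⟅⟆ (inj₂ refl)) , from ∈⟅⟆ (inj₂ refl))

  abstract
    ⊤ᶠ : Δ₁ {n} (λ _ → ⊤ {ℓ})
    ⊤ᶠ = resp-Δ (λ ρ → mk⇔ (λ _ → tt) (λ _ _ → ∉∅)) (Δ₀⇒Δ₁ {P = λ ρ → ⊤ {ℓ} → ¬ (∅ ∈ ∅)} (d₀ (⊥̇ ⇒̇ ⊥̇) (impl bot bot) λ ρ → mk⇔ (λ _ _ → ∉∅) (λ _ z → z)))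

    graph-of : ∀ (F : Env n → M) {R : Env (suc n) → Set ℓ} → Δ₁ R → (∀ y ρ → R (y ∷ ρ) ⇔ (y ≡ F ρ)) →
               Σ₁ (λ σ → head σ ≡ F (tail σ))
    graph-of F d e = resp₁ (λ { (y ∷ ρ) → e y ρ }) (d .pos)

  ∅ᶠ : Fun n
  ∅ᶠ ⟨ _ ⟩ = ∅
  ∅ᶠ .graph = graph-of (λ _ → ∅) (∀∈ᶠ (var v0) (¬ᶠ ⊤ᶠ)) λ y ρ →
    mk⇔ (λ h → ext (λ z z∈ → contradiction tt (h z z∈)) (λ z z∈ → contradiction z∈ ∉∅)) (λ { refl z z∈ _ → ∉∅ z∈ })

  ⟅_,_⟆ᶠ : Fun n → Fun n → Fun n
  ⟅ f , g ⟆ᶠ ⟨ ρ ⟩ = ⟅ f ⟨ ρ ⟩ , g ⟨ ρ ⟩ ⟆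
  ⟅ f , g ⟆ᶠ .graph = comp pairᶠ (f ∷ g ∷ []) .graph
    where
    pairᶠ : Fun 2
    pairᶠ ⟨ x ∷ y ∷ [] ⟩ = ⟅ x , y ⟆
    pairᶠ .graph = graph-of (pairᶠ ⟨_⟩) (var v1 ∈ᶠ var v0 ∧ᶠ var v2 ∈ᶠ var v0 ∧ᶠ
      ∀∈ᶠ (var v0) (var v0 ≡ᶠ var v2 ∨ᶠ var v0 ≡ᶠ var v3)) λ { p (x ∷ y ∷ []) →
      mk⇔ (λ (x∈ , y∈ , h) → ext (λ z z∈ → from ∈⟅⟆ (h z z∈))
            (λ z z∈ → case to ∈⟅⟆ z∈ of λ { (inj₁ refl) → x∈ ; (inj₂ refl) → y∈ }))
          (λ { refl → from ∈⟅⟆ (inj₁ refl) , from ∈⟅⟆ (inj₂ refl) , λ z → to ∈⟅⟆ }) }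

  ⋃ᶠ : Fun n → Fun n
  ⋃ᶠ f ⟨ ρ ⟩ = ⋃ (f ⟨ ρ ⟩)
  ⋃ᶠ f .graph = comp unionᶠ (f ∷ []) .graph
    where
    unionᶠ : Fun 1
    unionᶠ ⟨ x ∷ [] ⟩ = ⋃ x
    unionᶠ .graph = graph-of (unionᶠ ⟨_⟩) (∀∈ᶠ (var v0) (∃∈ᶠ (var v2) (var v1 ∈ᶠ var v0)) ∧ᶠ
      ∀∈ᶠ (var v1) (∀∈ᶠ (var v0) (var v0 ∈ᶠ var v2))) λ { u (x ∷ []) →
      mk⇔ (λ (h , h′) → ext (λ z z∈ → from ∈⋃ (h z z∈)) (λ z z∈ → let y , y∈ , z∈y = to ∈⋃ z∈ in h′ y y∈ z z∈y))
          (λ { refl → (λ z → to ∈⋃) , λ y y∈ z z∈ → from ∈⋃ (y , y∈ , z∈) }) }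

  singᶠ : Fun n → Fun n
  singᶠ f = ⟅ f , f ⟆ᶠ

  infixl 7 _∪ᶠ_
  _∪ᶠ_ : Fun n → Fun n → Fun n
  f ∪ᶠ g = ⋃ᶠ ⟅ f , g ⟆ᶠ

  Sᶠ : Fun n → Fun n
  Sᶠ f = f ∪ᶠ singᶠ f

  ⟪_,_⟫ᶠ : Fun n → Fun n → Fun n
  ⟪ f , g ⟫ᶠ = ⟅ singᶠ f , ⟅ f , g ⟆ᶠ ⟆ᶠ

  fldᶠ : Fun n → Fun n
  fldᶠ f = ⋃ᶠ (⋃ᶠ f)

  wk : Fun n → Fun (suc n)
  wk = ren-Fun weaken

  under : Renaming (suc n) (suc (suc n))
  under = lift weaken

  private
    member : (t : Fun (suc n)) (u : Fun n) → Δ₁ P →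
             Δ₁ (λ σ → ∃[ x ] x ∈ wk u ⟨ σ ⟩ × P (under .env (x ∷ σ)) × head σ ≡ t ⟨ under .env (x ∷ σ) ⟩)
    member t u p = resp-Δ (λ { (z ∷ σ) → ⇔-id })
      (∃∈ᶠ (wk u) (ren-Δ under p ∧ᶠ var v1 ≡ᶠ ren-Fun under t))

  abstract
    -- Σ₁-collection yields a set containing all the values, and Δ₁-separation removes the surplus.
    Build : {P : Env (suc n) → Set ℓ} (t : Fun (suc n)) (u : Fun n) → Δ₁ P → Env n → M
    ∈Build : ∀ {P : Env (suc n) → Set ℓ} {t : Fun (suc n)} {u : Fun n} {p : Δ₁ P} {ρ z} →
             z ∈ Build t u p ρ ⇔ (∃[ x ] x ∈ u ⟨ ρ ⟩ × P (x ∷ ρ) × z ≡ t ⟨ x ∷ ρ ⟩)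

    private
      image : (t : Fun (suc n)) (u : Fun n) → ∀ ρ → ∃[ b ] ∀ x → x ∈ u ⟨ ρ ⟩ → t ⟨ x ∷ ρ ⟩ ∈ b
      image t u ρ with Σ₁-collection {P = λ { (y ∷ x ∷ ρ) → y ≡ t ⟨ x ∷ ρ ⟩ }}
        (resp₁ (λ { (y ∷ x ∷ ρ) → ⇔-id }) (t .graph)) ρ (u ⟨ ρ ⟩) (λ x _ → _ , refl)
      ... | b , h = b , λ x x∈ → case h x x∈ of λ { (_ , y∈ , refl) → y∈ }

      construct : {P : Env (suc n) → Set ℓ} (t : Fun (suc n)) (u : Fun n) (p : Δ₁ P) (ρ : Env n) →
                  ∃[ b ] ∀ z → z ∈ b ⇔ (∃[ x ] x ∈ u ⟨ ρ ⟩ × P (x ∷ ρ) × z ≡ t ⟨ x ∷ ρ ⟩)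
      construct {P = P} t u p ρ = let b , hb = image t u ρ ; c , hc = Δ₁-separation (member t u p) ρ b in
        c , λ z → mk⇔ (λ h → proj₂ (to (hc z) h))
                      (λ { (x , x∈ , px , refl) → from (hc z) (hb x x∈ , x , x∈ , px , refl) })

    Build t u p ρ = proj₁ (construct t u p ρ)
    ∈Build {t = t} {u} {p} {ρ} = proj₂ (construct t u p ρ) _

  setOf : {P : Env (suc n) → Set ℓ} (t : Fun (suc n)) (u : Fun n) → Δ₁ P → Fun n
  setOf t u p ⟨ ρ ⟩ = Build t u p ρ
  setOf t u p .graph = graph-of (Build t u p)
    (∀∈ᶠ (var v0) (ren-Δ (lift weaken) (member t u p)) ∧ᶠ
     ∀∈ᶠ (wk u) (ren-Δ (lift weaken) p ⇒ᶠ ren-Fun (lift weaken) t ∈ᶠ var v1)) λ y ρ →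
     mk⇔ (λ (h , h′) → ext (λ z z∈ → from ∈Build (h z z∈))
            (λ z z∈ → case to ∈Build z∈ of λ { (x , x∈ , px , refl) → h′ x x∈ px }))
         (λ { refl → (λ z → to ∈Build) , λ x x∈ px → from ∈Build (x , x∈ , px , refl) })

  sepᶠ : {P : Env (suc n) → Set ℓ} → Fun n → Δ₁ P → Fun n
  sepᶠ u p = setOf (var v0) u p

  ∈Sep : ∀ {P : Env (suc n) → Set ℓ} {u : Fun n} {p : Δ₁ P} {ρ z} → z ∈ sepᶠ u p ⟨ ρ ⟩ ⇔ (z ∈ u ⟨ ρ ⟩ × P (z ∷ ρ))
  ∈Sep = ⇔-trans ∈Build (mk⇔ (λ { (x , x∈ , px , refl) → x∈ , px }) (λ (x∈ , px) → _ , x∈ , px , refl))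

  bigᶠ : {P : Env (suc n) → Set ℓ} (t : Fun (suc n)) (u : Fun n) → Δ₁ P → Fun n
  bigᶠ t u p = ⋃ᶠ (setOf t u p)

  ∈Big : ∀ {P : Env (suc n) → Set ℓ} {t : Fun (suc n)} {u : Fun n} {p : Δ₁ P} {ρ z} →
         z ∈ bigᶠ t u p ⟨ ρ ⟩ ⇔ (∃[ x ] x ∈ u ⟨ ρ ⟩ × P (x ∷ ρ) × z ∈ t ⟨ x ∷ ρ ⟩)
  ∈Big = mk⇔ (λ h → case to ∈⋃ h of λ (y , y∈ , z∈) → case to ∈Build y∈ of λ { (x , x∈ , px , refl) → x , x∈ , px , z∈ })
             (λ (x , x∈ , px , z∈) → from ∈⋃ (_ , from ∈Build (x , x∈ , px , refl) , z∈))

  -- Replaces the values of F by those of an abstract op: unfolding the nested defining terms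
  -- of set functions is prohibitively expensive.
  seal : (F : Fun n) (op : Env n → M) → (∀ ρ → F ⟨ ρ ⟩ ≡ op ρ) → Fun n
  seal F op e ⟨ ρ ⟩ = op ρ
  seal F op e .graph = resp₁ (λ { (z ∷ ρ) → ≡⇒⇔ (cong (z ≡_) (e ρ)) }) (F .graph)

  private
    appF : Fun 2
    appF = ⋃ᶠ (sepᶠ (fldᶠ (var v0)) (⟪ var v2 , var v0 ⟫ᶠ ∈ᶠ var v1))

    restrictF : Fun 2
    restrictF = sepᶠ (var v0) (∃∈ᶠ (var v2) (∃∈ᶠ (fldᶠ (var v2)) (var v2 ≡ᶠ ⟪ var v1 , var v0 ⟫ᶠ)))

  infixl 8 _·_ _↾_ _·ᶠ_ _↾ᶠ_
  abstract
    -- Junk unless f has exactly one value at x.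
    _·_ : M → M → M
    f · x = appF ⟨ f ∷ x ∷ [] ⟩

    _↾_ : M → M → M
    f ↾ x = restrictF ⟨ f ∷ x ∷ [] ⟩

    private
      ·-def : ∀ ρ → appF ⟨ ρ ⟩ ≡ lookup ρ v0 · lookup ρ v1
      ·-def (f ∷ x ∷ []) = refl

      ↾-def : ∀ ρ → restrictF ⟨ ρ ⟩ ≡ lookup ρ v0 ↾ lookup ρ v1
      ↾-def (f ∷ x ∷ []) = refl

    ·-unique : ∀ {f x y} → ⟪ x , y ⟫ ∈ f → (∀ y′ → ⟪ x , y′ ⟫ ∈ f → y′ ≡ y) → f · x ≡ y
    ·-unique {f} {x} {y} y∈ u = ext
      (λ z z∈ → let w , w∈ , z∈w = to ∈⋃ z∈ in subst (z ∈_) (u w (proj₂ (to ∈Sep w∈))) z∈w)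
      (λ z z∈ → from ∈⋃ (y , from ∈Sep (fldʳ y∈ , y∈) , z∈))

    ∈↾ : ∀ {f x p} → p ∈ f ↾ x ⇔ (∃[ z ] ∃[ w ] p ≡ ⟪ z , w ⟫ × z ∈ x × ⟪ z , w ⟫ ∈ f)
    ∈↾ = ⇔-trans ∈Sep (mk⇔
      (λ { (p∈ , z , z∈ , w , w∈ , refl) → z , w , refl , z∈ , p∈ })
      (λ { (z , w , refl , z∈ , p∈) → p∈ , z , z∈ , w , fldʳ p∈ , refl }))

  _·ᶠ_ : Fun n → Fun n → Fun n
  f ·ᶠ g = comp (seal appF _ ·-def) (f ∷ g ∷ [])

  _↾ᶠ_ : Fun n → Fun n → Fun n
  f ↾ᶠ g = comp (seal restrictF _ ↾-def) (f ∷ g ∷ [])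

  ∈↾-pair : ∀ {f x z w} → ⟪ z , w ⟫ ∈ f ↾ x ⇔ (z ∈ x × ⟪ z , w ⟫ ∈ f)
  ∈↾-pair = ⇔-trans ∈↾ (mk⇔
    (λ { (z , w , e , z∈ , p∈) → case ⟪⟫-injective e of λ { (refl , refl) → z∈ , p∈ } })
    (λ (z∈ , p∈) → _ , _ , refl , z∈ , p∈))

  ↾-cong : ∀ {f g x} → (∀ z w → z ∈ x → ⟪ z , w ⟫ ∈ f → ⟪ z , w ⟫ ∈ g) →
           (∀ z w → z ∈ x → ⟪ z , w ⟫ ∈ g → ⟪ z , w ⟫ ∈ f) → f ↾ x ≡ g ↾ x
  ↾-cong h h′ = ext
    (λ p p∈ → case to ∈↾ p∈ of λ { (z , w , refl , z∈ , zw∈) → from ∈↾ (z , w , refl , z∈ , h z w z∈ zw∈) })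
    (λ p p∈ → case to ∈↾ p∈ of λ { (z , w , refl , z∈ , zw∈) → from ∈↾ (z , w , refl , z∈ , h′ z w z∈ zw∈) })

  -- ∈-recursion: F(x) = G(F ↾ x , x).
  module Recursion {n} (G : Fun (2 + n)) where
    private
      -- The domain is closed under elements, so `f ↾ x` is a complete history at each `x` in it.
      -- Functionality is implied, since `y` is determined by `f` and `x`.
      IsApprox : Env n → M → Set ℓ
      IsApprox ρ f = ∀ p → p ∈ f → ∃[ x ] ∃[ y ] p ≡ ⟪ x , y ⟫ ×
        (∀ z → z ∈ x → ∃[ w ] ⟪ z , w ⟫ ∈ f) × y ≡ G ⟨ f ↾ x ∷ x ∷ ρ ⟩

      Gᶠ : Fun (4 + n)
      Gᶠ ⟨ σ ⟩ = G ⟨ lookup σ v3 ↾ lookup σ v1 ∷ lookup σ v1 ∷ drops 4 .env σ ⟩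
      Gᶠ .graph = resp₁ (λ { (a ∷ b ∷ c ∷ d ∷ e ∷ ρ) → ⇔-id })
        (subst₁ {P = λ σ → lookup σ v1 ≡ G ⟨ lookup σ v0 ∷ lookup σ v3 ∷ drops 6 .env σ ⟩}
          (resp₁ (λ { (h ∷ a ∷ b ∷ c ∷ d ∷ e ∷ ρ) → ⇔-id })
            (ren₁ {P = λ τ → head τ ≡ G ⟨ tail τ ⟩} r′ (G .graph)))
          (var v4 ↾ᶠ var v2))
        where
        r′ : Renaming (3 + n) (6 + n)
        r′ .index zero = v1
        r′ .index (suc zero) = v0
        r′ .index (suc (suc zero)) = v3
        r′ .index (suc (suc (suc i))) = suc (suc (suc (suc (suc (suc i)))))
        r′ .env (h ∷ a ∷ b ∷ c ∷ d ∷ e ∷ ρ) = a ∷ h ∷ c ∷ ρ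
        r′ .agree (h ∷ a ∷ b ∷ c ∷ d ∷ e ∷ ρ) zero = refl
        r′ .agree (h ∷ a ∷ b ∷ c ∷ d ∷ e ∷ ρ) (suc zero) = refl
        r′ .agree (h ∷ a ∷ b ∷ c ∷ d ∷ e ∷ ρ) (suc (suc zero)) = refl
        r′ .agree (h ∷ a ∷ b ∷ c ∷ d ∷ e ∷ ρ) (suc (suc (suc i))) = refl

      bounded-form : Δ₁ {suc n} _
      bounded-form = ∀∈ᶠ (var v0) (∃∈ᶠ (fldᶠ (var v1)) (∃∈ᶠ (fldᶠ (var v2))
        (var v2 ≡ᶠ ⟪ var v1 , var v0 ⟫ᶠ ∧ᶠ
         ∀∈ᶠ (var v1) (∃∈ᶠ (fldᶠ (var v4)) (⟪ var v1 , var v0 ⟫ᶠ ∈ᶠ var v5)) ∧ᶠ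
         var v0 ≡ᶠ Gᶠ)))

      isApprox-Δ : Δ₁ (λ σ → IsApprox (weaken .env σ) (lookup σ v0))
      isApprox-Δ = bounded-form via λ { (f ∷ ρ) → mk⇔
          (λ h p p∈ → case h p p∈ of λ (x , _ , y , _ , e , d , v) →
             x , y , e , (λ z z∈ → let w , _ , i = d z z∈ in w , i) , v)
          (λ h p p∈ → case h p p∈ of λ { (x , y , refl , d , v) →
             x , fldˡ p∈ , y , fldʳ p∈ , refl , (λ z z∈ → let w , i = d z z∈ in w , fldʳ i , i) , v }) }

      -- By induction on `x`: agreement below `x` gives `f ↾ x ≡ g ↾ x`, and both values are `G` at
      -- this common history.
      agree-values : ∀ {ρ f g} → IsApprox ρ f → IsApprox ρ g →
                     ∀ x {y y′} → ⟪ x , y ⟫ ∈ f → ⟪ x , y′ ⟫ ∈ g → y ≡ y′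

      entry : ∀ {ρ f x y} → IsApprox ρ f → ⟪ x , y ⟫ ∈ f →
              (∀ z → z ∈ x → ∃[ w ] ⟪ z , w ⟫ ∈ f) × y ≡ G ⟨ f ↾ x ∷ x ∷ ρ ⟩
      entry a xy∈ with a _ xy∈
      ... | _ , _ , e , d , v with ⟪⟫-injective e
      ...   | refl , refl = d , v

      agree-values {ρ} {f} {g} a b x {y} {y′} y∈ y′∈ =
        ∈-induction {P = λ { (x ∷ f ∷ g ∷ []) →
            ∀ y → y ∈ fld f → ∀ y′ → y′ ∈ fld g → ⟪ x , y ⟫ ∈ f → ⟪ x , y′ ⟫ ∈ g → y ≡ y′ }}
          (Δ₁⇒FO (∀∈ᶠ (fldᶠ (var v1)) (∀∈ᶠ (fldᶠ (var v3))
             (⟪ var v2 , var v1 ⟫ᶠ ∈ᶠ var v3 ⇒ᶠ ⟪ var v2 , var v0 ⟫ᶠ ∈ᶠ var v4 ⇒ᶠ var v1 ≡ᶠ var v0))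
             via λ { (x ∷ f ∷ g ∷ []) → ⇔-id }))
          (f ∷ g ∷ [])
          (λ x ih y _ y′ _ y∈ y′∈ →
            let d , v = entry a y∈
                d′ , v′ = entry b y′∈
                same : ∀ z w w′ → z ∈ x → ⟪ z , w ⟫ ∈ f → ⟪ z , w′ ⟫ ∈ g → w ≡ w′
                same z w w′ z∈ h h′ = ih z z∈ w (fldʳ h) w′ (fldʳ h′) h h′
            in trans v (trans (cong (λ h → G ⟨ h ∷ x ∷ ρ ⟩) (↾-cong
                 (λ z w z∈ h → let w′ , h′ = d′ z z∈ in
                    subst (λ u → ⟪ z , u ⟫ ∈ g) (sym (same z w w′ z∈ h h′)) h′)
                 (λ z w′ z∈ h′ → let w , h = d z z∈ in
                    subst (λ u → ⟪ z , u ⟫ ∈ f) (same z w w′ z∈ h h′) h)))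
               (sym v′)))
          x y (fldʳ y∈) y′ (fldʳ y′∈) y∈ y′∈

      IsValue : M → Env (suc n) → Set ℓ
      IsValue f (x ∷ ρ) = IsApprox ρ f × (∃[ y ] ⟪ x , y ⟫ ∈ f)

      isValue-Δ : Δ₁ (λ σ → IsValue (head σ) (tail σ))
      isValue-Δ = ren-Δ under isApprox-Δ ∧ᶠ ∃∈ᶠ (fldᶠ (var v0)) (⟪ var v2 , var v0 ⟫ᶠ ∈ᶠ var v1)
        via λ { (f ∷ x ∷ ρ) → ⇔-id ×-⇔ mk⇔ (λ (y , _ , h) → y , h) (λ (y , h) → y , fldʳ h , h) }

      -- By `agree-values`, passing from one member `f` to the union adds nothing below an `x` in
      -- the domain of `f`; the history at `x` is unchanged.
      amalgam : ∀ ρ b → (∀ f → f ∈ b → IsApprox ρ f) → IsApprox ρ (⋃ b)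
      amalgam ρ b all p p∈ with to ∈⋃ p∈
      ... | f , f∈ , p∈f with all f f∈ p p∈f
      ...   | x , y , refl , d , v = x , y , refl ,
              (λ z z∈ → let w , h = d z z∈ in w , from ∈⋃ (f , f∈ , h)) ,
              trans v (cong (λ h → G ⟨ h ∷ x ∷ ρ ⟩) (↾-cong (λ z w _ h → from ∈⋃ (f , f∈ , h))
                λ z w z∈ h → let g , g∈ , h′ = to ∈⋃ h ; w′ , h″ = d z z∈ in
                  subst (λ u → ⟪ z , u ⟫ ∈ f) (agree-values (all f f∈) (all g g∈) z h″ h′) h″))

      extend : ∀ {ρ x F} → IsApprox ρ F → (∀ z → z ∈ x → ∃[ w ] ⟪ z , w ⟫ ∈ F) → ∃[ f ] IsValue f (x ∷ ρ)
      extend {ρ} {x} {F} F-approx F-total = result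
        where
        y₀ = G ⟨ F ↾ x ∷ x ∷ ρ ⟩
        F′ = adjoin F ⟪ x , y₀ ⟫
        same : ∀ u → ¬ (x ∈ u) → F ↾ u ≡ F′ ↾ u
        same u x∉u = ↾-cong (λ z w _ → ∈adjoinˡ) λ z w z∈ h → case to ∈adjoin h of λ
          { (inj₁ h′) → h′
          ; (inj₂ e) → contradiction (subst (_∈ u) (proj₁ (⟪⟫-injective e)) z∈) x∉u }
        result : ∃[ f ] IsValue f (x ∷ ρ)
        result with em {∃[ y ] ⟪ x , y ⟫ ∈ F}
        ... | yes h = F , F-approx , h
        ... | no nh = F′ , approx , y₀ , ∈adjoinʳ
          where
          approx : IsApprox ρ F′
          approx p p∈ with to ∈adjoin p∈
          ... | inj₂ refl = x , y₀ , refl , (λ z z∈ → let w , h = F-total z z∈ in w , ∈adjoinˡ h) ,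
                            cong (λ h → G ⟨ h ∷ x ∷ ρ ⟩) (same x ∈-irrefl)
          ... | inj₁ p∈F with F-approx p p∈F
          -- If `x ∈ u`, closure of the domain would give `x` a value in `F` already. So the new
          -- pair leaves the history at `u` intact.
          ...   | u , v , refl , d , e = u , v , refl , (λ z z∈ → let w , h = d z z∈ in w , ∈adjoinˡ h) ,
                  trans e (cong (λ h → G ⟨ h ∷ u ∷ ρ ⟩) (same u λ x∈u → nh (d x x∈u)))

      exists : ∀ x ρ → ∃[ f ] IsValue f (x ∷ ρ)
      exists x ρ = ∈-induction {P = λ σ → ∃[ f ] IsValue f σ} (∃ᵒ (Δ₁⇒FO isValue-Δ)) ρ
        (λ x ih →
          let b , hb = Σ₁-collection {P = λ σ → IsValue (head σ) (tail σ)} (isValue-Δ .pos) ρ x ih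
              -- Collection may put other sets into `b`; only approximations may enter the union.
              c , hc = Δ₁-separation isApprox-Δ ρ b
          in extend (amalgam ρ c λ f f∈ → proj₂ (to (hc f) f∈))
               (λ z z∈ → let f , f∈ , a , w , h = hb z z∈ in
                  w , from ∈⋃ (f , from (hc f) (f∈ , a) , h))) x

    abstract
      private
        value : Env (suc n) → M
        value (x ∷ ρ) = proj₁ (proj₂ (proj₂ (exists x ρ)))

        value-spec : ∀ x ρ → ∃[ f ] IsApprox ρ f × ⟪ x , value (x ∷ ρ) ⟫ ∈ f
        value-spec x ρ = let f , a , _ , h = exists x ρ in f , a , h

    rec : Fun (suc n)
    rec ⟨ σ ⟩ = value σ
    rec .graph = resp₁
      (λ { (y ∷ x ∷ ρ) → mk⇔
        (λ (f , a , h) → let g , b , h′ = value-spec x ρ in agree-values a b x h h′)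
        (λ { refl → value-spec x ρ }) })
      (ex₁ {P = λ { (f ∷ y ∷ x ∷ ρ) → IsApprox ρ f × ⟪ x , y ⟫ ∈ f }} ((ren-Δ (lift (drops 2)) isApprox-Δ ∧ᶠ ⟪ var v2 , var v1 ⟫ᶠ ∈ᶠ var v0
         via λ { (f ∷ y ∷ x ∷ ρ) → ⇔-id }) .pos))

    history : Fun (suc n)
    history = setOf ⟪ var v0 , ren-Fun under rec ⟫ᶠ (var v0) ⊤ᶠ

    history-· : ∀ {x ρ z} → z ∈ x → history ⟨ x ∷ ρ ⟩ · z ≡ rec ⟨ z ∷ ρ ⟩
    history-· z∈ = ·-unique (from ∈Build (_ , z∈ , tt , refl))
      λ w h → case to ∈Build h of λ (_ , _ , _ , e) → case ⟪⟫-injective e of λ { (refl , e′) → e′ }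

    rec-eq : ∀ x ρ → rec ⟨ x ∷ ρ ⟩ ≡ G ⟨ history ⟨ x ∷ ρ ⟩ ∷ x ∷ ρ ⟩
    rec-eq x ρ with value-spec x ρ
    ... | f , a , h with entry a h
    ...   | d , e = trans e (cong (λ h → G ⟨ h ∷ x ∷ ρ ⟩) (ext
        (λ p p∈ → case to ∈↾ p∈ of λ { (z , w , refl , z∈ , p∈f) → from ∈Build
           (z , z∈ , tt , cong ⟪ z ,_⟫ (rec-value z z∈ w p∈f)) })
        (λ p p∈ → case to ∈Build p∈ of λ { (z , z∈ , _ , refl) → let w , h′ = d z z∈ in
           from ∈↾ (z , _ , refl , z∈ , subst (λ u → ⟪ z , u ⟫ ∈ f) (rec-value z z∈ w h′) h′) })))
      where
      rec-value : ∀ z → z ∈ x → ∀ w → ⟪ z , w ⟫ ∈ f → w ≡ rec ⟨ z ∷ ρ ⟩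
      rec-value z z∈ w h′ = let g , b , h″ = value-spec z ρ in agree-values a b z h′ h″

-- Ordinals, natural numbers, functions and finite sequences inside the model.

module NaturalNumbers
  {ℓ : Level} (em : ExcludedMiddle ℓ) (𝓜 : Structure ℓ) (kp : IsKPModel 𝓜) where
  open SetFunctions em 𝓜 kp public
  open Structure 𝓜 renaming (Carrier to M)
  open Renaming
  open Fun
  private variable
    P Q : Env n → Set ℓ

  isEmpty : ∀ {x} → IsEmpty 𝓜 x ⇔ (x ≡ ∅)
  isEmpty = mk⇔ (λ h → ext (λ z z∈ → contradiction z∈ (h z)) (λ z z∈ → contradiction z∈ ∉∅)) λ { refl y → ∉∅ }

  isPair : ∀ {p x y} → IsPair 𝓜 p x y ⇔ (p ≡ ⟅ x , y ⟆)
  isPair = mk⇔ (λ h → ext (λ z z∈ → from ∈⟅⟆ (to (h z) z∈)) (λ z z∈ → from (h z) (to ∈⟅⟆ z∈))) λ { refl z → ∈⟅⟆ }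

  isOrderedPair : ∀ {p x y} → IsOrderedPair 𝓜 p x y ⇔ (p ≡ ⟪ x , y ⟫)
  isOrderedPair = mk⇔
    (λ (u , v , hu , hv , hp) → trans (to isPair hp) (cong₂ ⟅_,_⟆ (to isPair hu) (to isPair hv)))
    (λ e → _ , _ , from isPair refl , from isPair refl , from isPair e)

  isSuc : ∀ {y x} → IsSuc 𝓜 y x ⇔ (y ≡ S x)
  isSuc = mk⇔ (λ h → ext (λ z z∈ → from ∈adjoin (to (h z) z∈)) (λ z z∈ → from (h z) (to ∈adjoin z∈)))
              λ { refl z → ∈adjoin }

  maps : ∀ {f x y} → Maps 𝓜 f x y ⇔ ⟪ x , y ⟫ ∈ f
  maps {f} = mk⇔ (λ (p , e , p∈) → subst (_∈ f) (to isOrderedPair e) p∈) (λ h → _ , from isOrderedPair refl , h)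

  ∈-asym : ∀ {x y} → y ∈ x → ¬ (x ∈ y)
  ∈-asym {x} = ∈-induction {P = λ { (x ∷ []) → ∀ y → y ∈ x → ¬ (x ∈ y) }}
    (Δ₁⇒FO (∀∈ᶠ (var v0) (¬ᶠ (var v1 ∈ᶠ var v0)) via λ { (x ∷ []) → ⇔-id })) []
    (λ x ih y y∈x x∈y → ih y y∈x x x∈y y∈x) x _

  S-injective : ∀ {x y} → S x ≡ S y → x ≡ y
  S-injective {x} {y} e with to ∈adjoin (subst (x ∈_) e ∈adjoinʳ) | to ∈adjoin (subst (y ∈_) (sym e) ∈adjoinʳ)
  ... | inj₂ h | _ = h
  ... | inj₁ _ | inj₂ h = sym h
  ... | inj₁ h | inj₁ h′ = contradiction h′ (∈-asym h)

  S≢∅ : ∀ {x} → S x ≢ ∅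
  S≢∅ {x} e = ∉∅ (subst (x ∈_) e ∈adjoinʳ)

  x∈Sx : ∀ {x} → x ∈ S x
  x∈Sx = ∈adjoinʳ

  Transitive Ordinal Nat : M → Set ℓ
  Transitive = IsTransitive 𝓜
  Ordinal = IsOrdinal 𝓜
  Nat = IsNat 𝓜

  transitive-Δ : (f : Fun n) → Δ₁ (λ ρ → Transitive (f ⟨ ρ ⟩))
  transitive-Δ f = ∀∈ᶠ f (∀∈ᶠ (var v0) (var v0 ∈ᶠ wk (wk f))) via λ ρ → ⇔-id

  ordinal-Δ : (f : Fun n) → Δ₁ (λ ρ → Ordinal (f ⟨ ρ ⟩))
  ordinal-Δ f = transitive-Δ f ∧ᶠ ∀∈ᶠ f (transitive-Δ (var v0)) via λ ρ → ⇔-id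

  nat-Δ : (f : Fun n) → Δ₁ (λ ρ → Nat (f ⟨ ρ ⟩))
  nat-Δ f = ordinal-Δ f ∧ᶠ ∀∈ᶠ (Sᶠ f) (var v0 ≡ᶠ ∅ᶠ ∨ᶠ ∃∈ᶠ (var v0) (var v1 ≡ᶠ Sᶠ (var v0)))
    via λ ρ → ⇔-id ×-⇔ mk⇔
      (λ h m m∈ → case h m (from ∈adjoin m∈) of λ
        { (inj₁ e) → inj₁ (from isEmpty e) ; (inj₂ (k , _ , e)) → inj₂ (k , from isSuc e) })
      (λ h m m∈ → case h m (to ∈adjoin m∈) of λ
        { (inj₁ e) → inj₁ (to isEmpty e)
        ; (inj₂ (k , e)) → inj₂ (k , subst (k ∈_) (sym (to isSuc e)) x∈Sx , to isSuc e) })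

  ∅-ordinal : Ordinal ∅
  ∅-ordinal = (λ y y∈ → contradiction y∈ ∉∅) , λ y y∈ → contradiction y∈ ∉∅

  S-transitive : ∀ {x} → Transitive x → Transitive (S x)
  S-transitive t y y∈ z z∈ with to ∈adjoin y∈
  ... | inj₁ y∈x = ∈adjoinˡ (t y y∈x z z∈)
  ... | inj₂ refl = ∈adjoinˡ z∈

  S-ordinal : ∀ {x} → Ordinal x → Ordinal (S x)
  S-ordinal (t , h) = S-transitive t , λ y y∈ → case to ∈adjoin y∈ of λ { (inj₁ y∈x) → h y y∈x ; (inj₂ refl) → t }

  ∈-ordinal : ∀ {x y} → Ordinal x → y ∈ x → Ordinal y
  ∈-ordinal (t , h) y∈ = h _ y∈ , λ z z∈ → h z (t _ y∈ z z∈)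

  ∅-nat : Nat ∅
  ∅-nat = ∅-ordinal , λ { m (inj₁ m∈) → contradiction m∈ ∉∅ ; m (inj₂ refl) → inj₁ (from isEmpty refl) }

  S-nat : ∀ {x} → Nat x → Nat (S x)
  S-nat (o , h) = S-ordinal o , λ
    { m (inj₁ m∈) → h m (to ∈adjoin m∈) ; m (inj₂ refl) → inj₂ (_ , from isSuc refl) }

  ∈-nat : ∀ {x y} → Nat x → y ∈ x → Nat y
  ∈-nat (o , h) y∈ = ∈-ordinal o y∈ , λ
    { m (inj₁ m∈) → h m (inj₁ (proj₁ o _ y∈ m m∈)) ; m (inj₂ refl) → h m (inj₁ y∈) }

  nat-cases : ∀ {x} → Nat x → x ≡ ∅ ⊎ (∃[ k ] Nat k × x ≡ S k)
  nat-cases nx@(o , h) with h _ (inj₂ refl)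
  ... | inj₁ e = inj₁ (to isEmpty e)
  ... | inj₂ (k , e) = inj₂ (k , ∈-nat nx (subst (k ∈_) (sym (to isSuc e)) x∈Sx) , to isSuc e)

  nat-induction : FO P → ∀ ρ → P (∅ ∷ ρ) → (∀ k → Nat k → P (k ∷ ρ) → P (S k ∷ ρ)) →
                  ∀ n → Nat n → P (n ∷ ρ)
  nat-induction {P = P} p ρ base step = ∈-induction {P = λ σ → Nat (lookup σ v0) → P σ}
    (Δ₁⇒FO (nat-Δ (var v0)) ⇒ᵒ p) ρ
    λ x ih nx → case nat-cases nx of λ
      { (inj₁ refl) → base ; (inj₂ (k , nk , refl)) → step k nk (ih k x∈Sx nk) }

  nat-transitive : ∀ {x} → Nat x → Transitive x
  nat-transitive (o , _) = proj₁ o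

  nat-⊆ : ∀ {x y} → Nat x → y ∈ x → y ⊆ x
  nat-⊆ nx y∈ = nat-transitive nx _ y∈

  -- Nested induction on `x` and `y`. An element of `x` outside `y` is comparable with `y`, which
  -- forces `y ∈ x`; the mirror case gives `x ∈ y`; with neither, extensionality gives equality.
  trichotomy : ∀ {x y} → Ordinal x → Ordinal y → x ∈ y ⊎ x ≡ y ⊎ y ∈ x
  trichotomy {x} {y} ox oy = outer x ox y oy
    where
    Comparable : M → M → Set ℓ
    Comparable x y = x ∈ y ⊎ x ≡ y ⊎ y ∈ x
    comparable-Δ : Δ₁ {2 + n} (λ σ → Comparable (lookup σ v1) (lookup σ v0))
    comparable-Δ = var v1 ∈ᶠ var v0 ∨ᶠ var v1 ≡ᶠ var v0 ∨ᶠ var v0 ∈ᶠ var v1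
    ordinalᵒ : FO {1 + n} (λ σ → Ordinal (lookup σ v0))
    ordinalᵒ = Δ₁⇒FO (ordinal-Δ (var v0))
    compare : ∀ x → Ordinal x → ∀ y → Ordinal y →
      (∀ a → a ∈ x → Comparable a y) → (∀ b → b ∈ y → Comparable x b) → Comparable x y
    compare x ox y oy h h′ with em {∃[ a ] a ∈ x × ¬ (a ∈ y)} | em {∃[ b ] b ∈ y × ¬ (b ∈ x)}
    ... | yes (a , a∈ , a∉) | _ with h a a∈
    ...   | inj₁ a∈y = contradiction a∈y a∉
    ...   | inj₂ (inj₁ refl) = inj₂ (inj₂ a∈)
    ...   | inj₂ (inj₂ y∈a) = inj₂ (inj₂ (proj₁ ox a a∈ y y∈a))
    compare x ox y oy h h′ | no _ | yes (b , b∈ , b∉) with h′ b b∈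
    ...   | inj₁ x∈b = inj₁ (proj₁ oy b b∈ x x∈b)
    ...   | inj₂ (inj₁ refl) = inj₁ b∈
    ...   | inj₂ (inj₂ b∈x) = contradiction b∈x b∉
    compare x ox y oy h h′ | no p | no q = inj₂ (inj₁ (ext
      (λ a a∈ → by-contradiction λ a∉ → p (a , a∈ , a∉)) (λ b b∈ → by-contradiction λ b∉ → q (b , b∈ , b∉))))
    outer : ∀ x → Ordinal x → ∀ y → Ordinal y → Comparable x y
    outer = ∈-induction {P = λ { (x ∷ []) → Ordinal x → ∀ y → Ordinal y → Comparable x y }}
      (resp-FO (λ { (x ∷ []) → ⇔-id }) (ordinalᵒ ⇒ᵒ ∀ᵒ (ordinalᵒ ⇒ᵒ Δ₁⇒FO comparable-Δ))) []
      λ x ih ox → ∈-induction {P = λ { (y ∷ x ∷ []) → Ordinal y → Comparable x y }}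
        (resp-FO (λ { (y ∷ x ∷ []) → ⇔-id }) (ordinalᵒ ⇒ᵒ Δ₁⇒FO comparable-Δ)) (x ∷ [])
        λ y ih′ oy → compare x ox y oy (λ a a∈ → ih a a∈ (∈-ordinal ox a∈) y oy)
                                        (λ b b∈ → ih′ b b∈ (∈-ordinal oy b∈))

  -- Writing values as the total application `s · i` removes the quantifier over values from the
  -- official definition and makes the notion plainly Δ₁; `isFunction` shows the equivalence.
  record Fn (s d : M) : Set ℓ where
    field
      is-pair : ∀ p → p ∈ s → ∃[ i ] i ∈ d × p ≡ ⟪ i , s · i ⟫
      value∈  : ∀ i → i ∈ d → ⟪ i , s · i ⟫ ∈ s

    dom : ∀ {i y} → ⟪ i , y ⟫ ∈ s → i ∈ d
    dom h with is-pair _ h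
    ... | i , i∈ , e with ⟪⟫-injective e
    ...   | refl , _ = i∈

    value≡ : ∀ {i y} → ⟪ i , y ⟫ ∈ s → y ≡ s · i
    value≡ h with is-pair _ h
    ... | i , i∈ , e with ⟪⟫-injective e
    ...   | refl , e′ = e′
  open Fn public

  mkFn : ∀ {s d} → (∀ p → p ∈ s → ∃[ i ] ∃[ y ] i ∈ d × p ≡ ⟪ i , y ⟫) →
         (∀ i → i ∈ d → ∃[ y ] ⟪ i , y ⟫ ∈ s × (∀ y′ → ⟪ i , y′ ⟫ ∈ s → y′ ≡ y)) → Fn s d
  mkFn {s} {d} h h′ = record
    { is-pair = λ p p∈ → case h p p∈ of λ { (i , y , i∈ , refl) → i , i∈ , cong ⟪ i ,_⟫ (value i i∈ y p∈) }
    ; value∈ = λ i i∈ → let y , y∈ , u = h′ i i∈ in subst (λ z → ⟪ i , z ⟫ ∈ s) (sym (·-unique y∈ u)) y∈ }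
    where
    value : ∀ i → i ∈ d → ∀ y → ⟪ i , y ⟫ ∈ s → y ≡ s · i
    value i i∈ y y∈ = let y₀ , y₀∈ , u = h′ i i∈ in trans (u y y∈) (sym (·-unique y₀∈ u))

  isFunction : ∀ {s d} → IsFunction 𝓜 s d ⇔ Fn s d
  isFunction {s} {d} = mk⇔ ⇒ ⇐
    where
    ⇒ : IsFunction 𝓜 s d → Fn s d
    ⇒ (h , h′) = mkFn
      (λ p p∈ → let i , y , i∈ , e = h p p∈ in i , y , i∈ , to isOrderedPair e)
      (λ i i∈ → let y , y∈ , u = h′ i i∈ in y , to maps y∈ , λ y′ y′∈ → u y′ (from maps y′∈))
    ⇐ : Fn s d → IsFunction 𝓜 s d
    ⇐ f = (λ p p∈ → let i , i∈ , e = f .is-pair p p∈ in i , _ , i∈ , from isOrderedPair e) ,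
          (λ i i∈ → _ , from maps (f .value∈ i i∈) , λ y′ y′∈ → value≡ f (to maps y′∈))

  fn-Δ : (f g : Fun n) → Δ₁ (λ ρ → Fn (f ⟨ ρ ⟩) (g ⟨ ρ ⟩))
  fn-Δ f g = ∀∈ᶠ f (∃∈ᶠ (wk g) (var v1 ≡ᶠ ⟪ var v0 , wk (wk f) ·ᶠ var v0 ⟫ᶠ)) ∧ᶠ
             ∀∈ᶠ g (⟪ var v0 , wk f ·ᶠ var v0 ⟫ᶠ ∈ᶠ wk f)
    via λ ρ → mk⇔ (λ (a , b) → record { is-pair = a ; value∈ = b }) (λ f → f .is-pair , f .value∈)

  Fn-ext : ∀ {s t d} → Fn s d → Fn t d → (∀ i → i ∈ d → s · i ≡ t · i) → s ≡ t
  Fn-ext {s} {t} f g h = ext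
    (λ p p∈ → case f .is-pair p p∈ of λ { (i , i∈ , refl) →
       subst (λ y → ⟪ i , y ⟫ ∈ t) (sym (h i i∈)) (g .value∈ i i∈) })
    (λ p p∈ → case g .is-pair p p∈ of λ { (i , i∈ , refl) →
       subst (λ y → ⟪ i , y ⟫ ∈ s) (h i i∈) (f .value∈ i i∈) })

  ∅-Fn : Fn ∅ ∅
  ∅-Fn = mkFn (λ p p∈ → contradiction p∈ ∉∅) (λ p p∈ → contradiction p∈ ∉∅)

  Fn-∅ : ∀ {s} → Fn s ∅ → s ≡ ∅
  Fn-∅ f = Fn-ext f ∅-Fn λ i i∈ → contradiction i∈ ∉∅

  module _ {s m e : M} (f : Fn s m) where
    append = adjoin s ⟪ m , e ⟫

    private
      at-m : ∀ {y} → ⟪ m , y ⟫ ∈ append → y ≡ e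
      at-m h with to ∈adjoin h
      ... | inj₁ h′ = contradiction (dom f h′) ∈-irrefl
      ... | inj₂ h′ = proj₂ (⟪⟫-injective h′)

      before-m : ∀ {i y} → i ∈ m → ⟪ i , y ⟫ ∈ append → ⟪ i , y ⟫ ∈ s
      before-m i∈ h with to ∈adjoin h
      ... | inj₁ h′ = h′
      ... | inj₂ h′ with ⟪⟫-injective h′
      ...   | refl , _ = contradiction i∈ ∈-irrefl

    append-last : append · m ≡ e
    append-last = ·-unique ∈adjoinʳ λ y → at-m

    append-· : ∀ {i} → i ∈ m → append · i ≡ s · i
    append-· i∈ = ·-unique (∈adjoinˡ (f .value∈ _ i∈)) λ y h → value≡ f (before-m i∈ h)

    append-Fn : Fn append (S m)
    append-Fn = mkFn
      (λ p p∈ → case to ∈adjoin p∈ of λ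
        { (inj₁ h) → let i , i∈ , e = f .is-pair p h in i , _ , ∈adjoinˡ i∈ , e
        ; (inj₂ h) → m , e , x∈Sx , h })
      (λ i i∈ → case to ∈adjoin i∈ of λ
        { (inj₁ h) → s · i , ∈adjoinˡ (f .value∈ i h) , λ y y∈ → value≡ f (before-m h y∈)
        ; (inj₂ refl) → e , ∈adjoinʳ , λ y → at-m })

    append-↾ : ∀ {i} → i ∈ S m → append ↾ i ≡ s ↾ i
    append-↾ {i} i∈ = ↾-cong
      (λ z w z∈ h → case to ∈adjoin h of λ
        { (inj₁ h′) → h′
        ; (inj₂ h′) → contradiction (subst (_∈ i) (proj₁ (⟪⟫-injective h′)) z∈)
            (case to ∈adjoin i∈ of λ { (inj₁ i∈m) → ∈-asym i∈m ; (inj₂ refl) → ∈-irrefl }) })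
      (λ z w _ → ∈adjoinˡ)

  ↾-Fn : ∀ {t d c} → Fn t d → c ⊆ d → Fn (t ↾ c) c
  ↾-Fn f c⊆d = mkFn
    (λ p p∈ → let z , w , e , z∈ , _ = to ∈↾ p∈ in z , w , z∈ , e)
    (λ i i∈ → _ , from ∈↾-pair (i∈ , f .value∈ i (c⊆d i i∈)) , λ y h → value≡ f (proj₂ (to ∈↾-pair h)))

  ↾-· : ∀ {t d c i} → Fn t d → c ⊆ d → i ∈ c → t ↾ c · i ≡ t · i
  ↾-· f c⊆d i∈ = ·-unique (from ∈↾-pair (i∈ , f .value∈ _ (c⊆d _ i∈))) λ y h → value≡ f (proj₂ (to ∈↾-pair h))

  ↾-self : ∀ {t d} → Fn t d → t ↾ d ≡ t
  ↾-self f = Fn-ext (↾-Fn f λ _ h → h) f λ i → ↾-· f λ _ h → h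

  ↾-↾ : ∀ {t c b} → b ⊆ c → t ↾ c ↾ b ≡ t ↾ b
  ↾-↾ b⊆c = ↾-cong (λ z w _ h → proj₂ (to ∈↾-pair h)) (λ z w z∈ h → from ∈↾-pair (b⊆c z z∈ , h))

  unappend : ∀ {t m} → Fn t (S m) → t ≡ adjoin (t ↾ m) ⟪ m , t · m ⟫
  unappend f = Fn-ext f (append-Fn (↾-Fn f λ _ → ∈adjoinˡ)) λ i i∈ → case to ∈adjoin i∈ of λ
    { (inj₁ i∈m) → sym (trans (append-· (↾-Fn f λ _ → ∈adjoinˡ) i∈m) (↾-· f (λ _ → ∈adjoinˡ) i∈m))
    ; (inj₂ refl) → sym (append-last (↾-Fn f λ _ → ∈adjoinˡ)) }

  adjoinᶠ : Fun n → Fun n → Fun n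
  adjoinᶠ f g = f ∪ᶠ singᶠ g

  -- The set of functions s on l with s(i) ∈ E(s ↾ i , i) for all i ∈ l.
  module Sequences {n} (E : Fun (2 + n)) where
    private
      E′ : Fun (4 + n)
      E′ = ren-Fun (lift (lift (drops 2))) E

      extensions : Fun (3 + n)
      extensions = bigᶠ (setOf (adjoinᶠ (var v1) ⟪ var v2 , var v0 ⟫ᶠ) E′ ⊤ᶠ) (var v1 ·ᶠ var v0) ⊤ᶠ

      body : Fun (2 + n)
      -- At ∅ only the empty sequence, at `S m` all one-entry extensions of the sequences on `m`;
      -- the predecessor is sought among the elements of the argument. Other arguments receive the
      -- empty set.
      body = sepᶠ (singᶠ ∅ᶠ) (var v2 ≡ᶠ ∅ᶠ) ∪ᶠ bigᶠ extensions (var v1) (var v2 ≡ᶠ Sᶠ (var v0))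

      open Recursion body

    Seq : Fun (1 + n)
    Seq = rec

    ∈Seq-∅ : ∀ {ρ s} → s ∈ Seq ⟨ ∅ ∷ ρ ⟩ ⇔ (s ≡ ∅)
    ∈Seq-∅ {ρ} {s} = mk⇔
      (λ h → case to ∈∪ (subst (s ∈_) (rec-eq ∅ ρ) h) of λ
        { (inj₁ h) → to ∈sing (proj₁ (to ∈Sep h))
        ; (inj₂ h) → contradiction (proj₁ (proj₂ (to ∈Big h))) ∉∅ })
      (λ e → subst (s ∈_) (sym (rec-eq ∅ ρ)) (from ∈∪ (inj₁ (from ∈Sep (from ∈sing e , refl)))))

    ∈Seq-S : ∀ {m ρ t} → t ∈ Seq ⟨ S m ∷ ρ ⟩ ⇔
             (∃[ s ] s ∈ Seq ⟨ m ∷ ρ ⟩ × ∃[ e ] e ∈ E ⟨ s ∷ m ∷ ρ ⟩ × t ≡ adjoin s ⟪ m , e ⟫)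
    ∈Seq-S {m} {ρ} {t} = mk⇔
      (λ h → case to ∈∪ (subst (t ∈_) (rec-eq (S m) ρ) h) of λ
        { (inj₁ h) → contradiction (proj₂ (to ∈Sep h)) S≢∅
        ; (inj₂ h) → case to ∈Big h of λ (m′ , m′∈ , e≡ , h′) → case S-injective e≡ of λ { refl →
            case to ∈Big h′ of λ (s , s∈ , _ , h″) → case to ∈Build h″ of λ (e , e∈ , _ , t≡) →
              s , subst (s ∈_) (history-· x∈Sx) s∈ , e , e∈ , t≡ } })
      (λ (s , s∈ , e , e∈ , t≡) → subst (t ∈_) (sym (rec-eq (S m) ρ)) (from ∈∪ (inj₂ (from ∈Big
        (m , x∈Sx , refl , from ∈Big (s , subst (s ∈_) (sym (history-· x∈Sx)) s∈ , tt , from ∈Build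
          (e , e∈ , tt , t≡)))))))

    Coherent : Env n → M → M → Set ℓ
    Coherent ρ l s = Fn s l × (∀ i → i ∈ l → s · i ∈ E ⟨ s ↾ i ∷ i ∷ ρ ⟩)

    private
      E″ : Fun (3 + n)
      E″ ⟨ i ∷ s ∷ l ∷ ρ ⟩ = E ⟨ s ↾ i ∷ i ∷ ρ ⟩
      E″ .graph = resp₁ (λ { (y ∷ i ∷ s ∷ l ∷ ρ) → ⇔-id })
        (subst₁ {P = λ { (a ∷ y ∷ i ∷ s ∷ l ∷ ρ) → y ≡ E ⟨ a ∷ i ∷ ρ ⟩ }}
          (resp₁ (λ { (a ∷ y ∷ i ∷ s ∷ l ∷ ρ) → ⇔-id }) (ren₁ r (E .graph))) (var v2 ↾ᶠ var v1))
        where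
        r : Renaming (3 + n) (5 + n)
        r .index zero = v1
        r .index (suc zero) = v0
        r .index (suc (suc zero)) = v2
        r .index (suc (suc (suc i))) = suc (suc (suc (suc (suc i))))
        r .env (a ∷ y ∷ i ∷ s ∷ l ∷ ρ) = y ∷ a ∷ i ∷ ρ
        r .agree (a ∷ y ∷ i ∷ s ∷ l ∷ ρ) zero = refl
        r .agree (a ∷ y ∷ i ∷ s ∷ l ∷ ρ) (suc zero) = refl
        r .agree (a ∷ y ∷ i ∷ s ∷ l ∷ ρ) (suc (suc zero)) = refl
        r .agree (a ∷ y ∷ i ∷ s ∷ l ∷ ρ) (suc (suc (suc j))) = refl

    ∈Seq : ∀ {l ρ} → Nat l → ∀ s → s ∈ Seq ⟨ l ∷ ρ ⟩ ⇔ Coherent ρ l s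
    ∈Seq {l} {ρ} = nat-induction {P = λ { (l ∷ ρ) → ∀ s → s ∈ Seq ⟨ l ∷ ρ ⟩ ⇔ Coherent ρ l s }}
      (resp-FO (λ { (l ∷ ρ) → ⇔-id }) (∀ᵒ (Δ₁⇒FO {P = λ { (s ∷ l ∷ ρ) → s ∈ Seq ⟨ l ∷ ρ ⟩ ⇔ Coherent ρ l s }} (var v0 ∈ᶠ wk Seq ⇔ᶠ (fn-Δ (var v0) (var v1) ∧ᶠ
        ∀∈ᶠ (var v1) (var v1 ·ᶠ var v0 ∈ᶠ E″)) via λ { (s ∷ l ∷ ρ) → ⇔-id })))) ρ
      (λ s → mk⇔ (λ h → case to ∈Seq-∅ h of λ { refl → ∅-Fn , λ i i∈ → contradiction i∈ ∉∅ })
                 (λ (f , _) → from ∈Seq-∅ (Fn-∅ f)))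
      (λ m nm ih t → mk⇔
        (λ h → case to ∈Seq-S h of λ { (s , s∈ , e , e∈ , refl) →
          let f , c = to (ih s) s∈ in append-Fn f , λ i i∈ →
            subst (λ z → adjoin s ⟪ m , e ⟫ · i ∈ E ⟨ z ∷ i ∷ ρ ⟩) (sym (append-↾ f i∈))
              (case to ∈adjoin i∈ of λ
                { (inj₁ i∈m) → subst (_∈ E ⟨ s ↾ i ∷ i ∷ ρ ⟩) (sym (append-· f i∈m)) (c i i∈m)
                ; (inj₂ refl) → subst₂ (λ a b → a ∈ E ⟨ b ∷ i ∷ ρ ⟩) (sym (append-last f)) (sym (↾-self f)) e∈ }) })
        (λ (f , c) → from ∈Seq-S (t ↾ m ,
           from (ih _) (↾-Fn f (λ _ → ∈adjoinˡ) , λ i i∈ →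
             subst₂ (λ a b → a ∈ E ⟨ b ∷ i ∷ ρ ⟩) (sym (↾-· f (λ _ → ∈adjoinˡ) i∈))
               (sym (↾-↾ (nat-⊆ nm i∈))) (c i (∈adjoinˡ i∈))) ,
           t · m , c m x∈Sx , unappend f)))
      l

  private
    module Tuples = Sequences {1} (var v2)

  abstract
    -- The set Aⁿ. KP has no power set from which to separate it, so it arises by recursion on `n`,
    -- which may be nonstandard.
    Tup : M → M → M
    Tup A n = Tuples.Seq ⟨ n ∷ A ∷ [] ⟩

    private
      Tup-def : ∀ ρ → Tuples.Seq ⟨ ρ ⟩ ≡ Tup (lookup ρ v1) (lookup ρ v0)
      Tup-def (n ∷ A ∷ []) = refl

    ∈Tup : ∀ {A n s} → Nat n → s ∈ Tup A n ⇔ (Fn s n × (∀ i → i ∈ n → s · i ∈ A))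
    ∈Tup nn = Tuples.∈Seq nn _

  Tupᶠ : Fun n → Fun n → Fun n
  Tupᶠ f g = comp (seal Tuples.Seq _ Tup-def) (g ∷ f ∷ [])

  isTuple : ∀ {A n s} → Nat n → IsTuple 𝓜 A n s ⇔ s ∈ Tup A n
  isTuple {A} nn = ⇔-trans (mk⇔
    (λ (f , h) → let f′ = to isFunction f in f′ , λ i i∈ → h i _ (from maps (f′ .value∈ i i∈)))
    (λ (f , h) → from isFunction f , λ i x ix → subst (_∈ A) (sym (value≡ f (to maps ix))) (h i (dom f (to maps ix)))))
    (⇔-sym (∈Tup nn))

-- Operations on relations, formation sequences and definable subsets.

module FormationSequences
  {ℓ : Level} (em : ExcludedMiddle ℓ) (𝓜 : Structure ℓ) (kp : IsKPModel 𝓜) where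
  open NaturalNumbers em 𝓜 kp public
  open Structure 𝓜 renaming (Carrier to M)
  open Fun
  private variable
    P Q : Env n → Set ℓ

  ⊆-Δ : (f g : Fun n) → Δ₁ (λ ρ → f ⟨ ρ ⟩ ⊆ g ⟨ ρ ⟩)
  ⊆-Δ f g = ∀∈ᶠ f (var v0 ∈ᶠ wk g) via λ ρ → ⇔-id

  private
    diag∈F diag≡F : Fun 4
    diag∈F = sepᶠ (Tupᶠ (var v0) (var v1)) (var v0 ·ᶠ var v3 ∈ᶠ var v0 ·ᶠ var v4)
    diag≡F = sepᶠ (Tupᶠ (var v0) (var v1)) (var v0 ·ᶠ var v3 ≡ᶠ var v0 ·ᶠ var v4)
    complF projF : Fun 3
    complF = sepᶠ (Tupᶠ (var v0) (var v1)) (¬ᶠ (var v0 ∈ᶠ var v3))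
    projF = sepᶠ (Tupᶠ (var v0) (var v1)) (∃∈ᶠ (var v3) (⊆-Δ (var v1) (var v0)))
    interF : Fun 2
    interF = sepᶠ (var v0) (var v0 ∈ᶠ var v2)

  abstract
    Diag∈ Diag≡ : M → M → M → M → M
    Diag∈ A n j k = diag∈F ⟨ A ∷ n ∷ j ∷ k ∷ [] ⟩
    Diag≡ A n j k = diag≡F ⟨ A ∷ n ∷ j ∷ k ∷ [] ⟩
    Compl Proj : M → M → M → M
    Compl A n R = complF ⟨ A ∷ n ∷ R ∷ [] ⟩
    Proj A n R = projF ⟨ A ∷ n ∷ R ∷ [] ⟩
    Inter : M → M → M
    Inter R₁ R₂ = interF ⟨ R₁ ∷ R₂ ∷ [] ⟩

    ∈Diag∈ : ∀ {A n j k s} → s ∈ Diag∈ A n j k ⇔ (s ∈ Tup A n × s · j ∈ s · k)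
    ∈Diag∈ = ∈Sep
    ∈Diag≡ : ∀ {A n j k s} → s ∈ Diag≡ A n j k ⇔ (s ∈ Tup A n × s · j ≡ s · k)
    ∈Diag≡ = ∈Sep
    ∈Compl : ∀ {A n R s} → s ∈ Compl A n R ⇔ (s ∈ Tup A n × ¬ (s ∈ R))
    ∈Compl = ∈Sep
    ∈Proj : ∀ {A n R s} → s ∈ Proj A n R ⇔ (s ∈ Tup A n × ∃[ t ] t ∈ R × s ⊆ t)
    ∈Proj = ∈Sep
    ∈Inter : ∀ {R₁ R₂ s} → s ∈ Inter R₁ R₂ ⇔ (s ∈ R₁ × s ∈ R₂)
    ∈Inter = ∈Sep

    private
      Diag∈-def : ∀ ρ → diag∈F ⟨ ρ ⟩ ≡ Diag∈ (lookup ρ v0) (lookup ρ v1) (lookup ρ v2) (lookup ρ v3)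
      Diag∈-def (A ∷ n ∷ j ∷ k ∷ []) = refl
      Diag≡-def : ∀ ρ → diag≡F ⟨ ρ ⟩ ≡ Diag≡ (lookup ρ v0) (lookup ρ v1) (lookup ρ v2) (lookup ρ v3)
      Diag≡-def (A ∷ n ∷ j ∷ k ∷ []) = refl
      Compl-def : ∀ ρ → complF ⟨ ρ ⟩ ≡ Compl (lookup ρ v0) (lookup ρ v1) (lookup ρ v2)
      Compl-def (A ∷ n ∷ R ∷ []) = refl
      Proj-def : ∀ ρ → projF ⟨ ρ ⟩ ≡ Proj (lookup ρ v0) (lookup ρ v1) (lookup ρ v2)
      Proj-def (A ∷ n ∷ R ∷ []) = refl
      Inter-def : ∀ ρ → interF ⟨ ρ ⟩ ≡ Inter (lookup ρ v0) (lookup ρ v1)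
      Inter-def (R₁ ∷ R₂ ∷ []) = refl

  Diag∈ᶠ Diag≡ᶠ : Fun 4
  Diag∈ᶠ = seal diag∈F _ Diag∈-def
  Diag≡ᶠ = seal diag≡F _ Diag≡-def
  Complᶠ Projᶠ : Fun 3
  Complᶠ = seal complF _ Compl-def
  Projᶠ = seal projF _ Proj-def
  Interᶠ : Fun 2
  Interᶠ = seal interF _ Inter-def

  -- `ListedBefore g i` turns into `Listed (g ↾ i)`. A formation step then depends on earlier
  -- entries only through the restriction, which is the shape that `Sequences` requires.
  Listed : M → M → M → Set ℓ
  Listed g n R = ∃[ k ] ⟪ k , ⟪ n , R ⟫ ⟫ ∈ g

  listed-Δ : (g m r : Fun n) → Δ₁ (λ ρ → Listed (g ⟨ ρ ⟩) (m ⟨ ρ ⟩) (r ⟨ ρ ⟩))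
  listed-Δ g m r = ∃∈ᶠ (fldᶠ g) (⟪ var v0 , ⟪ wk m , wk r ⟫ᶠ ⟫ᶠ ∈ᶠ wk g) via λ ρ →
    mk⇔ (λ (k , _ , h) → k , h) (λ (k , h) → k , fldˡ h , h)

  entries : M → M
  entries g = fld (fld g)

  entriesᶠ : Fun n → Fun n
  entriesᶠ f = fldᶠ (fldᶠ f)

  ∈entries : ∀ {g n R} → Listed g n R → R ∈ entries g
  ∈entries (k , h) = fldʳ (fldʳ h)

  Listed-mono : ∀ {g g′ n R} → g ⊆ g′ → Listed g n R → Listed g′ n R
  Listed-mono h (k , p) = k , h _ p

  Step : M → M → M → M → Set ℓ
  Step A g n R =
      (∃[ j ] j ∈ n × ∃[ k ] k ∈ n × R ≡ Diag∈ A n j k)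
    ⊎ (∃[ j ] j ∈ n × ∃[ k ] k ∈ n × R ≡ Diag≡ A n j k)
    ⊎ (∃[ R₁ ] Listed g n R₁ × R ≡ Compl A n R₁)
    ⊎ (∃[ R₁ ] Listed g n R₁ × ∃[ R₂ ] Listed g n R₂ × R ≡ Inter R₁ R₂)
    ⊎ (∃[ R₁ ] Listed g (S n) R₁ × R ≡ Proj A n R₁)

  stepᵒ : FO {4} (λ σ → Step (lookup σ v0) (lookup σ v1) (lookup σ v2) (lookup σ v3))
  stepᵒ =
       ∃ᵒ (Δ₁⇒FO (var v0 ∈ᶠ var v3) ∧ᵒ ∃ᵒ (Δ₁⇒FO (var v0 ∈ᶠ var v4) ∧ᵒ
         Δ₁⇒FO (var v5 ≡ᶠ comp Diag∈ᶠ (var v2 ∷ var v4 ∷ var v1 ∷ var v0 ∷ []))))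
    ∨ᵒ ∃ᵒ (Δ₁⇒FO (var v0 ∈ᶠ var v3) ∧ᵒ ∃ᵒ (Δ₁⇒FO (var v0 ∈ᶠ var v4) ∧ᵒ
         Δ₁⇒FO (var v5 ≡ᶠ comp Diag≡ᶠ (var v2 ∷ var v4 ∷ var v1 ∷ var v0 ∷ []))))
    ∨ᵒ ∃ᵒ (Δ₁⇒FO (listed-Δ (var v2) (var v3) (var v0)) ∧ᵒ
         Δ₁⇒FO (var v4 ≡ᶠ comp Complᶠ (var v1 ∷ var v3 ∷ var v0 ∷ [])))
    ∨ᵒ ∃ᵒ (Δ₁⇒FO (listed-Δ (var v2) (var v3) (var v0)) ∧ᵒ
         ∃ᵒ (Δ₁⇒FO (listed-Δ (var v3) (var v4) (var v0)) ∧ᵒ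
           Δ₁⇒FO (var v5 ≡ᶠ comp Interᶠ (var v1 ∷ var v0 ∷ []))))
    ∨ᵒ ∃ᵒ (Δ₁⇒FO (listed-Δ (var v2) (Sᶠ (var v3)) (var v0)) ∧ᵒ
         Δ₁⇒FO (var v4 ≡ᶠ comp Projᶠ (var v1 ∷ var v3 ∷ var v0 ∷ [])))

  ext-⇔ : ∀ {x y} {B : M → Set ℓ} → (∀ {s} → s ∈ y ⇔ B s) → (∀ s → s ∈ x ⇔ B s) ⇔ (x ≡ y)
  ext-⇔ e = mk⇔ (λ h → ext (λ z z∈ → from e (to (h z) z∈)) (λ z z∈ → from (h z) (to e z∈))) λ { refl s → e }

  private
    ×-cong-⇔ : {A B C D : Set ℓ} → A ⇔ B → (B → C ⇔ D) → (A × C) ⇔ (B × D)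
    ×-cong-⇔ e f = mk⇔ (λ (a , c) → to e a , to (f (to e a)) c) (λ (b , d) → from e b , from (f b) d)

    values : ∀ {n s j k} (B : M → M → Set ℓ) → j ∈ n → k ∈ n → Fn s n →
             (∃[ x ] ∃[ y ] Maps 𝓜 s j x × Maps 𝓜 s k y × B x y) ⇔ B (s · j) (s · k)
    values {n} {s} {j} {k} B j∈ k∈ f = mk⇔ ⇒ ⇐
      where
      ⇒ : (∃[ x ] ∃[ y ] Maps 𝓜 s j x × Maps 𝓜 s k y × B x y) → B (s · j) (s · k)
      ⇒ (x , y , mx , my , b) = subst₂ B (value≡ f (to maps mx)) (value≡ f (to maps my)) b
      ⇐ : B (s · j) (s · k) → ∃[ x ] ∃[ y ] Maps 𝓜 s j x × Maps 𝓜 s k y × B x y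
      ⇐ b = s · j , s · k , from maps (f .value∈ j j∈) , from maps (f .value∈ k k∈) , b

    isDiag : ∀ {A n j k} (B : M → M → Set ℓ) → Nat n → j ∈ n → k ∈ n → ∀ s →
             (IsTuple 𝓜 A n s × (∃[ x ] ∃[ y ] Maps 𝓜 s j x × Maps 𝓜 s k y × B x y)) ⇔
             (s ∈ Tup A n × B (s · j) (s · k))
    isDiag B nn j∈ k∈ s = ×-cong-⇔ (isTuple nn) (λ s∈ → values B j∈ k∈ (proj₁ (to (∈Tup nn) s∈)))

    ∀s⇔ : {B C : M → Set ℓ} {x : M} → (∀ s → B s ⇔ C s) → (∀ s → s ∈ x ⇔ B s) ⇔ (∀ s → s ∈ x ⇔ C s)
    ∀s⇔ e = mk⇔ (λ h s → ⇔-trans (h s) (e s)) (λ h s → ⇔-trans (h s) (⇔-sym (e s)))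

    isDiag∈ : ∀ {A n j k R} → Nat n → j ∈ n → k ∈ n → IsDiag∈ 𝓜 A n j k R ⇔ (R ≡ Diag∈ A n j k)
    isDiag∈ nn j∈ k∈ = ⇔-trans (∀s⇔ (isDiag _∈_ nn j∈ k∈)) (ext-⇔ ∈Diag∈)

    isDiag≡ : ∀ {A n j k R} → Nat n → j ∈ n → k ∈ n → IsDiag≡ 𝓜 A n j k R ⇔ (R ≡ Diag≡ A n j k)
    isDiag≡ nn j∈ k∈ = ⇔-trans (∀s⇔ (isDiag _≡_ nn j∈ k∈)) (ext-⇔ ∈Diag≡)

    isCompl : ∀ {A n R₁ R} → Nat n → IsComplement 𝓜 A n R₁ R ⇔ (R ≡ Compl A n R₁)
    isCompl nn = ⇔-trans (∀s⇔ λ s → isTuple nn ×-⇔ ⇔-id) (ext-⇔ ∈Compl)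

    isProj : ∀ {A n R₁ R} → Nat n → IsProjection 𝓜 A n R₁ R ⇔ (R ≡ Proj A n R₁)
    isProj nn = ⇔-trans (∀s⇔ λ s → isTuple nn ×-⇔ ⇔-id) (ext-⇔ ∈Proj)

  lists : ∀ {g k n R} → Lists 𝓜 g k n R ⇔ ⟪ k , ⟪ n , R ⟫ ⟫ ∈ g
  lists = mk⇔ (λ (e , h , p) → subst (λ e → ⟪ _ , e ⟫ ∈ _) (to isOrderedPair h) (to maps p))
              (λ h → _ , from isOrderedPair refl , from maps h)

  listedBefore : ∀ {g i n R} → ListedBefore 𝓜 g i n R ⇔ Listed (g ↾ i) n R
  listedBefore = ∃-⇔ λ k → ⇔-trans (⇔-id ×-⇔ lists) (⇔-sym ∈↾-pair)

  isStep : ∀ {A g i n R} → Nat n → IsFormationStep 𝓜 A g i n R ⇔ Step A (g ↾ i) n R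
  isStep {A} {g} {i} {n} {R} nn = mk⇔ ⇒ ⇐
    where
    ⇒ : IsFormationStep 𝓜 A g i n R → Step A (g ↾ i) n R
    ⇒ (inj₁ (j , k , j∈ , k∈ , h)) = inj₁ (j , j∈ , k , k∈ , to (isDiag∈ nn j∈ k∈) h)
    ⇒ (inj₂ (inj₁ (j , k , j∈ , k∈ , h))) = inj₂ (inj₁ (j , j∈ , k , k∈ , to (isDiag≡ nn j∈ k∈) h))
    ⇒ (inj₂ (inj₂ (inj₁ (R₁ , l , h)))) = inj₂ (inj₂ (inj₁ (R₁ , to listedBefore l , to (isCompl nn) h)))
    ⇒ (inj₂ (inj₂ (inj₂ (inj₁ (R₁ , R₂ , l₁ , l₂ , h))))) =
      inj₂ (inj₂ (inj₂ (inj₁ (R₁ , to listedBefore l₁ , R₂ , to listedBefore l₂ , to (ext-⇔ ∈Inter) h))))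
    ⇒ (inj₂ (inj₂ (inj₂ (inj₂ (m , R₁ , e , l , h))))) =
      inj₂ (inj₂ (inj₂ (inj₂ (R₁ , subst (λ z → Listed (g ↾ i) z R₁) (to isSuc e) (to listedBefore l) ,
        to (isProj nn) h))))
    ⇐ : Step A (g ↾ i) n R → IsFormationStep 𝓜 A g i n R
    ⇐ (inj₁ (j , j∈ , k , k∈ , h)) = inj₁ (j , k , j∈ , k∈ , from (isDiag∈ nn j∈ k∈) h)
    ⇐ (inj₂ (inj₁ (j , j∈ , k , k∈ , h))) = inj₂ (inj₁ (j , k , j∈ , k∈ , from (isDiag≡ nn j∈ k∈) h))
    ⇐ (inj₂ (inj₂ (inj₁ (R₁ , l , h)))) = inj₂ (inj₂ (inj₁ (R₁ , from listedBefore l , from (isCompl nn) h)))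
    ⇐ (inj₂ (inj₂ (inj₂ (inj₁ (R₁ , l₁ , R₂ , l₂ , h))))) =
      inj₂ (inj₂ (inj₂ (inj₁ (R₁ , R₂ , from listedBefore l₁ , from listedBefore l₂ , from (ext-⇔ ∈Inter) h))))
    ⇐ (inj₂ (inj₂ (inj₂ (inj₂ (R₁ , l , h))))) =
      inj₂ (inj₂ (inj₂ (inj₂ (S n , R₁ , from isSuc refl , from listedBefore l , from (isProj nn) h))))

  Formation : M → M → M → Set ℓ
  Formation A l g = Nat l × Fn g l ×
    (∀ i → i ∈ l → ∃[ n ] ∃[ R ] Nat n × g · i ≡ ⟪ n , R ⟫ × Step A (g ↾ i) n R)

  isFormation : ∀ {A l g} → IsFormationSequence 𝓜 A l g ⇔ Formation A l g
  isFormation {A} {l} {g} = mk⇔ ⇒ ⇐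
    where
    ⇒ : IsFormationSequence 𝓜 A l g → Formation A l g
    ⇒ (nl , f , h) = nl , to isFunction f , λ i i∈ → let n , R , nn , e , s = h i i∈ in
      n , R , nn , sym (value≡ (to isFunction f) (to lists e)) , to (isStep nn) s
    ⇐ : Formation A l g → IsFormationSequence 𝓜 A l g
    ⇐ (nl , f , h) = nl , from isFunction f , λ i i∈ → let n , R , nn , e , s = h i i∈ in
      n , R , nn , from lists (subst (λ z → ⟪ i , z ⟫ ∈ g) e (f .value∈ i i∈)) , from (isStep nn) s

  Formed : M → M → Set ℓ
  Formed A g = ∃[ l ] Formation A l g

  private
    step↾ᵒ : FO {6} (λ σ → Step (lookup σ v4) (lookup σ v5 ↾ lookup σ v2) (lookup σ v1) (lookup σ v0))
    step↾ᵒ = resp-FO (λ { (R ∷ m ∷ i ∷ l ∷ A ∷ g ∷ []) → ⇔-id })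
      (substᵒ {P = λ σ → Step (lookup σ v5) (lookup σ v0) (lookup σ v2) (lookup σ v1)}
        (ren-FO (pick (v5 ∷ v0 ∷ v2 ∷ v1 ∷ [])) stepᵒ) (var v5 ↾ᶠ var v2))

  formedᵒ : FO {2} (λ σ → Formed (lookup σ v0) (lookup σ v1))
  formedᵒ = ∃ᵒ (Δ₁⇒FO (nat-Δ (var v0)) ∧ᵒ Δ₁⇒FO (fn-Δ (var v2) (var v0)) ∧ᵒ
    ∀ᵒ (Δ₁⇒FO (var v0 ∈ᶠ var v1) ⇒ᵒ ∃ᵒ ∃ᵒ (Δ₁⇒FO (nat-Δ (var v1)) ∧ᵒ
      Δ₁⇒FO (var v5 ·ᶠ var v2 ≡ᶠ ⟪ var v1 , var v0 ⟫ᶠ) ∧ᵒ step↾ᵒ)))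

  formed-∅ : ∀ {A} → Formed A ∅
  formed-∅ = ∅ , ∅-nat , ∅-Fn , λ i i∈ → contradiction i∈ ∉∅

  formed-step : ∀ {A g n R} → Formed A g → Nat n → Step A g n R →
                ∃[ g′ ] Formed A g′ × g ⊆ g′ × Listed g′ n R
  formed-step {A} {g} {n} {R} (l , nl , f , h) nn s =
    adjoin g ⟪ l , ⟪ n , R ⟫ ⟫ ,
    (S l , S-nat nl , append-Fn f , λ i i∈ → case to ∈adjoin i∈ of λ
      { (inj₁ i∈l) → let m , Q , nm , e , s′ = h i i∈l in
          m , Q , nm , trans (append-· f i∈l) e , subst (λ z → Step A z m Q) (sym (append-↾ f i∈)) s′
      ; (inj₂ refl) → n , R , nn , append-last f ,
          subst (λ z → Step A z n R) (sym (trans (append-↾ f i∈) (↾-self f))) s }) ,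
    (λ z → ∈adjoinˡ) , l , ∈adjoinʳ

  unrestrict : ∀ {g i n R} → Listed (g ↾ i) n R → Listed g n R
  unrestrict (k , h) = k , proj₂ (to ∈↾-pair h)

  DefinableRelation : M → M → M → Set ℓ
  DefinableRelation A n R = ∃[ g ] Formed A g × Listed g n R

  isDefinableRelation : ∀ {A n R} → IsDefinableRelation 𝓜 A n R ⇔ DefinableRelation A n R
  isDefinableRelation {A} {n} {R} = mk⇔
    (λ { (l , g , fs , lb) → g , (l , to isFormation fs) , unrestrict (to listedBefore lb) })
    (λ { (g , (l , fs) , lst) → l , g , from isFormation fs ,
          from listedBefore (subst (λ z → Listed z n R) (sym (↾-self (proj₁ (proj₂ fs)))) lst) })

  Section : M → M → M → M → M → Set ℓ
  Section A n s R z = ∀ x → x ∈ z ⇔ (x ∈ A × ∃[ t ] t ∈ R × s ⊆ t × ⟪ n , x ⟫ ∈ t)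

  DefinableSubset : M → M → Set ℓ
  DefinableSubset A z = ∃[ n ] ∃[ s ] ∃[ R ] Nat n × s ∈ Tup A n × DefinableRelation A (S n) R × Section A n s R z

  private
    section : ∀ {A n s R z} → (∀ x → x ∈ z ⇔ (x ∈ A × (∃[ t ] t ∈ R × s ⊆ t × Maps 𝓜 t n x))) ⇔ Section A n s R z
    section = ∀s⇔ λ x → ⇔-id ×-⇔ ∃-⇔ λ t → ⇔-id ×-⇔ (⇔-id ×-⇔ maps)

  isDefinableSubset : ∀ {A z} → IsDefinableSubset 𝓜 A z ⇔ DefinableSubset A z
  isDefinableSubset {A} {z} = mk⇔ ⇒ ⇐
    where
    ⇒ : IsDefinableSubset 𝓜 A z → DefinableSubset A z
    ⇒ (n , m , s , R , nn , e , ts , d , h) with to isSuc e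
    ... | refl = n , s , R , nn , to (isTuple nn) ts , to isDefinableRelation d , to section h
    ⇐ : DefinableSubset A z → IsDefinableSubset 𝓜 A z
    ⇐ (n , s , R , nn , ts , d , h) =
      n , S n , s , R , nn , from isSuc refl , from (isTuple nn) ts , from isDefinableRelation d , from section h

-- Subsets defined by finite disjunctions of atomic clauses.

module DefinableSubsets
  {ℓ : Level} (em : ExcludedMiddle ℓ) (𝓜 : Structure ℓ) (kp : IsKPModel 𝓜) where
  open FormationSequences em 𝓜 kp public
  open Structure 𝓜 renaming (Carrier to M)
  open Fun

  -- These atomic clauses cover every definability claim below: `equals` and `contains` describe the
  -- values of j, `belongs` gives A ⊆ Def(A), and `equals` alone describes finite subsets.
  data Kind : Set where
    equals contains belongs : Kind

  Rel : Kind → M → M → Set ℓ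
  Rel equals   a x = a ≡ x
  Rel contains a x = a ∈ x
  Rel belongs  a x = x ∈ a

  rel-Δ : ∀ c (f g : Fun n) → Δ₁ (λ ρ → Rel c (f ⟨ ρ ⟩) (g ⟨ ρ ⟩))
  rel-Δ equals   f g = f ≡ᶠ g
  rel-Δ contains f g = f ∈ᶠ g
  rel-Δ belongs  f g = g ∈ᶠ f

  -- The flag sets e c tell which coordinates of a tuple are compared in the way c with x.
  Clause : (Kind → M) → M → M → M → Set ℓ
  Clause e i a x = ∃[ c ] i ∈ e c × Rel c a x

  clause-Δ : (e : Kind → Fun n) (i f g : Fun n) →
             Δ₁ (λ ρ → Clause (λ c → e c ⟨ ρ ⟩) (i ⟨ ρ ⟩) (f ⟨ ρ ⟩) (g ⟨ ρ ⟩))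
  clause-Δ e i f g = part equals ∨ᶠ part contains ∨ᶠ part belongs via λ ρ → mk⇔
    (λ { (inj₁ h) → equals , h ; (inj₂ (inj₁ h)) → contains , h ; (inj₂ (inj₂ h)) → belongs , h })
    (λ { (equals , h) → inj₁ h ; (contains , h) → inj₂ (inj₁ h) ; (belongs , h) → inj₂ (inj₂ h) })
    where
    part : ∀ c → Δ₁ (λ ρ → i ⟨ ρ ⟩ ∈ e c ⟨ ρ ⟩ × Rel c (f ⟨ ρ ⟩) (g ⟨ ρ ⟩))
    part c = i ∈ᶠ e c ∧ᶠ rel-Δ c f g

  private
    flags : Fin n → Fin n → Fin n → Kind → Fun n
    flags i j k equals   = var i
    flags i j k contains = var j
    flags i j k belongs  = var k

    unionF : Fun 6
    unionF = sepᶠ (Tupᶠ (var v1) (Sᶠ (var v2)))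
      (∃∈ᶠ (var v1) (clause-Δ (flags v5 v6 (suc v6)) (var v0) (var v1 ·ᶠ var v0) (var v1 ·ᶠ var v4)))

  abstract
    -- The dimension n + 1 stays fixed while clauses are added, so variables are never renamed.
    Clauses : M → M → (Kind → M) → M → M
    Clauses A n e k = unionF ⟨ k ∷ A ∷ n ∷ e equals ∷ e contains ∷ e belongs ∷ [] ⟩

    ∈Clauses : ∀ {A n e k t} → t ∈ Clauses A n e k ⇔
               (t ∈ Tup A (S n) × ∃[ i ] i ∈ k × Clause e i (t · i) (t · n))
    ∈Clauses {A} {n} {e} {k} {t} = ⇔-trans ∈Sep (⇔-id ×-⇔ ∃-⇔ λ i → ⇔-id ×-⇔ mk⇔
      (λ { (equals , h) → equals , h ; (contains , h) → contains , h ; (belongs , h) → belongs , h })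
      (λ { (equals , h) → equals , h ; (contains , h) → contains , h ; (belongs , h) → belongs , h }))

    private
      flagged : M → M → M → Kind → M
      flagged a b d equals   = a
      flagged a b d contains = b
      flagged a b d belongs  = d

      Clauses-def : ∀ ρ → unionF ⟨ ρ ⟩ ≡ Clauses (lookup ρ v1) (lookup ρ v2)
        (flagged (lookup ρ v3) (lookup ρ v4) (lookup ρ v5)) (lookup ρ v0)
      Clauses-def (k ∷ A ∷ n ∷ a ∷ b ∷ d ∷ []) = refl

      Clauses-flagged : ∀ {A n e k} →
        Clauses A n (flagged (e equals) (e contains) (e belongs)) k ≡ Clauses A n e k
      Clauses-flagged = refl

  private
    Clausesᶠ : Fun 6
    Clausesᶠ = seal unionF _ Clauses-def

    Tup-· : ∀ {A n t i} → Nat n → t ∈ Tup A n → i ∈ n → t · i ∈ A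
    Tup-· nn t∈ i∈ = proj₂ (to (∈Tup nn) t∈) _ i∈

    -- Union by De Morgan's law.
    formed-union : ∀ {A n g R₁ R₂} → Nat n → Formed A g → Listed g n R₁ → Listed g n R₂ →
                   ∃[ g′ ] Formed A g′ × g ⊆ g′ × ∃[ R ] Listed g′ n R ×
                     (∀ t → t ∈ R ⇔ (t ∈ Tup A n × (t ∈ R₁ ⊎ t ∈ R₂)))
    formed-union {A} {n} nn f l₁ l₂ =
      let g₁ , f₁ , s₁ , c₁ = formed-step f nn (inj₂ (inj₂ (inj₁ (_ , l₁ , refl))))
          g₂ , f₂ , s₂ , c₂ = formed-step f₁ nn (inj₂ (inj₂ (inj₁ (_ , Listed-mono s₁ l₂ , refl))))
          g₃ , f₃ , s₃ , c₃ = formed-step f₂ nn (inj₂ (inj₂ (inj₂ (inj₁ (_ , Listed-mono s₂ c₁ , _ , c₂ , refl)))))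
          g₄ , f₄ , s₄ , c₄ = formed-step f₃ nn (inj₂ (inj₂ (inj₁ (_ , c₃ , refl))))
      in g₄ , f₄ , (λ z h → s₄ z (s₃ z (s₂ z (s₁ z h)))) , _ , c₄ , λ t → mk⇔
        (λ h → let t∈ , nh = to ∈Compl h in t∈ , by-contradiction λ no →
          nh (from ∈Inter (from ∈Compl (t∈ , no ∘ inj₁) , from ∈Compl (t∈ , no ∘ inj₂))))
        (λ (t∈ , h) → from ∈Compl (t∈ , λ h′ → let h₁ , h₂ = to ∈Inter h′ in
          [ proj₂ (to ∈Compl h₁) , proj₂ (to ∈Compl h₂) ] h))

    diagonal : ∀ {A g n i} c → Nat n → Formed A g → i ∈ S n →
               ∃[ g′ ] Formed A g′ × g ⊆ g′ × ∃[ R ] Listed g′ (S n) R ×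
                 (∀ t → t ∈ R ⇔ (t ∈ Tup A (S n) × Rel c (t · i) (t · n)))
    diagonal equals   nn f i∈ = let g′ , f′ , s , l = formed-step f (S-nat nn) (inj₂ (inj₁ (_ , i∈ , _ , x∈Sx , refl)))
                                 in g′ , f′ , s , _ , l , λ t → ∈Diag≡
    diagonal contains nn f i∈ = let g′ , f′ , s , l = formed-step f (S-nat nn) (inj₁ (_ , i∈ , _ , x∈Sx , refl))
                                 in g′ , f′ , s , _ , l , λ t → ∈Diag∈
    diagonal belongs  nn f i∈ = let g′ , f′ , s , l = formed-step f (S-nat nn) (inj₁ (_ , x∈Sx , _ , i∈ , refl))
                                 in g′ , f′ , s , _ , l , λ t → ∈Diag∈

    -- The flag condition `B` concerns parameters only. It is decided outside the formula, and the
    -- disjunct is formed only when it holds, so flag sets never enter the definable relation.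
    optional : ∀ {A g n i U} (B : Set ℓ) c → Nat n → Formed A g → i ∈ S n → Listed g (S n) U →
               (∀ t → t ∈ U → t ∈ Tup A (S n)) →
               ∃[ g′ ] Formed A g′ × ∃[ R ] Listed g′ (S n) R ×
                 (∀ t → t ∈ R ⇔ (t ∈ U ⊎ (t ∈ Tup A (S n) × B × Rel c (t · i) (t · n))))
    optional B c nn f i∈ l sub with em {B}
    ... | no nb = _ , f , _ , l , λ t → mk⇔ inj₁ λ { (inj₁ h) → h ; (inj₂ (_ , b , _)) → contradiction b nb }
    ... | yes b =
      let g₁ , f₁ , s₁ , D , l₁ , h₁ = diagonal c nn f i∈
          g₂ , f₂ , s₂ , R , l₂ , h₂ = formed-union (S-nat nn) f₁ (Listed-mono s₁ l) l₁
      in g₂ , f₂ , R , l₂ , λ t → mk⇔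
        (λ h → case to (h₂ t) h of λ
          { (t∈ , inj₁ u) → inj₁ u ; (t∈ , inj₂ d) → inj₂ (t∈ , b , proj₂ (to (h₁ t) d)) })
        (λ { (inj₁ u) → from (h₂ t) (sub t u , inj₁ u)
           ; (inj₂ (t∈ , _ , r)) → from (h₂ t) (t∈ , inj₂ (from (h₁ t) (t∈ , r))) })

    clauses-step : ∀ {A n k} e → Nat n → k ∈ S n → DefinableRelation A (S n) (Clauses A n e k) →
                   DefinableRelation A (S n) (Clauses A n e (S k))
    clauses-step {A} {n} {k} e nn k∈ (g , f , l) =
      let g₁ , f₁ , R₁ , l₁ , h₁ = optional (k ∈ e equals) equals nn f k∈ l (λ t h → proj₁ (to ∈Clauses h))
          sub₁ : ∀ t → t ∈ R₁ → t ∈ Tup A (S n)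
          sub₁ = λ t h → [ (λ u → proj₁ (to ∈Clauses u)) , proj₁ ] (to (h₁ t) h)
          g₂ , f₂ , R₂ , l₂ , h₂ = optional (k ∈ e contains) contains nn f₁ k∈ l₁ sub₁
          sub₂ : ∀ t → t ∈ R₂ → t ∈ Tup A (S n)
          sub₂ = λ t h → [ sub₁ t , proj₁ ] (to (h₂ t) h)
          g₃ , f₃ , R₃ , l₃ , h₃ = optional (k ∈ e belongs) belongs nn f₂ k∈ l₂ sub₂
          R₃≡ : R₃ ≡ Clauses A n e (S k)
          R₃≡ = ext
            (λ t h → case to (h₃ t) h of λ
              { (inj₂ (t∈ , b , r)) → from ∈Clauses (t∈ , k , x∈Sx , belongs , b , r)
              ; (inj₁ h) → case to (h₂ t) h of λ
                { (inj₂ (t∈ , b , r)) → from ∈Clauses (t∈ , k , x∈Sx , contains , b , r)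
                ; (inj₁ h) → case to (h₁ t) h of λ
                  { (inj₂ (t∈ , b , r)) → from ∈Clauses (t∈ , k , x∈Sx , equals , b , r)
                  ; (inj₁ h) → let t∈ , i , i∈ , c = to ∈Clauses h in from ∈Clauses (t∈ , i , ∈adjoinˡ i∈ , c) } } })
            (λ t h → case to ∈Clauses h of λ (t∈ , i , i∈ , c) → case to ∈adjoin i∈ of λ
              { (inj₁ i∈k) → from (h₃ t) (inj₁ (from (h₂ t) (inj₁ (from (h₁ t) (inj₁ (from ∈Clauses (t∈ , i , i∈k , c)))))))
              ; (inj₂ refl) → case c of λ
                { (equals , b , r) → from (h₃ t) (inj₁ (from (h₂ t) (inj₁ (from (h₁ t) (inj₂ (t∈ , b , r))))))
                ; (contains , b , r) → from (h₃ t) (inj₁ (from (h₂ t) (inj₂ (t∈ , b , r))))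
                ; (belongs , b , r) → from (h₃ t) (inj₂ (t∈ , b , r)) } })
      in g₃ , f₃ , subst (Listed g₃ (S n)) R₃≡ l₃

    definableClausesᵒ : FO {6} (λ ρ → lookup ρ v0 ∈ S (lookup ρ v2) →
      DefinableRelation (lookup ρ v1) (S (lookup ρ v2)) (Clausesᶠ ⟨ ρ ⟩))
    definableClausesᵒ = resp-FO (λ { (k ∷ A ∷ n ∷ a ∷ b ∷ d ∷ []) → ⇔-id })
      (Δ₁⇒FO (var v0 ∈ᶠ Sᶠ (var v2)) ⇒ᵒ
       ∃ᵒ (ren-FO (pick (v2 ∷ v0 ∷ [])) formedᵒ ∧ᵒ Δ₁⇒FO (listed-Δ (var v0) (Sᶠ (var v3)) (wk Clausesᶠ))))

  -- As `n` may be nonstandard, the disjunction cannot be assembled by external recursion. Induction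
  -- inside 𝓜 over `k` up to `n` adds the clauses of one coordinate at a time.
  clauses-definable : ∀ {A n} e → Nat n → DefinableRelation A (S n) (Clauses A n e n)
  clauses-definable {A} {n} e nn = subst (DefinableRelation A (S n)) Clauses-flagged
    (nat-induction definableClausesᵒ (A ∷ n ∷ e equals ∷ e contains ∷ e belongs ∷ [])
      -- The empty disjunction is realised by `t(n) ∈ t(n)`, which no tuple satisfies.
      (λ _ → let g , f , s , l = formed-step formed-∅ (S-nat nn) (inj₁ (n , x∈Sx , n , x∈Sx , refl)) in
         g , f , subst (Listed g (S n)) (ext
           (λ t h → contradiction (proj₂ (to ∈Diag∈ h)) ∈-irrefl)
           (λ t h → contradiction (proj₁ (proj₂ (proj₂ (to ∈Clauses h)))) ∉∅)) l)
      (λ k nk ih Sk∈ → clauses-step _ nn (∈adjoinˡ (k∈n Sk∈)) (ih (∈adjoinˡ (k∈n Sk∈))))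
      n nn x∈Sx)
    where
    k∈n : ∀ {k} → S k ∈ S n → k ∈ n
    k∈n h with to ∈adjoin h
    ... | inj₁ h′ = nat-⊆ nn h′ _ x∈Sx
    ... | inj₂ refl = x∈Sx

  clauses-subset : ∀ {A n s z} e → Nat n → s ∈ Tup A n →
    (∀ x → x ∈ z ⇔ (x ∈ A × ∃[ i ] i ∈ n × Clause e i (s · i) x)) → DefinableSubset A z
  clauses-subset {A} {n} {s} {z} e nn s∈ hz = n , s , _ , nn , s∈ , clauses-definable e nn , λ x →
    mk⇔ (λ h → let x∈ , c = to (hz x) h in x∈ , ⇒ x∈ c) (λ (x∈ , h) → from (hz x) (x∈ , ⇐ h))
    where
    f : Fn s n
    f = proj₁ (to (∈Tup nn) s∈)
    ⇒ : ∀ {x} → x ∈ A → ∃[ i ] i ∈ n × Clause e i (s · i) x →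
        ∃[ t ] t ∈ Clauses A n e n × s ⊆ t × ⟪ n , x ⟫ ∈ t
    ⇒ {x} x∈ (i , i∈ , c) = adjoin s ⟪ n , x ⟫ ,
      from ∈Clauses (from (∈Tup (S-nat nn)) (append-Fn f , λ j j∈ → case to ∈adjoin j∈ of λ
        { (inj₁ j∈n) → subst (_∈ A) (sym (append-· f j∈n)) (Tup-· nn s∈ j∈n)
        ; (inj₂ refl) → subst (_∈ A) (sym (append-last f)) x∈ }) ,
        i , i∈ , subst₂ (Clause e i) (sym (append-· f i∈)) (sym (append-last f)) c) ,
      (λ z → ∈adjoinˡ) , ∈adjoinʳ
    ⇐ : ∀ {x} → ∃[ t ] t ∈ Clauses A n e n × s ⊆ t × ⟪ n , x ⟫ ∈ t →
        ∃[ i ] i ∈ n × Clause e i (s · i) x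
    ⇐ (t , t∈ , s⊆t , x∈) with to ∈Clauses t∈
    ... | t∈Tup , i , i∈ , c = i , i∈ ,
          subst₂ (Clause e i) (sym (value≡ g (s⊆t _ (f .value∈ i i∈)))) (sym (value≡ g x∈)) c
      where
      g : Fn t (S n)
      g = proj₁ (to (∈Tup (S-nat nn)) t∈Tup)

  private
    same? : (c d : Kind) → (c ≡ d) ⊎ (c ≢ d)
    same? equals   equals   = inj₁ refl
    same? contains contains = inj₁ refl
    same? belongs  belongs  = inj₁ refl
    same? equals   contains = inj₂ λ ()
    same? equals   belongs  = inj₂ λ ()
    same? contains equals   = inj₂ λ ()
    same? contains belongs  = inj₂ λ ()
    same? belongs  equals   = inj₂ λ ()
    same? belongs  contains = inj₂ λ ()

    -- The passage from an external list of parameters to one internal tuple: coordinates carry the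
    -- parameters, flag sets their kinds.
    record Coding (A : M) (xs : List (Kind × M)) : Set ℓ where
      field
        {length} : M
        {tuple}  : M
        flag     : Kind → M
        nat      : Nat length
        tuple∈   : tuple ∈ Tup A length
        flag⊆    : ∀ c → flag c ⊆ length
        clauses  : ∀ x → (∃[ i ] i ∈ length × Clause flag i (tuple · i) x) ⇔ Any (λ (c , a) → Rel c a x) xs

    coding : ∀ {A} xs → All (λ (c , a) → a ∈ A) xs → Coding A xs
    coding [] [] = record
      { flag = λ _ → ∅ ; nat = ∅-nat ; tuple∈ = from (∈Tup ∅-nat) (∅-Fn , λ i i∈ → contradiction i∈ ∉∅)
      ; flag⊆ = λ _ z h → h ; clauses = λ x → mk⇔ (λ (i , i∈ , _) → contradiction i∈ ∉∅) λ () }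
    coding {A} ((d , a) ∷ xs) (a∈ ∷ as) = record
      { flag = flag′ ; nat = S-nat nat
      ; tuple∈ = from (∈Tup (S-nat nat)) (append-Fn f , λ i i∈ → case to ∈adjoin i∈ of λ
          { (inj₁ i∈n) → subst (_∈ A) (sym (append-· f i∈n)) (Tup-· nat tuple∈ i∈n)
          ; (inj₂ refl) → subst (_∈ A) (sym (append-last f)) a∈ })
      ; flag⊆ = flag⊆′
      ; clauses = λ x → mk⇔
          (λ (i , i∈ , c , i∈c , r) → case to ∈adjoin i∈ of λ
            { (inj₁ i∈n) → there (to (clauses x) (i , i∈n , c , old {c = c} i∈n i∈c , subst (λ z → Rel c z x) (append-· f i∈n) r))
            ; (inj₂ refl) → case new {c} i∈c of λ { refl → here (subst (λ z → Rel c z x) (append-last f) r) } })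
          (λ { (here r) → length , x∈Sx , d , d-flagged , subst (λ z → Rel d z x) (sym (append-last f)) r
             ; (there h) → let i , i∈ , c , i∈c , r = from (clauses x) h in
                 i , ∈adjoinˡ i∈ , c , keep {c = c} i∈c , subst (λ z → Rel c z x) (sym (append-· f i∈)) r }) }
      where
      open Coding (coding xs as)
      f : Fn tuple length
      f = proj₁ (to (∈Tup nat) tuple∈)
      flag′ : Kind → M
      flag′ c = [ (λ _ → adjoin (flag c) length) , (λ _ → flag c) ] (same? c d)
      flag⊆′ : ∀ c → flag′ c ⊆ S length
      flag⊆′ c z h with same? c d
      ... | inj₂ _ = ∈adjoinˡ (flag⊆ c z h)
      ... | inj₁ _ with to ∈adjoin h
      ...   | inj₁ h′ = ∈adjoinˡ (flag⊆ c z h′)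
      ...   | inj₂ refl = x∈Sx
      old : ∀ {i c} → i ∈ length → i ∈ flag′ c → i ∈ flag c
      old {i} {c} i∈ h with same? c d
      ... | inj₂ _ = h
      ... | inj₁ _ with to ∈adjoin h
      ...   | inj₁ h′ = h′
      ...   | inj₂ refl = contradiction i∈ ∈-irrefl
      new : ∀ {c} → length ∈ flag′ c → c ≡ d
      new {c} h with same? c d
      ... | inj₁ e = e
      ... | inj₂ _ = contradiction (flag⊆ c _ h) ∈-irrefl
      d-flagged : length ∈ flag′ d
      d-flagged with same? d d
      ... | inj₁ _ = ∈adjoinʳ
      ... | inj₂ ne = contradiction refl ne
      keep : ∀ {i c} → i ∈ flag c → i ∈ flag′ c
      keep {i} {c} h with same? c d
      ... | inj₁ _ = ∈adjoinˡ h
      ... | inj₂ _ = h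

  list-definable : ∀ {A z} xs → All (λ (c , a) → a ∈ A) xs →
    (∀ x → x ∈ z ⇔ (x ∈ A × Any (λ (c , a) → Rel c a x) xs)) → DefinableSubset A z
  list-definable xs as hz = clauses-subset flag nat tuple∈ λ x → ⇔-trans (hz x) (⇔-id ×-⇔ ⇔-sym (clauses x))
    where open Coding (coding xs as)

  private
    clauses-set : ∀ A n s e → ∃[ z ] ∀ x → x ∈ z ⇔ (x ∈ A × ∃[ i ] i ∈ n × Clause e i (s · i) x)
    clauses-set A n s e = let z , hz = Δ₁-separation
                                (∃∈ᶠ (var v1) (clause-Δ (flags v4 v5 v6) (var v0) (var v3 ·ᶠ var v0) (var v1)))
                                (n ∷ s ∷ e equals ∷ e contains ∷ e belongs ∷ []) A
      in z , λ x → ⇔-trans (hz x) (⇔-id ×-⇔ ∃-⇔ λ i → ⇔-id ×-⇔ mk⇔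
        (λ { (equals , h) → equals , h ; (contains , h) → contains , h ; (belongs , h) → belongs , h })
        (λ { (equals , h) → equals , h ; (contains , h) → contains , h ; (belongs , h) → belongs , h }))

  -- Existence comes from Δ₁-separation alone, before any `Def` is available; `list-definable` later
  -- places the set one level above `A`.
  list-set : ∀ {A} xs → All (λ (c , a) → a ∈ A) xs →
    ∃[ z ] ∀ x → x ∈ z ⇔ (x ∈ A × Any (λ (c , a) → Rel c a x) xs)
  list-set {A} xs as = let z , hz = clauses-set A length tuple flag in
    z , λ x → ⇔-trans (hz x) (⇔-id ×-⇔ clauses x)
    where open Coding (coding xs as)

-- The definable power set in the presence of ω.

module DefinablePowerSet
  {ℓ : Level} (em : ExcludedMiddle ℓ) (𝓜 : Structure ℓ) (kp : IsKPModel 𝓜) where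
  open DefinableSubsets em 𝓜 kp public
  open Structure 𝓜 renaming (Carrier to M)
  open Fun

  module Infinite (ω : M) (∈ω : ∀ {n} → n ∈ ω ⇔ Nat n) where
    private
      -- The graph of a `Fun` has no hidden parameters, so even a constant must be characterised: a
      -- set of natural numbers that contains ∅ and is closed under `S`.
      ωᶠ : Fun n
      ωᶠ ⟨ _ ⟩ = ω
      ωᶠ .graph = graph-of (λ _ → ω)
        (∀∈ᶠ (var v0) (nat-Δ (var v0)) ∧ᶠ ∅ᶠ ∈ᶠ var v0 ∧ᶠ ∀∈ᶠ (var v0) (Sᶠ (var v0) ∈ᶠ var v1))
        λ y ρ → mk⇔
          (λ (h , b , s) → ext (λ n n∈ → from ∈ω (h n n∈)) (λ n n∈ →
            nat-induction {P = λ { (n ∷ y ∷ []) → n ∈ y }}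
              (Δ₁⇒FO (var v0 ∈ᶠ var v1 via λ { (n ∷ y ∷ []) → ⇔-id })) (y ∷ []) b (λ k _ → s k) n (to ∈ω n∈)))
          (λ { refl → (λ n → to ∈ω) , from ∈ω ∅-nat , λ n n∈ → from ∈ω (S-nat (to ∈ω n∈)) })

      -- The set of all possible next entries after the partial sequence `g`. The five parts follow
      -- the alternatives of `Step`, with `entries g` bounding the relations already listed.
      legitF : Fun 3
      legitF = bigᶠ (diags Diag∈ᶠ ∪ᶠ diags Diag≡ᶠ ∪ᶠ
          setOf ⟪ var v1 , comp Complᶠ (var v4 ∷ var v1 ∷ var v0 ∷ []) ⟫ᶠ (entriesᶠ (var v1))
            (listed-Δ (var v2) (var v1) (var v0)) ∪ᶠ
          bigᶠ (setOf ⟪ var v2 , comp Interᶠ (var v1 ∷ var v0 ∷ []) ⟫ᶠ (entriesᶠ (var v2))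
                  (listed-Δ (var v3) (var v2) (var v0)))
            (entriesᶠ (var v1)) (listed-Δ (var v2) (var v1) (var v0)) ∪ᶠ
          setOf ⟪ var v1 , comp Projᶠ (var v4 ∷ var v1 ∷ var v0 ∷ []) ⟫ᶠ (entriesᶠ (var v1))
            (listed-Δ (var v2) (Sᶠ (var v1)) (var v0)))
        ωᶠ ⊤ᶠ
        where
        diags : Fun 4 → Fun 4
        diags d = bigᶠ (setOf ⟪ var v2 , comp d (var v5 ∷ var v2 ∷ var v1 ∷ var v0 ∷ []) ⟫ᶠ (var v1) ⊤ᶠ) (var v0) ⊤ᶠ

      ∈legit : ∀ {g i A e} → e ∈ legitF ⟨ g ∷ i ∷ A ∷ [] ⟩ ⇔
               (∃[ n ] ∃[ R ] Nat n × e ≡ ⟪ n , R ⟫ × Step A g n R)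
      ∈legit {g} {i} {A} {e} = mk⇔
        (λ h → case to ∈Big h of λ (n , n∈ , _ , h) → case to ∈∪ h of λ
          { (inj₂ h) → case to ∈Build h of λ (R , _ , l , e≡) →
              n , _ , to ∈ω n∈ , e≡ , inj₂ (inj₂ (inj₂ (inj₂ (R , l , refl))))
          ; (inj₁ h) → case to ∈∪ h of λ
            { (inj₂ h) → case to ∈Big h of λ (R , _ , l , h) → case to ∈Build h of λ (R′ , _ , l′ , e≡) →
                n , _ , to ∈ω n∈ , e≡ , inj₂ (inj₂ (inj₂ (inj₁ (R , l , R′ , l′ , refl))))
            ; (inj₁ h) → case to ∈∪ h of λ
              { (inj₂ h) → case to ∈Build h of λ (R , _ , l , e≡) →
                  n , _ , to ∈ω n∈ , e≡ , inj₂ (inj₂ (inj₁ (R , l , refl)))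
              ; (inj₁ h) → case to ∈∪ h of λ
                { (inj₂ h) → case to ∈Big h of λ (j , j∈ , _ , h) → case to ∈Build h of λ (k , k∈ , _ , e≡) →
                    n , _ , to ∈ω n∈ , e≡ , inj₂ (inj₁ (j , j∈ , k , k∈ , refl))
                ; (inj₁ h) → case to ∈Big h of λ (j , j∈ , _ , h) → case to ∈Build h of λ (k , k∈ , _ , e≡) →
                    n , _ , to ∈ω n∈ , e≡ , inj₁ (j , j∈ , k , k∈ , refl) } } } })
        (λ { (n , R , nn , e≡ , s) → from ∈Big (n , from ∈ω nn , tt , entry e≡ s) })
        where
        entry : ∀ {n R} → e ≡ ⟪ n , R ⟫ → Step A g n R → _
        entry refl (inj₁ (j , j∈ , k , k∈ , refl)) =
          from ∈∪ (inj₁ (from ∈∪ (inj₁ (from ∈∪ (inj₁ (from ∈∪ (inj₁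
            (from ∈Big (j , j∈ , tt , from ∈Build (k , k∈ , tt , refl))))))))))
        entry refl (inj₂ (inj₁ (j , j∈ , k , k∈ , refl))) =
          from ∈∪ (inj₁ (from ∈∪ (inj₁ (from ∈∪ (inj₁ (from ∈∪ (inj₂
            (from ∈Big (j , j∈ , tt , from ∈Build (k , k∈ , tt , refl))))))))))
        entry refl (inj₂ (inj₂ (inj₁ (R₁ , l , refl)))) =
          from ∈∪ (inj₁ (from ∈∪ (inj₁ (from ∈∪ (inj₂ (from ∈Build (R₁ , ∈entries l , l , refl)))))))
        entry refl (inj₂ (inj₂ (inj₂ (inj₁ (R₁ , l₁ , R₂ , l₂ , refl))))) =
          from ∈∪ (inj₁ (from ∈∪ (inj₂ (from ∈Big (R₁ , ∈entries l₁ , l₁ ,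
            from ∈Build (R₂ , ∈entries l₂ , l₂ , refl))))))
        entry refl (inj₂ (inj₂ (inj₂ (inj₂ (R₁ , l , refl))))) =
          from ∈∪ (inj₂ (from ∈Build (R₁ , ∈entries l , l , refl)))

      module Formations = Sequences {1} legitF

    abstract
      private
        FSeq : M → M → M
        FSeq A l = Formations.Seq ⟨ l ∷ A ∷ [] ⟩

        FSeq-def : ∀ ρ → Formations.Seq ⟨ ρ ⟩ ≡ FSeq (lookup ρ v1) (lookup ρ v0)
        FSeq-def (l ∷ A ∷ []) = refl

        ∈FSeq : ∀ {A l g} → Nat l → g ∈ FSeq A l ⇔ Formation A l g
        ∈FSeq nl = ⇔-trans (Formations.∈Seq nl _) (mk⇔
          (λ (f , h) → nl , f , λ i i∈ → to ∈legit (h i i∈))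
          (λ (_ , f , h) → f , λ i i∈ → from ∈legit (h i i∈)))

    private
      FSeqᶠ : Fun 2
      FSeqᶠ = seal Formations.Seq _ FSeq-def

      -- From the outside in, the ranges are a length, a formation sequence of that length, an arity
      -- `n`, a listed relation of arity `S n` and a tuple of `n` parameters. Each range is a set
      -- because ω is one.
      defF : Fun 1
      defF = bigᶠ (bigᶠ (bigᶠ (bigᶠ
          (setOf (sepᶠ (var v5) (∃∈ᶠ (var v2) (⊆-Δ (var v2) (var v0) ∧ᶠ ⟪ var v4 , var v1 ⟫ᶠ ∈ᶠ var v0)))
             (Tupᶠ (var v4) (var v1)) ⊤ᶠ)
          (entriesᶠ (var v1)) (listed-Δ (var v2) (Sᶠ (var v1)) (var v0)))
        ωᶠ ⊤ᶠ) (comp FSeqᶠ (var v0 ∷ var v1 ∷ [])) ⊤ᶠ) ωᶠ ⊤ᶠ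

    abstract
      Def : M → M
      Def A = defF ⟨ A ∷ [] ⟩

      private
        Def-def : ∀ ρ → defF ⟨ ρ ⟩ ≡ Def (lookup ρ v0)
        Def-def (A ∷ []) = refl

      ∈Def : ∀ {A z} → z ∈ Def A ⇔ DefinableSubset A z
      ∈Def {A} {z} = mk⇔
        (λ h → case to ∈Big h of λ (l , l∈ , _ , h) → case to ∈Big h of λ (g , g∈ , _ , h) →
          case to ∈Big h of λ (n , n∈ , _ , h) → case to ∈Big h of λ (R , _ , lst , h) →
          case to ∈Build h of λ (s , s∈ , _ , z≡) →
            n , s , R , to ∈ω n∈ , s∈ , (g , (l , to (∈FSeq (to ∈ω l∈)) g∈) , lst) , from (ext-⇔ ∈Sep) z≡)
        (λ { (n , s , R , nn , s∈ , (g , (l , fm) , lst) , sec) → from ∈Big (l , from ∈ω (proj₁ fm) , tt ,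
          from ∈Big (g , from (∈FSeq (proj₁ fm)) fm , tt , from ∈Big (n , from ∈ω nn , tt ,
          from ∈Big (R , ∈entries lst , lst , from ∈Build (s , s∈ , tt , to (ext-⇔ ∈Sep) sec))))) })

    Defᶠ : Fun 1
    Defᶠ = seal defF _ Def-def

-- Ranks above a base ordinal and the levels of L.

module ConstructibleHierarchy
  {ℓ : Level} (em : ExcludedMiddle ℓ) (𝓜 : Structure ℓ) (kp : IsKPModel 𝓜) where
  open DefinableSubsets em 𝓜 kp public
  open Structure 𝓜 renaming (Carrier to M)
  open Fun

  private
    -- One successor would only give `rank κ y ∈ rank κ x` for `y ∈ x`. The image of `y` first
    -- appears in the level after its rank, and `L-mono` must carry it into the level of `x`; hence
    -- two. The base κ is ω when levels must contain all markers, and ∅ when ranks are to be natural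
    -- numbers.
    rankBody : Fun 3
    rankBody = var v2 ∪ᶠ bigᶠ (Sᶠ (Sᶠ (var v1 ·ᶠ var v0))) (var v1) ⊤ᶠ

    module Rank = Recursion {1} rankBody

  abstract
    rank : M → M → M
    rank κ x = Rank.rec ⟨ x ∷ κ ∷ [] ⟩

    private
      rank-def : ∀ ρ → Rank.rec ⟨ ρ ⟩ ≡ rank (lookup ρ v1) (lookup ρ v0)
      rank-def (x ∷ κ ∷ []) = refl

    ∈rank : ∀ {κ x z} → z ∈ rank κ x ⇔ (z ∈ κ ⊎ ∃[ y ] y ∈ x × z ∈ S (S (rank κ y)))
    ∈rank {κ} {x} {z} = mk⇔
      (λ h → case to ∈∪ (subst (z ∈_) (Rank.rec-eq x _) h) of λ
        { (inj₁ z∈) → inj₁ z∈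
        ; (inj₂ h) → inj₂ (case to ∈Big h of λ (y , y∈ , _ , z∈) →
            y , y∈ , subst (λ u → z ∈ S (S u)) (Rank.history-· y∈) z∈) })
      (λ h → subst (z ∈_) (sym (Rank.rec-eq x _)) (case h of λ
        { (inj₁ z∈) → from ∈∪ (inj₁ z∈)
        ; (inj₂ (y , y∈ , z∈)) → from ∈∪ (inj₂ (from ∈Big
            (y , y∈ , tt , subst (λ u → z ∈ S (S u)) (sym (Rank.history-· y∈)) z∈))) }))

  rankᶠ : Fun 2
  rankᶠ = seal Rank.rec _ rank-def

  rank-∈ : ∀ {κ x y} → y ∈ x → rank κ y ∈ rank κ x
  rank-∈ y∈ = from ∈rank (inj₂ (_ , y∈ , ∈adjoinˡ x∈Sx))

  S-rank-∈ : ∀ {κ x y} → y ∈ x → S (rank κ y) ∈ rank κ x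
  S-rank-∈ y∈ = from ∈rank (inj₂ (_ , y∈ , x∈Sx))

  base⊆rank : ∀ {κ x} → κ ⊆ rank κ x
  base⊆rank z z∈ = from ∈rank (inj₁ z∈)

  rank-ordinal : ∀ {κ} → Ordinal κ → ∀ x → Ordinal (rank κ x)
  rank-ordinal {κ} oκ = ∈-induction {P = λ { (x ∷ κ ∷ []) → Ordinal (rank κ x) }}
    (resp-FO (λ { (x ∷ κ ∷ []) → ⇔-id }) (Δ₁⇒FO (ordinal-Δ rankᶠ))) (κ ∷ [])
    λ x ih →
      (λ y y∈ z z∈ → case to ∈rank y∈ of λ
        { (inj₁ y∈κ) → from ∈rank (inj₁ (proj₁ oκ y y∈κ z z∈))
        ; (inj₂ (u , u∈ , y∈S)) → from ∈rank (inj₂ (u , u∈ , proj₁ (S-ordinal (S-ordinal (ih u u∈))) y y∈S z z∈)) }) ,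
      (λ y y∈ → case to ∈rank y∈ of λ
        { (inj₁ y∈κ) → proj₂ oκ y y∈κ
        ; (inj₂ (u , u∈ , y∈S)) → proj₂ (S-ordinal (S-ordinal (ih u u∈))) y y∈S })

  -- `Def` is a parameter because the two kinds of model provide its Σ₁ graph differently: by
  -- formation sequences over ω, or as the full power set.
  module Hierarchy (Defᶠ : Fun 1) (∈Def : ∀ {A z} → z ∈ Defᶠ ⟨ A ∷ [] ⟩ ⇔ DefinableSubset A z) where
    private
      Def : M → M
      Def A = Defᶠ ⟨ A ∷ [] ⟩

      body : Fun 2
      body = bigᶠ (comp Defᶠ (var v1 ·ᶠ var v0 ∷ [])) (var v1) (var v2 ≡ᶠ Sᶠ (var v0)) ∪ᶠ
             -- Every non-successor is treated as a limit; at ∅ this is the empty union, the correct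
             -- value of L₀.
             bigᶠ (var v1 ·ᶠ var v0) (var v1) (¬ᶠ (∃∈ᶠ (var v2) (var v3 ≡ᶠ Sᶠ (var v0))))

      module Levels = Recursion {0} body

    abstract
      L : M → M
      L x = Levels.rec ⟨ x ∷ [] ⟩

      private
        L-def : ∀ ρ → Levels.rec ⟨ ρ ⟩ ≡ L (lookup ρ v0)
        L-def (x ∷ []) = refl

      L-S : ∀ {γ} → L (S γ) ≡ Def (L γ)
      L-S {γ} = trans (Levels.rec-eq (S γ) []) (ext
        (λ z h → case to ∈∪ h of λ
          { (inj₁ h) → case to ∈Big h of λ (δ , δ∈ , e , z∈) → case S-injective e of λ
              { refl → subst (λ u → z ∈ Def u) (Levels.history-· x∈Sx) z∈ }
          ; (inj₂ h) → case to ∈Big h of λ (_ , _ , ns , _) → contradiction (γ , x∈Sx , refl) ns })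
        (λ z z∈ → from ∈∪ (inj₁ (from ∈Big
          (γ , x∈Sx , refl , subst (λ u → z ∈ Def u) (sym (Levels.history-· x∈Sx)) z∈)))))

      L-limit : ∀ {β} → ¬ (∃[ γ ] β ≡ S γ) → ∀ {z} → z ∈ L β ⇔ (∃[ γ ] γ ∈ β × z ∈ L γ)
      L-limit {β} ns {z} = mk⇔
        (λ h → case to ∈∪ (subst (z ∈_) (Levels.rec-eq β []) h) of λ
          { (inj₁ h) → case to ∈Big h of λ (γ , _ , e , _) → contradiction (γ , e) ns
          ; (inj₂ h) → case to ∈Big h of λ (γ , γ∈ , _ , z∈) → γ , γ∈ , subst (z ∈_) (Levels.history-· γ∈) z∈ })
        (λ (γ , γ∈ , z∈) → subst (z ∈_) (sym (Levels.rec-eq β [])) (from ∈∪ (inj₂ (from ∈Big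
          (γ , γ∈ , (λ (δ , _ , e) → ns (δ , e)) , subst (z ∈_) (sym (Levels.history-· γ∈)) z∈)))))

    Lᶠ : Fun 1
    Lᶠ = seal Levels.rec _ L-def

    Def-⊆ : ∀ {A z} → z ∈ Def A → z ⊆ A
    Def-⊆ z∈ x x∈ with to ∈Def z∈
    ... | _ , _ , _ , _ , _ , _ , sec = proj₁ (to (sec x) x∈)

    -- By transitivity an element `x` of `A` equals {y ∈ A : y ∈ x}, a single `belongs` clause.
    ⊆-Def : ∀ {A} → Transitive A → A ⊆ Def A
    ⊆-Def t x x∈ = from ∈Def (list-definable ((belongs , x) ∷ []) (x∈ ∷ []) λ y → mk⇔
      (λ y∈ → t x x∈ y y∈ , here y∈) (λ { (_ , here y∈) → y∈ }))

    private
      Good : M → Set ℓ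
      Good α = Transitive (L α) × (∀ β → β ∈ α → L β ⊆ L α)

      -- Transitivity and monotonicity share one induction, since at a successor the inclusion
      -- `L γ ⊆ Def (L γ)` rests on transitivity of `L γ`.
      good : ∀ α → Good α
      good = ∈-induction {P = λ { (α ∷ []) → Good α }}
        (resp-FO (λ { (α ∷ []) → ⇔-id }) (Δ₁⇒FO (transitive-Δ Lᶠ ∧ᶠ
          ∀∈ᶠ (var v0) (⊆-Δ (comp Lᶠ (var v0 ∷ [])) (comp Lᶠ (var v1 ∷ [])))))) []
        λ α ih → step α ih
        where
        step : ∀ α → (∀ β → β ∈ α → Good β) → Good α
        step α ih with em {∃[ γ ] α ≡ S γ}
        ... | no ns =
          (λ y y∈ z z∈ → let γ , γ∈ , y∈L = to (L-limit ns) y∈ in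
             from (L-limit ns) (γ , γ∈ , proj₁ (ih γ γ∈) y y∈L z z∈)) ,
          (λ β β∈ z z∈ → from (L-limit ns) (β , β∈ , z∈))
        ... | yes (γ , refl) = subst (λ u → Transitive u × (∀ β → β ∈ S γ → L β ⊆ u)) (sym L-S)
          ((λ y y∈ z z∈ → up z (Def-⊆ y∈ z z∈)) ,
           (λ β β∈ z z∈ → case to ∈adjoin β∈ of λ
              { (inj₁ β∈γ) → up z (proj₂ (ih γ x∈Sx) β β∈γ z z∈) ; (inj₂ refl) → up z z∈ }))
          where
          up : L γ ⊆ Def (L γ)
          up = ⊆-Def (proj₁ (ih γ x∈Sx))

    L-mono : ∀ {α β} → β ∈ α → L β ⊆ L α
    L-mono β∈ = proj₂ (good _) _ β∈

    private
      levels : M → M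
      levels α = setOf ⟪ var v0 , comp Lᶠ (var v0 ∷ []) ⟫ᶠ (Sᶠ (var v0)) ⊤ᶠ ⟨ α ∷ [] ⟩

      ∈levels : ∀ {α β y} → ⟪ β , y ⟫ ∈ levels α ⇔ (β ∈ S α × y ≡ L β)
      ∈levels = mk⇔
        (λ h → case to ∈Build h of λ (γ , γ∈ , _ , e) → case ⟪⟫-injective e of λ { (refl , e′) → γ∈ , e′ })
        (λ { (β∈ , refl) → from ∈Build (_ , β∈ , tt , refl) })

      isLHierarchy : ∀ {α} → Ordinal α → IsLHierarchy 𝓜 α (levels α)
      isLHierarchy {α} oα =
        (S α , from isSuc refl , from isFunction (mkFn
          (λ p p∈ → case to ∈Build p∈ of λ (β , β∈ , _ , e) → β , _ , β∈ , e)
          (λ β β∈ → L β , from ∈levels (β∈ , refl) , λ y h → proj₂ (to ∈levels h)))) ,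
        λ β y m → case to ∈levels (to maps m) of λ { (β∈ , refl) → zero-case β , S-case β , limit-case β β∈ }
        where
        zero-case : ∀ β → IsEmpty 𝓜 β → IsEmpty 𝓜 (L β)
        zero-case β e z z∈ = let γ , γ∈ , _ = to (L-limit (λ (γ , e′) → e γ (subst (γ ∈_) (sym e′) x∈Sx))) z∈ in e γ γ∈
        S-case : ∀ β γ w → IsSuc 𝓜 β γ → Maps 𝓜 (levels α) γ w → IsDef 𝓜 (L β) w
        S-case β γ w s m z with to isSuc s | to ∈levels (to maps m)
        ... | refl | _ , refl = subst (λ u → z ∈ u ⇔ IsDefinableSubset 𝓜 (L γ) z) (sym L-S)
                                  (⇔-trans ∈Def (⇔-sym isDefinableSubset))
        limit-case : ∀ β → β ∈ S α → IsLimit 𝓜 β → ∀ z →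
                     z ∈ L β ⇔ (∃[ γ ] ∃[ w ] γ ∈ β × Maps 𝓜 (levels α) γ w × z ∈ w)
        limit-case β β∈ (_ , _ , ns) z = ⇔-trans (L-limit (λ (γ , e) → ns (γ , from isSuc e))) (mk⇔
          (λ (γ , γ∈ , z∈) → γ , L γ , γ∈ ,
             from maps (from ∈levels (proj₁ (S-ordinal oα) β β∈ γ γ∈ , refl)) , z∈)
          (λ (γ , w , γ∈ , m , z∈) → γ , γ∈ , subst (z ∈_) (proj₂ (to ∈levels (to maps m))) z∈))

    constructible : ∀ {α x} → Ordinal α → x ∈ L α → IsConstructible 𝓜 x
    constructible {α} oα x∈ = α , L α ,
      (oα , levels α , isLHierarchy oα , from maps (from ∈levels (x∈Sx , refl))) , x∈

-- Models without an inductive set.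

module WithoutInfinity
  {ℓ : Level} (em : ExcludedMiddle ℓ) (𝓜 : Structure ℓ) (kp : IsKPModel 𝓜) where
  open ConstructibleHierarchy em 𝓜 kp public
  open Structure 𝓜 renaming (Carrier to M)
  open Renaming
  open Fun
  private variable
    P Q : Env n → Set ℓ

  Inductive : M → Set ℓ
  Inductive w = ∅ ∈ w × (∀ n → n ∈ w → S n ∈ w)

  EmbedsInto𝐋 : Set ℓ
  EmbedsInto𝐋 = ∃[ j ] IsEmbeddingInto 𝓜 (IsConstructible 𝓜) j

  module Finite (no-inductive : ¬ (∃[ w ] Inductive w)) where
    private
      -- The least ordinal that is not a natural number would be inductive.
      ordinal⇒nat : ∀ α → Ordinal α → Nat α
      ordinal⇒nat = ∈-induction {P = λ { (α ∷ []) → Ordinal α → Nat α }}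
        (resp-FO (λ { (α ∷ []) → ⇔-id }) (Δ₁⇒FO (ordinal-Δ (var v0) ⇒ᶠ nat-Δ (var v0)))) []
        λ α ih oα →
          let nats : ∀ n → n ∈ α → Nat n
              nats n n∈ = ih n n∈ (∈-ordinal oα n∈)
              by-top : IsEmpty 𝓜 α ⊎ (∃[ k ] IsSuc 𝓜 α k) → Nat α
              by-top top = oα , λ { m (inj₁ m∈) → proj₂ (nats m m∈) m (inj₂ refl) ; m (inj₂ refl) → top }
          in by-contradiction λ nn → no-inductive (α ,
            (case trichotomy ∅-ordinal oα of λ
              { (inj₁ h) → h
              ; (inj₂ (inj₁ e)) → contradiction (by-top (inj₁ (from isEmpty (sym e)))) nn
              ; (inj₂ (inj₂ h)) → contradiction h ∉∅ }) ,
            λ n n∈ → case trichotomy (S-ordinal (∈-ordinal oα n∈)) oα of λ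
              { (inj₁ h) → h
              ; (inj₂ (inj₁ e)) → contradiction (by-top (inj₂ (n , from isSuc (sym e)))) nn
              ; (inj₂ (inj₂ h)) → case to ∈adjoin h of λ
                { (inj₁ α∈n) → contradiction n∈ (∈-asym α∈n) ; (inj₂ refl) → contradiction n∈ ∈-irrefl } })

      -- Repetitions are allowed, so adjoining an element just lengthens the sequence, whether or
      -- not the element was already present.
      Enumerates : M → M → M → Set ℓ
      Enumerates s n x = Fn s n × (∀ i → i ∈ n → s · i ∈ x) × (∀ y → y ∈ x → ∃[ i ] i ∈ n × y ≡ s · i)

      enumerates-Δ : (f g h : Fun n) → Δ₁ (λ ρ → Enumerates (f ⟨ ρ ⟩) (g ⟨ ρ ⟩) (h ⟨ ρ ⟩))
      enumerates-Δ f g h = fn-Δ f g ∧ᶠ ∀∈ᶠ g (wk f ·ᶠ var v0 ∈ᶠ wk h) ∧ᶠ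
        ∀∈ᶠ h (∃∈ᶠ (wk g) (var v1 ≡ᶠ wk (wk f) ·ᶠ var v0)) via λ ρ → ⇔-id

      IsFinite : M → Set ℓ
      IsFinite x = ∃[ n ] ∃[ s ] Nat n × Enumerates s n x

      finᵒ : (f : Fun n) → FO (λ ρ → IsFinite (f ⟨ ρ ⟩))
      finᵒ f = ∃ᵒ ∃ᵒ Δ₁⇒FO (nat-Δ (var v1) ∧ᶠ enumerates-Δ (var v0) (var v1) (wk (wk f)))

      imageF : Fun 2
      imageF = setOf (var v1 ·ᶠ var v0) (var v1) ⊤ᶠ

      fin-induction : FO P → ∀ ρ → P (∅ ∷ ρ) → (∀ x y → P (x ∷ ρ) → P (adjoin x y ∷ ρ)) → ∀ x → IsFinite x → P (x ∷ ρ)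
      fin-induction {P = P} p ρ base step x (n , s , nn , e) =
        nat-induction {P = λ { (n ∷ ρ) → ∀ s x → Enumerates s n x → P (x ∷ ρ) }}
          (resp-FO (λ { (n ∷ ρ) → ⇔-id })
            (∀ᵒ ∀ᵒ (Δ₁⇒FO (enumerates-Δ (var v1) (var v2) (var v0)) ⇒ᵒ ren-FO (lift (drops 2)) p))) ρ
          (λ s x (_ , _ , onto) → subst (λ z → P (z ∷ ρ)) (sym (ext
            (λ y y∈ → contradiction (proj₁ (proj₂ (onto y y∈))) ∉∅) (λ y y∈ → contradiction y∈ ∉∅))) base)
          (λ m nm ih t x (f , into , onto) →
            let x′ = imageF ⟨ t ∷ m ∷ [] ⟩
                g = ↾-Fn f (λ _ → ∈adjoinˡ)
            in subst (λ z → P (z ∷ ρ)) (ext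
                 (λ y y∈ → case to ∈adjoin y∈ of λ
                   { (inj₁ h) → case to ∈Build h of λ { (i , i∈ , _ , refl) → into i (∈adjoinˡ i∈) }
                   ; (inj₂ refl) → into m x∈Sx })
                 (λ y y∈ → case onto y y∈ of λ { (i , i∈ , refl) → case to ∈adjoin i∈ of λ
                   { (inj₁ h) → ∈adjoinˡ (from ∈Build (i , h , tt , refl)) ; (inj₂ refl) → ∈adjoinʳ } }))
               (step x′ (t · m) (ih (t ↾ m) x′ (g ,
                 (λ i i∈ → from ∈Build (i , i∈ , tt , ↾-· f (λ _ → ∈adjoinˡ) i∈)) ,
                 λ y y∈ → case to ∈Build y∈ of λ (i , i∈ , _ , e) →
                   i , i∈ , trans e (sym (↾-· f (λ _ → ∈adjoinˡ) i∈))))))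
          n nn s x e

      fin-∅ : IsFinite ∅
      fin-∅ = ∅ , ∅ , ∅-nat , ∅-Fn , (λ i i∈ → contradiction i∈ ∉∅) , λ y y∈ → contradiction y∈ ∉∅

      fin-adjoin : ∀ {x y} → IsFinite x → IsFinite (adjoin x y)
      fin-adjoin {x} {y} (n , s , nn , f , into , onto) = S n , adjoin s ⟪ n , y ⟫ , S-nat nn , append-Fn f ,
        (λ i i∈ → case to ∈adjoin i∈ of λ
          { (inj₁ h) → subst (_∈ adjoin x y) (sym (append-· f h)) (∈adjoinˡ (into i h))
          ; (inj₂ refl) → subst (_∈ adjoin x y) (sym (append-last f)) ∈adjoinʳ }) ,
        (λ z z∈ → case to ∈adjoin z∈ of λ
          { (inj₁ h) → let i , i∈ , e = onto z h in i , ∈adjoinˡ i∈ , trans e (sym (append-· f i∈))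
          ; (inj₂ refl) → n , x∈Sx , sym (append-last f) })

      removeF : Fun 2
      removeF = sepᶠ (var v0) (¬ᶠ (var v0 ≡ᶠ var v2))

      remove : M → M → M
      remove x y = removeF ⟨ x ∷ y ∷ [] ⟩

      remove-⊆ : ∀ {x y z} → z ⊆ adjoin x y → remove z y ⊆ x
      remove-⊆ h u u∈ = let u∈z , ne = to ∈Sep u∈ in
        [ (λ u∈x → u∈x) , (λ e → contradiction e ne) ] (to ∈adjoin (h u u∈z))

      adjoin-remove : ∀ {y z} → y ∈ z → adjoin (remove z y) y ≡ z
      adjoin-remove {y} {z} y∈ = ext
        (λ u u∈ → case to ∈adjoin u∈ of λ { (inj₁ h) → proj₁ (to ∈Sep h) ; (inj₂ refl) → y∈ })
        (λ u u∈ → case em {u ≡ y} of λ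
          { (yes refl) → ∈adjoinʳ ; (no ne) → ∈adjoinˡ (from ∈Sep (u∈ , ne)) })

      drop-adjoin : ∀ {x y z} → z ⊆ adjoin x y → ¬ (y ∈ z) → z ⊆ x
      drop-adjoin h y∉ u u∈ with to ∈adjoin (h u u∈)
      ... | inj₁ u∈x = u∈x
      ... | inj₂ refl = contradiction u∈ y∉

      fin-⊆ : ∀ {x} → IsFinite x → ∀ z → z ⊆ x → IsFinite z
      fin-⊆ {x} = fin-induction {P = λ { (x ∷ []) → ∀ z → z ⊆ x → IsFinite z }}
        (resp-FO (λ { (x ∷ []) → ⇔-id }) (∀ᵒ (Δ₁⇒FO (⊆-Δ (var v0) (var v1)) ⇒ᵒ finᵒ (var v0)))) []
        (λ z h → subst IsFinite (⊆-antisym (λ u u∈ → contradiction u∈ ∉∅) h) fin-∅)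
        (λ x y ih z h → case em {y ∈ z} of λ
          { (yes y∈) → subst IsFinite (adjoin-remove y∈) (fin-adjoin (ih _ (remove-⊆ h)))
          ; (no y∉) → ih z (drop-adjoin h y∉) })
        x

      fin-∪ : ∀ {a x} → IsFinite a → IsFinite x → IsFinite (a ∪ x)
      fin-∪ {a} {x} fa = fin-induction {P = λ { (x ∷ a ∷ []) → IsFinite (a ∪ x) }}
        (resp-FO (λ { (x ∷ a ∷ []) → ⇔-id }) (finᵒ (var v1 ∪ᶠ var v0))) (a ∷ [])
        (subst IsFinite (ext (λ z z∈ → from ∈∪ (inj₁ z∈))
          (λ z z∈ → [ (λ h → h) , (λ h → contradiction h ∉∅) ] (to ∈∪ z∈))) fa)
        (λ x y ih → subst IsFinite (ext
          (λ z z∈ → case to ∈adjoin z∈ of λ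
            { (inj₁ h) → from ∈∪ ([ inj₁ , (λ h → inj₂ (∈adjoinˡ h)) ] (to ∈∪ h))
            ; (inj₂ refl) → from ∈∪ (inj₂ ∈adjoinʳ) })
          (λ z z∈ → case to ∈∪ z∈ of λ
            { (inj₁ h) → ∈adjoinˡ (from ∈∪ (inj₁ h))
            ; (inj₂ h) → case to ∈adjoin h of λ
              { (inj₁ h) → ∈adjoinˡ (from ∈∪ (inj₂ h)) ; (inj₂ refl) → ∈adjoinʳ } })) (fin-adjoin ih))
        x

      adjoinsF : Fun 2
      adjoinsF = setOf (adjoinᶠ (var v0) (var v2)) (var v0) ⊤ᶠ

      fin-adjoins : ∀ {p} y → IsFinite p → IsFinite (adjoinsF ⟨ p ∷ y ∷ [] ⟩)
      fin-adjoins {p} y = fin-induction {P = λ σ → IsFinite (adjoinsF ⟨ σ ⟩)} (finᵒ adjoinsF) (y ∷ [])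
        (subst IsFinite (ext (λ z z∈ → contradiction z∈ ∉∅)
          (λ z z∈ → contradiction (proj₁ (proj₂ (to ∈Build z∈))) ∉∅)) fin-∅)
        (λ p q ih → subst IsFinite (ext
          (λ z z∈ → case to ∈adjoin z∈ of λ
            { (inj₁ h) → case to ∈Build h of λ (u , u∈ , _ , e) → from ∈Build (u , ∈adjoinˡ u∈ , tt , e)
            ; (inj₂ e) → from ∈Build (q , ∈adjoinʳ , tt , e) })
          (λ z z∈ → case to ∈Build z∈ of λ (u , u∈ , _ , e) → case to ∈adjoin u∈ of λ
            { (inj₁ h) → ∈adjoinˡ (from ∈Build (u , h , tt , e))
            ; (inj₂ refl) → from ∈adjoin (inj₂ e) })) (fin-adjoin ih))
        p

      IsPower : M → M → Set ℓ
      IsPower p x = ∀ z → z ∈ p ⇔ z ⊆ x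

      abstract
        -- Finite induction replaces the missing power set axiom: the subsets of `adjoin x y` are
        -- those of `x` together with the same sets with `y` adjoined.
        fin-power : ∀ x → IsFinite x → ∃[ p ] IsFinite p × IsPower p x
        fin-power = fin-induction {P = λ { (x ∷ []) → ∃[ p ] IsFinite p × IsPower p x }}
          (resp-FO (λ { (x ∷ []) → ⇔-id }) (∃ᵒ (finᵒ (var v0) ∧ᵒ
            ∀ᵒ (Δ₁⇒FO (var v0 ∈ᶠ var v1) ⇔ᵒ Δ₁⇒FO (⊆-Δ (var v0) (var v2)))))) []
          (adjoin ∅ ∅ , fin-adjoin fin-∅ , λ z → mk⇔
            (λ h → case to ∈adjoin h of λ { (inj₁ h) → contradiction h ∉∅ ; (inj₂ refl) → λ u h → h })
            (λ h → from ∈adjoin (inj₂ (⊆-antisym h λ u u∈ → contradiction u∈ ∉∅))))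
          (λ { x y (p , fp , hp) → p ∪ adjoinsF ⟨ p ∷ y ∷ [] ⟩ , fin-∪ fp (fin-adjoins y fp) , λ z → mk⇔
            (λ h → case to ∈∪ h of λ
              { (inj₁ h) → λ u u∈ → ∈adjoinˡ (to (hp z) h u u∈)
              ; (inj₂ h) → case to ∈Build h of λ { (v , v∈ , _ , refl) → λ u u∈ → case to ∈adjoin u∈ of λ
                  { (inj₁ h) → ∈adjoinˡ (to (hp v) v∈ u h) ; (inj₂ refl) → ∈adjoinʳ } } })
            (λ h → case em {y ∈ z} of λ
              { (yes y∈) → from ∈∪ (inj₂ (from ∈Build (remove z y , from (hp _) (remove-⊆ h) , tt , sym (adjoin-remove y∈))))
              ; (no y∉) → from ∈∪ (inj₁ (from (hp z) (drop-adjoin h y∉))) }) })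

      rk : M → M
      rk = rank ∅

      rk-nat : ∀ x → Nat (rk x)
      rk-nat x = ordinal⇒nat (rk x) (rank-ordinal ∅-ordinal x)

      -- Iterated power sets of ∅, the finite stages V_n: a set of rank at most n has only elements
      -- of rank below n, so it is a subset of the previous stage.
      bounded-rank : ∀ n → Nat n → ∃[ v ] IsFinite v × (∀ x → rk x ∈ n → x ∈ v)
      bounded-rank = nat-induction {P = λ { (n ∷ []) → ∃[ v ] IsFinite v × (∀ x → rk x ∈ n → x ∈ v) }}
        (resp-FO (λ { (n ∷ []) → ⇔-id }) (∃ᵒ (finᵒ (var v0) ∧ᵒ
          ∀ᵒ (Δ₁⇒FO (comp rankᶠ (var v0 ∷ ∅ᶠ ∷ []) ∈ᶠ var v2) ⇒ᵒ Δ₁⇒FO (var v0 ∈ᶠ var v1))))) []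
        (∅ , fin-∅ , λ x h → contradiction h ∉∅)
        (λ { n nn (v , fv , hv) → let p , fp , hp = fin-power v fv in p , fp , λ x h → from (hp x) λ y y∈ →
          hv y (case to ∈adjoin h of λ
            { (inj₁ h) → nat-transitive nn _ h _ (rank-∈ y∈) ; (inj₂ e) → subst (rk y ∈_) e (rank-∈ y∈) }) })

      abstract
        -- Ranks are natural numbers here, so the elements of `x` all lie in one finite stage.
        all-finite : ∀ x → IsFinite x
        all-finite x = let v , fv , hv = bounded-rank (rk x) (rk-nat x) in fin-⊆ fv x λ y y∈ → hv y (rank-∈ y∈)

    abstract
      private
        Power : M → M
        Power x = proj₁ (fin-power x (all-finite x))

        ∈Power : ∀ {x z} → z ∈ Power x ⇔ z ⊆ x
        ∈Power = proj₂ (proj₂ (fin-power _ (all-finite _))) _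

    private
      -- "Every subset of x belongs to p" quantifies over all sets. Since subsets are finite, it can
      -- be replaced by a bounded condition: p contains ∅ and is closed under adjoining elements of
      -- x.
      Powerᶠ : Fun 1
      Powerᶠ ⟨ x ∷ [] ⟩ = Power x
      Powerᶠ .graph = graph-of (Powerᶠ ⟨_⟩)
        (∅ᶠ ∈ᶠ var v0 ∧ᶠ ∀∈ᶠ (var v0) (⊆-Δ (var v0) (var v2)) ∧ᶠ
         ∀∈ᶠ (var v0) (∀∈ᶠ (var v2) (adjoinᶠ (var v1) (var v0) ∈ᶠ var v2)))
        λ { p (x ∷ []) → mk⇔
          (λ (b , h , c) → ext (λ z z∈ → from ∈Power (h z z∈)) (λ z z∈ →
            fin-induction {P = λ { (z ∷ p ∷ x ∷ []) → z ⊆ x → z ∈ p }}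
              (resp-FO (λ { (z ∷ p ∷ x ∷ []) → ⇔-id }) (Δ₁⇒FO (⊆-Δ (var v0) (var v2) ⇒ᶠ var v0 ∈ᶠ var v1)))
              (p ∷ x ∷ []) (λ _ → b)
              (λ z y ih h → c z (ih λ u u∈ → h u (∈adjoinˡ u∈)) y (h y ∈adjoinʳ))
              z (all-finite z) (to ∈Power z∈)))
          (λ { refl → from ∈Power (λ u u∈ → contradiction u∈ ∉∅) , (λ z → to ∈Power) ,
            λ z z∈ a a∈ → from ∈Power λ u u∈ → case to ∈adjoin u∈ of λ
              { (inj₁ h) → to ∈Power z∈ u h ; (inj₂ refl) → a∈ } }) }

      -- The defining formula is x = s(0) ∨ ... ∨ x = s(n-1), possibly of nonstandard length; every
      -- coordinate carries the flag `equals` and no other.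
      ⊆-definable : ∀ {A z} → z ⊆ A → IsFinite z → DefinableSubset A z
      ⊆-definable {A} {z} z⊆A (n , s , nn , f , into , onto) = clauses-subset flag nn
            (from (∈Tup nn) (f , λ i i∈ → z⊆A _ (into i i∈))) λ x → mk⇔
            (λ x∈ → let i , i∈ , e = onto x x∈ in z⊆A x x∈ , i , i∈ , equals , i∈ , sym e)
            (λ { (_ , i , i∈ , equals , _ , refl) → into i i∈
               ; (_ , _ , _ , contains , h , _) → contradiction h ∉∅
               ; (_ , _ , _ , belongs , h , _) → contradiction h ∉∅ })
        where
        flag : Kind → M
        flag equals   = n
        flag contains = ∅
        flag belongs  = ∅

      open Hierarchy Powerᶠ (⇔-trans ∈Power (mk⇔ (λ h → ⊆-definable h (all-finite _))
        λ (_ , _ , _ , _ , _ , _ , sec) x x∈ → proj₁ (to (sec x) x∈)))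

      x∈L : ∀ x → x ∈ L (S (rk x))
      x∈L = ∈-induction {P = λ { (x ∷ []) → x ∈ L (S (rk x)) }}
        (resp-FO (λ { (x ∷ []) → ⇔-id }) (Δ₁⇒FO (var v0 ∈ᶠ comp Lᶠ (Sᶠ (comp rankᶠ (var v0 ∷ ∅ᶠ ∷ [])) ∷ [])))) []
        -- Each level is followed by its full power set, so `x ⊆ L (rk x)` is enough; the doubled
        -- successor in the rank gives this inclusion.
        λ x ih → subst (x ∈_) (sym L-S) (from ∈Power λ y y∈ → L-mono (S-rank-∈ y∈) y (ih y y∈))

    embeds : EmbedsInto𝐋
    embeds = (λ x → x) , record
      { into = λ x → constructible (S-ordinal (rank-ordinal ∅-ordinal x)) (x∈L x)
      ; injective = λ e → e
      ; ∈-iff = λ x y → ⇔-id }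

-- Models with an inductive set: markers and the embedding.

module WithInfinity
  {ℓ : Level} (em : ExcludedMiddle ℓ) (𝓜 : Structure ℓ) (kp : IsKPModel 𝓜) where
  open WithoutInfinity em 𝓜 kp public
  open DefinablePowerSet em 𝓜 kp using (module Infinite)
  open Structure 𝓜 renaming (Carrier to M)

  double : ℕ → ℕ
  double zero    = zero
  double (suc k) = suc (suc (double k))

  double-injective : ∀ {i j} → double i ≡ double j → i ≡ j
  double-injective {zero}  {zero}  e = refl
  double-injective {suc i} {suc j} e = cong suc (double-injective (suc-injective (suc-injective e)))

  odd≢even : ∀ {i j} → suc (double i) ≢ double j
  odd≢even {suc i} {suc j} e = odd≢even (suc-injective (suc-injective e))

  module _ (B : ℕ → Set ℓ) {C : Set ℓ} (f : ℕ → C) where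
    -- The recursion is external and excluded middle decides each `B k`. The result is a genuinely
    -- finite list, although the property selecting it need not be definable in 𝓜.
    select : ℕ → List C
    select zero = []
    select (suc k) with em {B k}
    ... | yes _ = f k ∷ select k
    ... | no _  = select k

    Any-select : ∀ {R : C → Set ℓ} i → Any R (select i) ⇔ (∃[ k ] k < i × B k × R (f k))
    Any-select {R} i = mk⇔ (⇒ i) (λ (k , k< , b , r) → ⇐ i k< b r)
      where
      ⇒ : ∀ i → Any R (select i) → ∃[ k ] k < i × B k × R (f k)
      ⇒ (suc i) h with em {B i}
      ⇒ (suc i) (here r)  | yes b = i , n<1+n i , b , r
      ⇒ (suc i) (there h) | yes b = let k , k< , r = ⇒ i h in k , m≤n⇒m≤1+n k< , r
      ⇒ (suc i) h         | no _  = let k , k< , r = ⇒ i h in k , m≤n⇒m≤1+n k< , r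
      ⇐ : ∀ i {k} → k < i → B k → R (f k) → Any R (select i)
      ⇐ (suc i) k< b r with em {B i} | m<1+n⇒m<n∨m≡n k<
      ... | yes _ | inj₁ k<i  = there (⇐ i k<i b r)
      ... | yes _ | inj₂ refl = here r
      ... | no _  | inj₁ k<i  = ⇐ i k<i b r
      ... | no nb | inj₂ refl = contradiction b nb

    All-select : ∀ {R : C → Set ℓ} i → (∀ k → R (f k)) → All R (select i)
    All-select zero h = []
    All-select (suc i) h with em {B i}
    ... | yes _ = h i ∷ All-select i h
    ... | no _  = All-select i h

  module InfiniteCase (countable : Countable 𝓜) (has-inductive : ∃[ w ] Inductive w) where
    private
      code : M → ℕ
      code = Injection.to countable

      code-injective : ∀ {x y} → code x ≡ code y → x ≡ y
      code-injective = Injection.injective countable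

      ω : M
      ω = proj₁ (Δ₁-separation (nat-Δ (var v0)) [] (proj₁ has-inductive))

      ∈ω : ∀ {n} → n ∈ ω ⇔ Nat n
      ∈ω {n} = mk⇔ (λ h → proj₂ (to (sep n) h)) (λ nn → from (sep n) (inside n nn , nn))
        where
        w = proj₁ has-inductive
        sep : ∀ n → n ∈ ω ⇔ (n ∈ w × Nat n)
        sep = proj₂ (Δ₁-separation (nat-Δ (var v0)) [] w)
        inside : ∀ n → Nat n → n ∈ w
        inside = nat-induction {P = λ { (n ∷ w ∷ []) → n ∈ w }}
          (resp-FO (λ { (n ∷ w ∷ []) → ⇔-id }) (Δ₁⇒FO (var v0 ∈ᶠ var v1))) (w ∷ [])
          (proj₁ (proj₂ has-inductive)) (λ k _ → proj₂ (proj₂ has-inductive) k)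

      ω-ordinal : Ordinal ω
      ω-ordinal = (λ n n∈ k k∈ → from ∈ω (∈-nat (to ∈ω n∈) k∈)) , λ n n∈ → nat-transitive (to ∈ω n∈)

      open Infinite ω ∈ω
      open Hierarchy Defᶠ ∈Def

      height : M → M
      height = rank ω

      -- Zermelo's numerals rather than von Neumann's: a singleton has one element, so membership
      -- links only neighbouring numerals, and skipping every other one yields an antichain.
      ζ : ℕ → M
      ζ zero    = ∅
      ζ (suc k) = sing (ζ k)

      ζ-level : ∀ k → ∃[ n ] Nat n × ζ k ∈ L n
      ζ-level zero = S ∅ , S-nat ∅-nat , subst (∅ ∈_) (sym L-S)
        (from ∈Def (list-definable [] [] λ x → mk⇔ (λ h → contradiction h ∉∅) λ ()))
      ζ-level (suc k) = let n , nn , h = ζ-level k in S n , S-nat nn , subst (ζ (suc k) ∈_) (sym L-S)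
        (from ∈Def (list-definable ((equals , ζ k) ∷ []) (h ∷ []) λ x → mk⇔
          (λ x∈ → case to ∈sing x∈ of λ { refl → h , here refl }) λ { (_ , here refl) → sing-self }))

      ζ∈L : ∀ k x → ζ k ∈ L (height x)
      ζ∈L k x = let n , nn , h = ζ-level k in L-mono (base⊆rank n (from ∈ω nn)) _ h

      ζ-injective : ∀ i j → ζ i ≡ ζ j → i ≡ j
      ζ-injective zero    zero    e = refl
      ζ-injective zero    (suc j) e = contradiction (subst (ζ j ∈_) (sym e) sing-self) ∉∅
      ζ-injective (suc i) zero    e = contradiction (subst (ζ i ∈_) e sing-self) ∉∅
      ζ-injective (suc i) (suc j) e = cong suc (ζ-injective i j (to ∈sing (subst (ζ i ∈_) e sing-self)))

      ζ-∈ : ∀ i j → ζ i ∈ ζ j → suc i ≡ j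
      ζ-∈ i zero    h = contradiction h ∉∅
      ζ-∈ i (suc j) h = cong suc (ζ-injective i j (to ∈sing h))

      data Label : Set where
        p q : ℕ → Label

      number : Label → ℕ
      number (p k) = double k
      number (q k) = suc (double k)

      number-injective : ∀ {l m} → number l ≡ number m → l ≡ m
      number-injective {p i} {p j} e = cong p (double-injective e)
      number-injective {q i} {q j} e = cong q (double-injective (suc-injective e))
      number-injective {p i} {q j} e = contradiction (sym e) odd≢even
      number-injective {q i} {p j} e = contradiction e odd≢even

    abstract
      private
        -- ζ i ∈ ζ j only for j = i + 1, so the even indices give an antichain for ∈.
        marker : Label → M
        marker l = ζ (double (number l))

        marker-injective : ∀ {l m} → marker l ≡ marker m → l ≡ m
        marker-injective e = number-injective (double-injective (ζ-injective _ _ e))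

        marker∉marker : ∀ {l m} → ¬ (marker l ∈ marker m)
        marker∉marker {l} {m} h = odd≢even {number l} {number m} (ζ-∈ _ _ h)

        marker∈L : ∀ l x → marker l ∈ L (height x)
        marker∈L l = ζ∈L (double (number l))

    private
      -- Phrased on codes so that `select` can run through all numbers below a code; a number that
      -- codes no element satisfies neither.
      Above Below : M → ℕ → Set ℓ
      Above a k = ∃[ b ] code b ≡ k × a ∈ b
      Below a k = ∃[ b ] code b ≡ k × b ∈ a

      -- With i the code of `a`, the `equals` entries make up Pᵢ and the `contains` entries Qᵢ.
      clauses-of : M → List (Kind × M)
      clauses-of a = (equals , marker (q (code a))) ∷ (contains , marker (p (code a))) ∷
        select (Above a) (λ k → equals , marker (p k)) (code a) ++ᴸ
        select (Below a) (λ k → contains , marker (q k)) (code a)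

      clauses-in-L : ∀ a → All (λ (c , x) → x ∈ L (height a)) (clauses-of a)
      clauses-in-L a = marker∈L _ a ∷ marker∈L _ a ∷ All-++
        (All-select (Above a) _ (code a) λ k → marker∈L _ a) (All-select (Below a) _ (code a) λ k → marker∈L _ a)

    abstract
      private
        j : M → M
        j a = proj₁ (list-set (clauses-of a) (clauses-in-L a))

        ∈j′ : ∀ a x → x ∈ j a ⇔ (x ∈ L (height a) × Any (λ (c , y) → Rel c y x) (clauses-of a))
        ∈j′ a = proj₂ (list-set (clauses-of a) (clauses-in-L a))

    private
      data Joins (a x : M) : Set ℓ where
        is-q  : x ≡ marker (q (code a)) → Joins a x
        is-p  : ∀ {k} → k < code a → Above a k → x ≡ marker (p k) → Joins a x
        has-p : marker (p (code a)) ∈ x → Joins a x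
        has-q : ∀ {k} → k < code a → Below a k → marker (q k) ∈ x → Joins a x

      joins : ∀ a x → Any (λ (c , y) → Rel c y x) (clauses-of a) ⇔ Joins a x
      joins a x = mk⇔
        (λ { (here e) → is-q (sym e)
           ; (there (here h)) → has-p h
           ; (there (there h)) → case Any-++⁻ _ h of λ
             { (inj₁ h) → let k , k< , b , e = to (Any-select (Above a) _ (code a)) h in is-p k< b (sym e)
             ; (inj₂ h) → let k , k< , b , e = to (Any-select (Below a) _ (code a)) h in has-q k< b e } })
        (λ { (is-q e) → here (sym e)
           ; (has-p h) → there (here h)
           ; (is-p k< b e) → there (there (Any-++ˡ (from (Any-select (Above a) _ (code a)) (_ , k< , b , sym e))))
           ; (has-q k< b h) → there (there (Any-++ʳ _ (from (Any-select (Below a) _ (code a)) (_ , k< , b , h)))) })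

      ∈j : ∀ {a x} → x ∈ j a ⇔ (x ∈ L (height a) × Joins a x)
      ∈j {a} {x} = ⇔-trans (∈j′ a x) (⇔-id ×-⇔ joins a x)

      j∈L : ∀ a → j a ∈ L (S (height a))
      j∈L a = subst (j a ∈_) (sym L-S) (from ∈Def (list-definable (clauses-of a) (clauses-in-L a) (∈j′ a)))

      q∈j : ∀ {a} → marker (q (code a)) ∈ j a
      q∈j {a} = from ∈j (marker∈L _ a , is-q refl)

      -- The q-marker identifies the element: the clauses that look inside a set fail for markers by
      -- the antichain property, and injectivity of labels leaves only `is-q`. Injectivity of `j`
      -- and the `has-q` case of `j-reflects` follow from this.
      q∈j⁻ : ∀ {a k} → marker (q k) ∈ j a → k ≡ code a
      q∈j⁻ {a} h with proj₂ (to ∈j h)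
      ... | has-p h′     = contradiction h′ marker∉marker
      ... | has-q _ _ h′ = contradiction h′ marker∉marker
      ... | is-q e with marker-injective e
      ...   | refl = refl
      q∈j⁻ {a} h | is-p _ _ e with marker-injective e
      ...   | ()

      -- Only the clause `is-p` can admit a p-marker, and this clause carries the recorded
      -- membership fact with it.
      p∈j⁻ : ∀ {a k} → marker (p k) ∈ j a → Above a k
      p∈j⁻ {a} h with proj₂ (to ∈j h)
      ... | has-p h′     = contradiction h′ marker∉marker
      ... | has-q _ _ h′ = contradiction h′ marker∉marker
      ... | is-q e with marker-injective e
      ...   | ()
      p∈j⁻ {a} h | is-p _ b e with marker-injective e
      ...   | refl = b

      j-reflects : ∀ {a b} → j b ∈ j a → b ∈ a
      j-reflects {a} {b} h with proj₂ (to ∈j h)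
      -- `j b` contains its own q-marker, so by the antichain property it is not a marker; the next
      -- case is the same.
      ... | is-q e     = contradiction (subst (marker (q (code b)) ∈_) e q∈j) marker∉marker
      ... | is-p _ _ e = contradiction (subst (marker (q (code b)) ∈_) e q∈j) marker∉marker
      -- The p-marker of `a` entered `j b` because `b` belongs to the element with that code, which
      -- is `a`.
      ... | has-p h′   = let c , e , b∈c = p∈j⁻ h′ in subst (b ∈_) (code-injective e) b∈c
      ... | has-q _ (c , e , c∈a) h′ = subst (_∈ a) (code-injective (trans e (q∈j⁻ h′))) c∈a

      j-preserves : ∀ {a b} → b ∈ a → j b ∈ j a
      j-preserves {a} {b} b∈a = from ∈j (L-mono (S-rank-∈ b∈a) _ (j∈L b) , connected)
        where
        connected : Joins a (j b)
        connected with <-cmp (code b) (code a)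
        -- Whichever code is larger carries the information. Here the definition of `j a` names the
        -- q-marker of `b`.
        ... | tri< b<a _ _ = has-q b<a (b , refl , b∈a) q∈j
        ... | tri≈ _ e _   = contradiction (subst (_∈ a) (code-injective e) b∈a) ∈-irrefl
        -- Here `j b` has recorded `b ∈ a` by containing the p-marker of `a`, for which the
        -- definition of `j a` always asks.
        ... | tri> _ _ a<b = has-p (from ∈j (marker∈L _ b , is-p a<b (a , refl , b∈a) refl))

    embeds : EmbedsInto𝐋
    embeds = j , record
      { into = λ a → constructible (S-ordinal (rank-ordinal ω-ordinal a)) (j∈L a)
      ; injective = λ {a} {b} e → code-injective (q∈j⁻ (subst (marker (q (code a)) ∈_) e q∈j))
      ; ∈-iff = λ x y → mk⇔ j-preserves j-reflects }

theorem1 : ∀ {ℓ} → ExcludedMiddle ℓ →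
    (𝓜 : Structure ℓ) → Countable 𝓜 → IsKPModel 𝓜 →
    ∃[ j ] IsEmbeddingInto 𝓜 (IsConstructible 𝓜) j
theorem1 em 𝓜 countable kp with em {∃[ w ] WithoutInfinity.Inductive em 𝓜 kp w}
... | yes h = WithInfinity.InfiniteCase.embeds em 𝓜 kp countable h
... | no nh = WithoutInfinity.Finite.embeds em 𝓜 kp nh
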